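{- Let $\mathcal{K}$ be a FUR-class, let $\mathbb{M}$ be a monster model for $\mathcal{K}$, and suppose $A\subseteq B\subseteq C\subseteq D\subset\mathbb{M}$. Then the following hold (for $a,b\in\mathbb{M}$). (i) Local character: for each $a$ there is some finite $A_0\subseteq A$ such that $a\downarrow_{A_0}A$. (ii) Finite character: if $a\not\downarrow_A B$, then there is some $b\in B$ such that $a\not\downarrow_A b$. (iii) Stationarity: if $Lt(a/A)=Lt(b/A)$, $a\downarrow_A B$ and $b\downarrow_A B$, then $Lt(a/B)=Lt(b/B)$. (iv) Extension: for every $a$ there is some $b$ such that $Lt(b/A)=Lt(a/A)$ and $b\downarrow_A B$. (v) Monotonicity: if $a\downarrow_A D$, then $a\downarrow_B C$. (vi) Transitivity: if $a\downarrow_A B$ and $a\downarrow_B C$, then $a\downarrow_A C$. (vii) Symmetry: if $a\downarrow_A b$, then $b\downarrow_A a$. (viii) $U$-ranks: $a\downarrow_A B$ if and only if $U(a/B)=U(a/A)$. (ix) Finiteness of $U$-rank: for all $a$, $U(a/\emptyset)<\omega$. (x) Addition of ranks: for all $a,b$, $U(ab/A)=U(a/bA)+U(b/A)$. (xi) Independence of bcl: if $a\in\mathrm{bcl}(A)$, then $a\downarrow_A B$. (xii) Reflexivity: if $a\in\mathrm{bcl}(B)\setminus\mathrm{bcl}(A)$, then $a\not\downarrow_A B$. (xiii) Local character of bcl: if $a\in\mathrm{bcl}(A)$, then there is some finite $A_0\subseteq A$ such that $a\in\mathrm{bcl}(A_0)$. (xiv) Closure: $\mathrm{bcl}(\mathrm{bcl}(A))=\mathrm{bcl}(A)$.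 (xv) Models are closed: if $\mathcal{A}$ is a model, then $\mathrm{bcl}(\mathcal{A})=\mathcal{A}$.
   Context: SETTING. $(\mathcal{K},\preccurlyeq)$ is an abstract elementary class (AEC) with monster model $\mathbb{M}$: a $\delta$-model homogeneous and $\delta$-universal member of $\mathcal{K}$, $\delta$ a large cardinal. "Bounded" means of size $<\delta$. "Model" means $\mathcal{A}\in\mathcal{K}$, $\mathcal{A}\preccurlyeq\mathbb{M}$; models and parameter sets are bounded. $a\in X$ may be a finite tuple; juxtaposition denotes union or concatenation. TYPES. $\mathrm{Aut}(\mathbb{M}/A)$ is the group of automorphisms of $\mathbb{M}$ fixing $A$ pointwise. $a,b$ have the same Galois type over $A$, $t^g(a/A)=t^g(b/A)$, if $f(a)=b$ for some $f\in\mathrm{Aut}(\mathbb{M}/A)$; they have the same weak type, $t(a/A)=t(b/A)$, if $t^g(a/B)=t^g(b/B)$ for all finite $B\subseteq A$ (types of models are types of enumerations). For $A\subseteq B$ with $A$ finite, $t(a/B)$ splits over $A$ if there are $b,c\in B$ with $t(b/A)=t(c/A)$ but $t(ab/A)\ne t(ac/A)$. $a\downarrow^{ns}_B C$ means that $t(a/B\cup C)$ does not split over some finite $A\subseteq B$; $A\downarrow^{ns}_B C$ means $a\downarrow^{ns}_BC$ for each $a\in A$. FUR-CLASS. $\mathcal{K}$ is a FUR-class if it has AP and JEP, $LS(\mathcal{K})=\omega$, has arbitrarily large structures, contains no finite models, and satisfies: (AI) Every countable model $\mathcal{A}$ is s-saturated: for any $b\in\mathbb{M}$ and finite $A\subseteq\mathcal{A}$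 there is $a\in\mathcal{A}$ with $t(a/A)=t(b/A)$. (AII) For all $a$ and countable $\mathcal{A}$ there is an s-primary model $\mathcal{B}=\mathcal{A}a\cup\bigcup_{i<\omega}a_i$ over $\mathcal{A}a$. [s-primary: the $a_i$ are singletons and for all $n<\omega$ there is a finite $A_n\subset\mathcal{A}$ such that for all $(a',a_0',\dots,a_n')$ with $t(a'/\mathcal{A})=t(a/\mathcal{A})$: $t(a',a_0',\dots,a_n'/A_n)=t(a,a_0,\dots,a_n/A_n)$ implies $t(a',a_0',\dots,a_n'/\mathcal{A})=t(a,a_0,\dots,a_n/\mathcal{A})$.] (AIII) Let $\mathcal{A},\mathcal{B},\mathcal{C}$ be models with $\mathcal{A}\downarrow^{ns}_{\mathcal{B}}\mathcal{C}$ and $\mathcal{B}=\mathcal{A}\cap\mathcal{C}$. Then there is a unique (not only up to isomorphism) s-prime model $\mathcal{D}$ over $\mathcal{A}\cup\mathcal{C}$; furthermore, if $\mathcal{C}\subseteq\mathcal{C}'$ and $\mathcal{A}\downarrow^{ns}_{\mathcal{B}}\mathcal{C}'$, then $\mathcal{D}\downarrow^{ns}_{\mathcal{C}}\mathcal{C}'$. [For models $\mathcal{A}_i$, $i<\alpha$, and $A=\bigcup_{i<\alpha}\mathcal{A}_i$, a map $f:A\to\mathbb{M}$ is weakly elementary w.r.t. $(\mathcal{A}_i)_{i<\alpha}$ if $t(a/\emptyset)=t(f(a)/\emptyset)$ for all $a\in A$ and $f(\mathcal{A}_i)\preccurlyeq\mathbb{M}$ for all $i$. A model $\mathcal{D}$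 is s-prime over $A$ if for every model $\mathcal{B}$ and every $f:A\to\mathcal{B}$ weakly elementary w.r.t. $(\mathcal{A}_i)_{i<\alpha}$ there is an elementary embedding $g:\mathcal{D}\to\mathcal{B}$ with $f\subseteq g$.] (AIV) For each $a\in\mathbb{M}$ there is $n<\omega$ such that for every countable model $\mathcal{A}$ and finite $A\subset\mathcal{A}$, player II has a winning strategy in $GI(a,A,\mathcal{A})$ in $n$ moves. [$GI(a,A,\mathcal{A})$: start with $a_0=a$, $A_0=A$. At move $n$, player I chooses $a_{n+1}\in\mathbb{M}$ and a finite $A_{n+1}'\subseteq\mathcal{A}$ with $t(a_{n+1}/A_n)=t(a_n/A_n)$, $A_n\subseteq A'_{n+1}$ and $t(a_{n+1}/A'_{n+1})\ne t(a_n/A'_{n+1})$; then player II chooses a finite $A_{n+1}\subseteq\mathcal{A}$ with $A'_{n+1}\subseteq A_{n+1}$. Player II wins if player I can no longer move.] (AV) If $\mathcal{A}\subseteq\mathcal{B}$ are countable models, $a\in\mathbb{M}$ and $\mathcal{B}\downarrow^{ns}_{\mathcal{A}}a$, then $a\downarrow^{ns}_{\mathcal{A}}\mathcal{B}$. (AVI) For all models $\mathcal{A},\mathcal{B},\mathcal{D}$ with $\mathcal{A}\subseteq\mathcal{B}\cap\mathcal{D}$ there is a model $\mathcal{C}$ with $t(\mathcal{C}/\mathcal{A})=t(\mathcal{B}/\mathcal{A})$ and $\mathcal{C}\downarrow^{ns}_{\mathcal{A}}\mathcal{D}$. LASCAR TYPES AND INDEPENDENCE. For finite $A$, $E(A)$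 is the set of equivalence relations on powers $\mathbb{M}^n$ that are invariant under $\mathrm{Aut}(\mathbb{M}/A)$ and have boundedly many classes. $Lt(a/B)=Lt(b/B)$ means $(a,b)\in E$ for all finite $A\subseteq B$ and $E\in E(A)$. For $A\subseteq B$ with $A$ finite, $t(a/B)$ Lascar splits over $A$ if there are $b,c\in B$ with $Lt(b/A)=Lt(c/A)$ but $t(ab/A)\ne t(ac/A)$. $a\downarrow_B C$ means: there is a finite $A\subseteq B$ such that for all $D\supseteq B\cup C$ there is some $b$ with $t(b/B\cup C)=t(a/B\cup C)$ such that $t(b/D)$ does not Lascar split over $A$. $U$-RANK. For a model $\mathcal{A}$: $U(a/\mathcal{A})\ge0$ always; $U(a/\mathcal{A})\ge n+1$ if there is a model $\mathcal{B}\supseteq\mathcal{A}$ with $a\not\downarrow^{ns}_{\mathcal{A}}\mathcal{B}$ and $U(a/\mathcal{B})\ge n$; $U(a/\mathcal{A})$ is the largest $n$ such that $U(a/\mathcal{A})\ge n$. For finite $A$, $U(a/A)=\max\{U(a/\mathcal{A}):\mathcal{A}\supset A\text{ a model}\}$. For arbitrary $A$, $U(a/A)=\min\{U(a/B):B\subseteq A\text{ finite}\}$ (this is consistent with the previous cases). BOUNDED CLOSURE. $a\in\mathrm{bcl}(A)$ iff $t(a/A)$ has only boundedly many realizations. -}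

module Defs where

open import Level using (Level; _⊔_) renaming (suc to lsuc)
open import Data.Bool.Base using (Bool; if_then_else_)
open import Data.Fin.Base using (Fin; toℕ)
open import Data.Nat.Base using (ℕ; zero; suc; _≤_)
open import Data.Product.Base using (Σ; Σ-syntax; ∃; ∃₂; _×_; _,_)
open import Data.Sum.Base using (_⊎_)
open import Data.Unit.Polymorphic using (⊤)
open import Data.Vec.Base as Vec using (Vec; []; _∷_; _++_; map; lookup; tabulate)
open import Data.Vec.Membership.Propositional using () renaming (_∈_ to _∈ᵛ_)
open import Data.Vec.Relation.Unary.All using (All)
open import Function.Base using (_∘_)
open import Function.Bundles using (_↣_; _⇔_)
open import Function.Definitions using (Injective; StrictlySurjective)
open import Induction.WellFounded using (WellFounded)
open import Relation.Binary.Construct.Add.Supremum.NonStrict _≤_ using (_≤⁺_)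
open import Relation.Binary.Core using (Rel)
open import Relation.Binary.PropositionalEquality.Core using (_≡_; _≗_)
open import Relation.Binary.Structures using (IsEquivalence; IsStrictTotalOrder)
open import Relation.Nullary.Construct.Add.Supremum using (_⁺; ⊤⁺) renaming ([_] to fin)
open import Relation.Nullary.Negation.Core using (¬_)
open import Relation.Unary using (Pred; _∈_; _⊆_; _≐_; _∪_; _∩_; _⊢_)

image : ∀ {a} {X Y : Set a} → (X → Y) → Pred X a → Pred Y a
image f P y = ∃ λ x → P x × f x ≡ y

range : ∀ {a b} {X : Set a} {Y : Set b} → (X → Y) → Pred Y (a ⊔ b)
range f y = ∃ λ x → f x ≡ y

-- Cardinals are represented by types.

_≺_ : ∀ {a b} → Set a → Set b → Set (a ⊔ b)
X ≺ Y = (X ↣ Y) × ¬ (Y ↣ X)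

record IsInaccessible {ℓ} (Δ : Set ℓ) : Set (lsuc ℓ) where
  field
    uncountable : ℕ ≺ Δ
    regular     : (I : Set ℓ) (F : I → Set ℓ) → I ≺ Δ → (∀ i → F i ≺ Δ) → Σ I F ≺ Δ
    strongLimit : (X : Set ℓ) → X ≺ Δ → (X → Bool) ≺ Δ

record Language (ℓ : Level) : Set (lsuc ℓ) where
  field
    Fun : Set ℓ
    Rln : Set ℓ
    funArity : Fun → ℕ
    rlnArity : Rln → ℕ

record Structure {ℓ} (L : Language ℓ) : Set (lsuc ℓ) where
  open Language L
  field
    ∣_∣ : Set ℓ
    fun : (f : Fun) → Vec ∣_∣ (funArity f) → ∣_∣
    rln : (r : Rln) → Pred (Vec ∣_∣ (rlnArity r)) ℓ

open Structure public using (∣_∣)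

module _ {ℓ} {L : Language ℓ} where
  open Language L
  open Structure using (fun; rln)

  record IsEmbedding (A B : Structure L) (h : ∣ A ∣ → ∣ B ∣) : Set ℓ where
    field
      injective : Injective _≡_ _≡_ h
      pres-fun  : ∀ f v → h (fun A f v) ≡ fun B f (map h v)
      pres-rln  : ∀ r v → rln A r v ⇔ rln B r (map h v)

  IsIsomorphism : (A B : Structure L) → (∣ A ∣ → ∣ B ∣) → Set ℓ
  IsIsomorphism A B h = IsEmbedding A B h × StrictlySurjective _≡_ h

  ClosedUnderFunctions : (B : Structure L) → Pred ∣ B ∣ ℓ → Set ℓ
  ClosedUnderFunctions B X = ∀ f v → All X v → fun B f v ∈ X

-- A substructure of B is given by its universe X, a subset of ∣ B ∣, and
-- "B ≽ X" says that this substructure is ≼ B.  A structure A on another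
-- carrier is compared with B through an embedding i : A → B, which makes
-- it a copy of the substructure with universe range i; closure under
-- isomorphism makes the choice of the copy immaterial.

record AEC {ℓ} (L : Language ℓ) : Set (lsuc ℓ) where
  infix 4 _≽_
  field
    K   : Structure L → Set ℓ
    _≽_ : (B : Structure L) → Pred ∣ B ∣ ℓ → Set ℓ

  IsElementary : (A B : Structure L) → (∣ A ∣ → ∣ B ∣) → Set ℓ
  IsElementary A B h = IsEmbedding A B h × B ≽ range h

  -- |A| ≤ |X| + |Λ|, where X = range s and s is injective.
  LöwenheimSkolem : ∀ {λ′} → Set λ′ → Set (lsuc ℓ ⊔ λ′)
  LöwenheimSkolem Λ =
    ∀ (B : Structure L) → K B → (I : Set ℓ) (s : I → ∣ B ∣) → Injective _≡_ _≡_ s →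
    Σ[ A ∈ Structure L ] Σ[ h ∈ (∣ A ∣ → ∣ B ∣) ]
      K A × IsElementary A B h × range s ⊆ range h × (∣ A ∣ ↣ (I ⊎ Λ))

  field
    ≽-resp-≐ : ∀ {B X Y} → X ≐ Y → B ≽ X → B ≽ Y

    K-iso : ∀ {A B h} → IsIsomorphism A B h → K A → K B
    ≽-iso : ∀ {A B h X} → IsIsomorphism A B h → A ≽ X → B ≽ image h X

    ≽⇒K            : ∀ {B X} → B ≽ X → K B
    ≽⇒K-sub        : ∀ {A B i X} → IsEmbedding A B i → range i ≐ X → B ≽ X → K A
    ≽⇒substructure : ∀ {B X} → B ≽ X → ClosedUnderFunctions B X

    -- Antisymmetry holds by itself, subsets being compared by ≐.
    ≽-refl  : ∀ {B} → K B → B ≽ λ _ → ⊤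
    ≽-trans : ∀ {A B i X} → IsElementary A B i → A ≽ X → B ≽ image i X

    -- Chains are indexed by nonempty well-orders.  The members S i are
    -- compared inside V, the union of the chain: e j ⊢ range (e i) is the
    -- copy of the i-th member in S j.
    chain :
      {I : Set ℓ} {_<_ : Rel I ℓ} → IsStrictTotalOrder _≡_ _<_ → WellFounded _<_ → I →
      (S : I → Structure L) → (∀ i → K (S i)) →
      (V : Structure L) (e : ∀ i → ∣ S i ∣ → ∣ V ∣) → (∀ i → IsEmbedding (S i) V (e i)) →
      (∀ v → ∃ λ i → v ∈ range (e i)) →
      (∀ {i j} → i < j → range (e i) ⊆ range (e j) × S j ≽ (e j ⊢ range (e i))) →
      K V
      × (∀ i → V ≽ range (e i))
      × (∀ (B : Structure L) (h : ∣ V ∣ → ∣ B ∣) → K B → IsEmbedding V B h →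
           (∀ i → B ≽ range (h ∘ e i)) → B ≽ range h)

    coherence : ∀ {B C i X} → IsElementary B C i → C ≽ image i X → B ≽ X

    löwenheimSkolem : Σ[ Λ ∈ Set ℓ ] (ℕ ↣ Λ) × LöwenheimSkolem Λ

module _ {ℓ} {L : Language ℓ} (𝒦 : AEC L) where
  open AEC 𝒦

  AmalgamationProperty : Set (lsuc ℓ)
  AmalgamationProperty =
    ∀ {A B C : Structure L} {f : ∣ A ∣ → ∣ B ∣} {g : ∣ A ∣ → ∣ C ∣} →
    K A → K B → K C → IsElementary A B f → IsElementary A C g →
    Σ[ D ∈ Structure L ] Σ[ h ∈ (∣ B ∣ → ∣ D ∣) ] Σ[ k ∈ (∣ C ∣ → ∣ D ∣) ]
      K D × IsElementary B D h × IsElementary C D k × h ∘ f ≗ k ∘ g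

  JointEmbeddingProperty : Set (lsuc ℓ)
  JointEmbeddingProperty =
    ∀ {A B : Structure L} → K A → K B →
    Σ[ D ∈ Structure L ] Σ[ h ∈ (∣ A ∣ → ∣ D ∣) ] Σ[ k ∈ (∣ B ∣ → ∣ D ∣) ]
      K D × IsElementary A D h × IsElementary B D k

  ArbitrarilyLarge : Set (lsuc ℓ)
  ArbitrarilyLarge = (X : Set ℓ) → Σ[ A ∈ Structure L ] K A × (X ↣ ∣ A ∣)

  NoFiniteModels : Set (lsuc ℓ)
  NoFiniteModels = (A : Structure L) → K A → ∀ n → ¬ (∣ A ∣ ↣ Fin n)

  -- δ is the cardinality of Δ; "large" is read as strongly inaccessible.
  record Monster : Set (lsuc ℓ) where
    field
      𝕄            : Structure L
      𝕄∈K          : K 𝕄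
      Δ            : Set ℓ
      inaccessible : IsInaccessible Δ
      universal    : ∀ A → K A → ∣ A ∣ ≺ Δ → ∃ λ h → IsElementary A 𝕄 h
      homogeneous  :
        ∀ {A B : Structure L} {i : ∣ A ∣ → ∣ 𝕄 ∣} {j : ∣ B ∣ → ∣ 𝕄 ∣} {h : ∣ A ∣ → ∣ B ∣} →
        K A → K B → ∣ A ∣ ≺ Δ → ∣ B ∣ ≺ Δ → IsElementary A 𝕄 i → IsElementary B 𝕄 j →
        IsIsomorphism A B h → ∃ λ σ → IsIsomorphism 𝕄 𝕄 σ × σ ∘ i ≗ j ∘ h

module MonsterNotions {ℓ} {L : Language ℓ} {𝒦 : AEC L} (monster : Monster 𝒦) where
  open AEC 𝒦
  open Monster monster

  M : Set ℓ
  M = ∣ 𝕄 ∣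

  Subset : Set (lsuc ℓ)
  Subset = Pred M ℓ

  infix 4 _∈ᵗ_

  _∈ᵗ_ : ∀ {n} → Vec M n → Subset → Set ℓ
  a ∈ᵗ X = All X a

  -- The finite set enumerated by a tuple.  Finite subsets A of X are
  -- always given as tuples A ∈ᵗ X.
  ⟪_⟫ : ∀ {n} → Vec M n → Subset
  ⟪ a ⟫ x = x ∈ᵛ a

  -- |P| < δ.  Functions on P and into P are written as functions on M and
  -- into M, since Σ M P would also count the proofs of membership.
  Bounded : Subset → Set ℓ
  Bounded P =
    (Σ[ f ∈ (M → Δ) ] (∀ {x y} → x ∈ P → y ∈ P → f x ≡ f y → x ≡ y))
    × ¬ (Σ[ g ∈ (Δ → M) ] Injective _≡_ _≡_ g × range g ⊆ P)

  record Model : Set (lsuc ℓ) where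
    field
      str        : Structure L
      str∈K      : K str
      ι          : ∣ str ∣ → M
      elementary : IsElementary str 𝕄 ι
      bounded    : ∣ str ∣ ≺ Δ

  open Model

  ⌊_⌋ : Model → Subset
  ⌊ 𝒜 ⌋ = range (ι 𝒜)

  Countable : Model → Set ℓ
  Countable 𝒜 = ∣ str 𝒜 ∣ ↣ ℕ

  IsAutomorphismOver : Subset → (M → M) → Set ℓ
  IsAutomorphismOver A σ = IsIsomorphism 𝕄 𝕄 σ × (∀ {x} → x ∈ A → σ x ≡ x)

  SameGaloisType : ∀ {i} {I : Set i} (a b : I → M) → Subset → Set (ℓ ⊔ i)
  SameGaloisType a b A = ∃ λ σ → IsAutomorphismOver A σ × σ ∘ a ≗ b

  -- Equality of weak types.
  SameType : ∀ {i} {I : Set i} (a b : I → M) → Subset → Set (ℓ ⊔ i)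
  SameType a b A = ∀ {k} (B : Vec M k) → B ∈ᵗ A → SameGaloisType a b ⟪ B ⟫

  infix 4 _≡ᵗ_over_

  _≡ᵗ_over_ : ∀ {n} (a b : Vec M n) → Subset → Set ℓ
  a ≡ᵗ b over A = SameType (lookup a) (lookup b) A

  Splits : ∀ {n k} → Vec M n → Subset → Vec M k → Set ℓ
  Splits a B A =
    ∃ λ m → Σ[ b ∈ Vec M m ] Σ[ c ∈ Vec M m ] b ∈ᵗ B × c ∈ᵗ B
      × b ≡ᵗ c over ⟪ A ⟫ × ¬ (a ++ b ≡ᵗ a ++ c over ⟪ A ⟫)

  infix 4 _↓ⁿˢ[_]_ _⇓ⁿˢ[_]_

  _↓ⁿˢ[_]_ : ∀ {n} → Vec M n → Subset → Subset → Set ℓ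
  a ↓ⁿˢ[ B ] C = ∃ λ k → Σ[ A ∈ Vec M k ] A ∈ᵗ B × ¬ Splits a (B ∪ C) A

  _⇓ⁿˢ[_]_ : Subset → Subset → Subset → Set ℓ
  A ⇓ⁿˢ[ B ] C = ∀ {n} (a : Vec M n) → a ∈ᵗ A → a ↓ⁿˢ[ B ] C

  initial : (ℕ → M) → (n : ℕ) → Vec M (suc n)
  initial s n = tabulate (s ∘ toℕ)

  IsPrimary : ∀ {k} (ℬ 𝒜 : Model) → Vec M k → (ℕ → M) → Set ℓ
  IsPrimary {k} ℬ 𝒜 a s =
    (⌊ ℬ ⌋ ≐ ⌊ 𝒜 ⌋ ∪ ⟪ a ⟫ ∪ range s)
    × (∀ n → ∃ λ m → Σ[ Aₙ ∈ Vec M m ] Aₙ ∈ᵗ ⌊ 𝒜 ⌋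
         × (∀ (a′ : Vec M k) (s′ : Vec M (suc n)) → a′ ≡ᵗ a over ⌊ 𝒜 ⌋ →
              a′ ++ s′ ≡ᵗ a ++ initial s n over ⟪ Aₙ ⟫ →
              a′ ++ s′ ≡ᵗ a ++ initial s n over ⌊ 𝒜 ⌋))

  ⋃ : ∀ {i} {I : Set i} → (I → Model) → Pred M (ℓ ⊔ i)
  ⋃ 𝒜 x = ∃ λ i → x ∈ ⌊ 𝒜 i ⌋

  -- Maps defined on ⋃ 𝒜 are represented by maps on M, of which only the
  -- values on ⋃ 𝒜 are used.
  IsWeaklyElementary : ∀ {i} {I : Set i} → (I → Model) → (M → M) → Set (ℓ ⊔ i)
  IsWeaklyElementary 𝒜 f =
    (∀ {n} (a : Vec M n) → All (⋃ 𝒜) a → a ≡ᵗ map f a over ⟪ [] ⟫)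
    × (∀ i → 𝕄 ≽ image f ⌊ 𝒜 i ⌋)

  IsPrime : ∀ {i} {I : Set i} → (I → Model) → Model → Set (lsuc ℓ ⊔ i)
  IsPrime 𝒜 𝒟 =
    ∀ (ℬ : Model) (f : M → M) → (∀ {x} → x ∈ ⋃ 𝒜 → f x ∈ ⌊ ℬ ⌋) → IsWeaklyElementary 𝒜 f →
    ∃ λ g → IsElementary (str 𝒟) (str ℬ) g
      × (∀ {x} → x ∈ ⋃ 𝒜 → ∃ λ d → ι 𝒟 d ≡ x × ι ℬ (g d) ≡ f x)

  pair : Model → Model → Bool → Model
  pair 𝒜 𝒞 b = if b then 𝒜 else 𝒞

  -- WinsGI n 𝒜 a A: player II has a strategy in the game from the position
  -- (a , A) after which player I can make at most n moves.

  Move : ∀ {m k k′} (𝒜 : Model) (a : Vec M m) (A : Vec M k) (a′ : Vec M m) (A′ : Vec M k′) → Set ℓ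
  Move 𝒜 a A a′ A′ =
    A′ ∈ᵗ ⌊ 𝒜 ⌋ × a′ ≡ᵗ a over ⟪ A ⟫ × ⟪ A ⟫ ⊆ ⟪ A′ ⟫ × ¬ (a′ ≡ᵗ a over ⟪ A′ ⟫)

  WinsGI : ∀ {m k} → ℕ → Model → Vec M m → Vec M k → Set ℓ
  WinsGI {m} zero 𝒜 a A =
    ∀ {k′} (a′ : Vec M m) (A′ : Vec M k′) → ¬ Move 𝒜 a A a′ A′
  WinsGI {m} (suc n) 𝒜 a A =
    ∀ {k′} (a′ : Vec M m) (A′ : Vec M k′) → Move 𝒜 a A a′ A′ →
    ∃ λ k″ → Σ[ A″ ∈ Vec M k″ ] A″ ∈ᵗ ⌊ 𝒜 ⌋ × ⟪ A′ ⟫ ⊆ ⟪ A″ ⟫ × WinsGI n 𝒜 a′ A″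

  record IsFUR : Set (lsuc ℓ) where
    field
      amalgamation     : AmalgamationProperty 𝒦
      jointEmbedding   : JointEmbeddingProperty 𝒦
      -- LS(𝒦) = ω, the least infinite cardinal.
      LS≡ω             : LöwenheimSkolem ℕ
      arbitrarilyLarge : ArbitrarilyLarge 𝒦
      noFiniteModels   : NoFiniteModels 𝒦

      AI : ∀ (𝒜 : Model) → Countable 𝒜 → ∀ {n k} (b : Vec M n) (A : Vec M k) → A ∈ᵗ ⌊ 𝒜 ⌋ →
        Σ[ a ∈ Vec M n ] a ∈ᵗ ⌊ 𝒜 ⌋ × a ≡ᵗ b over ⟪ A ⟫

      AII : ∀ {n} (a : Vec M n) (𝒜 : Model) → Countable 𝒜 →
        Σ[ ℬ ∈ Model ] Σ[ s ∈ (ℕ → M) ] IsPrimary ℬ 𝒜 a s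

      AIII : ∀ (𝒜 ℬ 𝒞 : Model) → ⌊ 𝒜 ⌋ ⇓ⁿˢ[ ⌊ ℬ ⌋ ] ⌊ 𝒞 ⌋ → ⌊ ℬ ⌋ ≐ ⌊ 𝒜 ⌋ ∩ ⌊ 𝒞 ⌋ →
        Σ[ 𝒟 ∈ Model ] IsPrime (pair 𝒜 𝒞) 𝒟
          × (∀ 𝒟′ → IsPrime (pair 𝒜 𝒞) 𝒟′ → ⌊ 𝒟′ ⌋ ≐ ⌊ 𝒟 ⌋)
          × (∀ (𝒞′ : Model) → ⌊ 𝒞 ⌋ ⊆ ⌊ 𝒞′ ⌋ → ⌊ 𝒜 ⌋ ⇓ⁿˢ[ ⌊ ℬ ⌋ ] ⌊ 𝒞′ ⌋ →
               ⌊ 𝒟 ⌋ ⇓ⁿˢ[ ⌊ 𝒞 ⌋ ] ⌊ 𝒞′ ⌋)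

      AIV : ∀ {m} (a : Vec M m) → ∃ λ n →
        ∀ (𝒜 : Model) → Countable 𝒜 → ∀ {k} (A : Vec M k) → A ∈ᵗ ⌊ 𝒜 ⌋ → WinsGI n 𝒜 a A

      AV : ∀ (𝒜 ℬ : Model) → Countable 𝒜 → Countable ℬ → ⌊ 𝒜 ⌋ ⊆ ⌊ ℬ ⌋ →
        ∀ {n} (a : Vec M n) → ⌊ ℬ ⌋ ⇓ⁿˢ[ ⌊ 𝒜 ⌋ ] ⟪ a ⟫ → a ↓ⁿˢ[ ⌊ 𝒜 ⌋ ] ⌊ ℬ ⌋

      -- t(𝒞/𝒜) = t(ℬ/𝒜) for some enumeration of 𝒞 by the carrier of ℬ.
      AVI : ∀ (𝒜 ℬ 𝒟 : Model) → ⌊ 𝒜 ⌋ ⊆ ⌊ ℬ ⌋ ∩ ⌊ 𝒟 ⌋ →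
        Σ[ 𝒞 ∈ Model ] Σ[ e ∈ (∣ str ℬ ∣ → M) ]
          range e ≐ ⌊ 𝒞 ⌋ × SameType e (ι ℬ) ⌊ 𝒜 ⌋ × ⌊ 𝒞 ⌋ ⇓ⁿˢ[ ⌊ 𝒜 ⌋ ] ⌊ 𝒟 ⌋

  record E {k} (A : Vec M k) (n : ℕ) : Set (lsuc ℓ) where
    field
      R           : Rel (Vec M n) ℓ
      equivalence : IsEquivalence R
      invariant   : ∀ {σ} → IsAutomorphismOver ⟪ A ⟫ σ → ∀ {a b} → R a b → R (map σ a) (map σ b)
      -- R has fewer than δ classes: they are told apart by fewer than δ labels.
      boundedly   : Σ[ X ∈ Set ℓ ] X ≺ Δ × Σ[ c ∈ (Vec M n → X) ] (∀ {a b} → c a ≡ c b → R a b)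

  infix 4 _≡ᴸ_over_

  _≡ᴸ_over_ : ∀ {n} (a b : Vec M n) → Subset → Set (lsuc ℓ)
  _≡ᴸ_over_ {n} a b B = ∀ {k} (A : Vec M k) → A ∈ᵗ B → (e : E A n) → E.R e a b

  LascarSplits : ∀ {n k} → Vec M n → Subset → Vec M k → Set (lsuc ℓ)
  LascarSplits a B A =
    ∃ λ m → Σ[ b ∈ Vec M m ] Σ[ c ∈ Vec M m ] b ∈ᵗ B × c ∈ᵗ B
      × b ≡ᴸ c over ⟪ A ⟫ × ¬ (a ++ b ≡ᵗ a ++ c over ⟪ A ⟫)

  infix 4 _↓[_]_

  _↓[_]_ : ∀ {n} → Vec M n → Subset → Subset → Set (lsuc ℓ)
  _↓[_]_ {n} a B C =
    ∃ λ k → Σ[ A ∈ Vec M k ] A ∈ᵗ B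
      × (∀ (D : Subset) → Bounded D → B ∪ C ⊆ D →
           Σ[ b ∈ Vec M n ] b ≡ᵗ a over (B ∪ C) × ¬ LascarSplits b D A)

  -- U-ranks are relations "the rank of a over … is u" with values u in
  -- ℕ ∪ {∞}.

  RankAtLeast : ∀ {n} → ℕ → Vec M n → Model → Set (lsuc ℓ)
  RankAtLeast zero    a 𝒜 = ⊤
  RankAtLeast (suc m) a 𝒜 =
    Σ[ ℬ ∈ Model ] ⌊ 𝒜 ⌋ ⊆ ⌊ ℬ ⌋ × ¬ (a ↓ⁿˢ[ ⌊ 𝒜 ⌋ ] ⌊ ℬ ⌋) × RankAtLeast m a ℬ

  RankModel : ∀ {n} → Vec M n → Model → ℕ ⁺ → Set (lsuc ℓ)
  RankModel a 𝒜 (fin m) = RankAtLeast m a 𝒜 × (∀ m′ → RankAtLeast m′ a 𝒜 → m′ ≤ m)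
  RankModel a 𝒜 ⊤⁺      = ∀ m → RankAtLeast m a 𝒜

  -- The maximum of U(a/𝒜) over the models 𝒜 ⊃ A.
  RankFinite : ∀ {n k} → Vec M n → Vec M k → ℕ ⁺ → Set (lsuc ℓ)
  RankFinite a A u =
    (Σ[ 𝒜 ∈ Model ] A ∈ᵗ ⌊ 𝒜 ⌋ × RankModel a 𝒜 u)
    × (∀ (𝒜 : Model) v → A ∈ᵗ ⌊ 𝒜 ⌋ → RankModel a 𝒜 v → v ≤⁺ u)

  -- The minimum of U(a/B) over the finite B ⊆ A.
  Rank : ∀ {n} → Vec M n → Subset → ℕ ⁺ → Set (lsuc ℓ)
  Rank a A u =
    (∃ λ k → Σ[ B ∈ Vec M k ] B ∈ᵗ A × RankFinite a B u)
    × (∀ {k} (B : Vec M k) v → B ∈ᵗ A → RankFinite a B v → u ≤⁺ v)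

  -- Bounded closure

  bcl : Subset → Subset
  bcl A x = Bounded (λ y → y ∷ [] ≡ᵗ x ∷ [] over A)

{-# OPTIONS --safe #-}

-- If t(a/𝒜) split over every finite subset of a model 𝒜, player I could move for ever
-- in the game of AIV: an automorphism between countable models turns every failure of
-- independence into a move.  So types over models have finite bases, and the ranks
-- U(a/𝒜) of a tuple a are bounded.  Over models, AV and AVI make ↓ⁿˢ symmetric and
-- transitive and give free extensions, which can be chosen to preserve the rank.
--
-- Every class of a relation in E(A) meets every model containing A, so that the type
-- over a countable model determines the Lascar type.  A type over a model 𝒟 ⊇ A whose
-- rank is U(a/A) does not Lascar split over A, and by symmetry two types over 𝒟 that do
-- not Lascar split over A agree if their Lascar types over A do.  Hence a ↓[A] B says
-- that U(a/B) = U(a/A).  The remaining statements are about ranks: symmetry is additivity,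
-- whose upper bound uses the primary models of AII, and a ∈ bcl(A) means U(a/A) = 0, which
-- is to say that a lies in every model containing a suitable finite part of A.

module Submission where

open import Defs
open import Axiom.ExcludedMiddle using (ExcludedMiddle)
open import Axiom.Extensionality.Propositional using (Extensionality)
open import Data.Bool.Base using (Bool; true; false; T)
open import Data.Bool.Properties using (T-irrelevant)
open import Data.Fin.Base using (Fin; toℕ; fromℕ<)
open import Data.Fin.Properties using (toℕ-injective; toℕ<n; toℕ-fromℕ<)
open import Data.Nat.Base using (ℕ; zero; suc; _+_; _*_; _⊔_; _≤_; _≤′_; ≤′-refl; ≤′-step; s≤s)
open import Data.Nat.Properties
  using ( suc-injective; *-cancelˡ-≡; even≢odd; m≤m⊔n; m≤n⊔m; n≤1+n; _≤?_; ≤⇒≤′; ≤-pred; ≤-reflexive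
        ; ≤-trans; <⇒≱; ≰⇒>; +-comm; +-suc; +-cancelʳ-≤; +-mono-≤; +-monoˡ-≤ )
open import Data.Product.Base using (∃; ∃₂; Σ-syntax; _×_; _,_; -,_; proj₁; proj₂)
open import Data.Sum.Base using (_⊎_; inj₁; inj₂; [_,_]; [_,_]′)
open import Data.Sum.Function.Propositional using (_⊎-↣_)
open import Data.Sum.Properties using (inj₁-injective; inj₂-injective)
open import Data.Unit.Polymorphic using (⊤; tt)
open import Data.Vec.Base using (Vec; []; _∷_; _++_; map; lookup)
open import Data.Vec.Membership.Propositional using () renaming (_∈_ to _∈ᵛ_)
open import Data.Vec.Membership.Propositional.Properties using (∈-++⁺ˡ; ∈-++⁺ʳ; ∈-tabulate⁺)
open import Data.Vec.Properties
  using ( map-id; map-∘; map-cong; map-++; ++-injective; lookup-map; tabulate-cong; tabulate∘lookup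
        ; ∷-injectiveˡ; ∷-injectiveʳ )
open import Data.Vec.Relation.Unary.All as All using (All; []; _∷_)
open import Data.Vec.Relation.Unary.All.Properties using (++⁺; ++ˡ⁻; ++ʳ⁻; map⁺; tabulate⁺)
open import Data.Vec.Relation.Unary.Any using (here; there; index)
open import Data.Vec.Relation.Unary.Any.Properties using (lookup-index)
open import Function.Base using (_∘_; id)
open import Function.Bundles using (_↣_; _⇔_; Injection; Equivalence; mk↣; mk⇔)
open import Function.Construct.Composition using (_↣-∘_)
open import Function.Definitions using (Injective)
open import Level using (Level; Lift; lift; lower) renaming (_⊔_ to _⊔ˡ_; suc to lsuc)
import Relation.Binary.Construct.Add.Supremum.NonStrict as NonStrict
open import Relation.Binary.PropositionalEquality
  using (_≡_; _≢_; refl; sym; trans; cong; cong₂; subst; subst₂)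
open import Relation.Binary.Structures using (IsEquivalence)
open import Relation.Nullary.Construct.Add.Supremum using (⊤⁺) renaming ([_] to fin)
open import Relation.Nullary.Decidable
  using (Dec; yes; no; isYes; True; toWitness; fromWitness; decidable-stable)
open import Relation.Nullary.Negation.Core using (¬_; contradiction)
open import Relation.Unary using (Pred; _∈_; _⊆_; _≐_; _∪_)

-- Countability

-- Equality of weak types gives an automorphism for each finite set of parameters separately, but
-- none that works over a whole model. Independence is therefore tested on single tuples and finite
-- parts of a model (`_⫝[_]_`), and the automorphisms over a model that are used come from AVI,
-- which presents the free model as the image of ℬ under one of them. AI, AII, AIV and AV speak of
-- countable models. Their consequences reach larger models because a copy of a tuple or a base
-- needs only finitely many elements, and one step of a rank chain only countably many. The relation
-- ↓ quantifies over all bounded sets D. `StableRank` replaces it by a condition on the ranks over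
-- finite sets, after which transitivity and symmetry, for instance, become arithmetic with natural
-- numbers.

pairing : ℕ → ℕ → ℕ
pairing zero    y = suc (2 * y)
pairing (suc x) y = 2 * pairing x y

-- `pairing x y` is 2^x (2y + 1). As it is never 0, the code 0 is free for the empty tuple in
-- `encode`.
pairing≢0 : ∀ x y → pairing x y ≢ 0
pairing≢0 zero    y ()
pairing≢0 (suc x) y eq = pairing≢0 x y (*-cancelˡ-≡ _ 0 2 eq)

pairing-injective : ∀ x x′ {y y′} → pairing x y ≡ pairing x′ y′ → x ≡ x′ × y ≡ y′
pairing-injective zero    zero     {y} {y′} eq = refl , *-cancelˡ-≡ _ _ 2 (suc-injective eq)
pairing-injective zero    (suc x′) {y} {y′} eq = contradiction (sym eq) (even≢odd (pairing x′ y′) y)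
pairing-injective (suc x) zero     {y} {y′} eq = contradiction eq (even≢odd (pairing x y) y′)
pairing-injective (suc x) (suc x′) eq with pairing-injective x x′ (*-cancelˡ-≡ _ _ 2 eq)
... | refl , y≡y′ = refl , y≡y′

module _ {a} {X : Set a} (e : X ↣ ℕ) where

  encode : ∀ {n} → Vec X n → ℕ
  encode []       = 0
  encode (x ∷ xs) = pairing (Injection.to e x) (encode xs)

  encode-injective : ∀ {m n} (xs : Vec X m) (ys : Vec X n) → encode xs ≡ encode ys →
                     _≡_ {A = ∃ (Vec X)} (-, xs) (-, ys)
  encode-injective []       []       eq = refl
  encode-injective []       (y ∷ ys) eq = contradiction (sym eq) (pairing≢0 (Injection.to e y) _)
  encode-injective (x ∷ xs) []       eq = contradiction eq (pairing≢0 (Injection.to e x) _)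
  encode-injective (x ∷ xs) (y ∷ ys) eq with pairing-injective _ _ eq
  ... | p , q with Injection.injective e p | encode-injective xs ys q
  ... | refl | refl = refl

  tuples-countable : ∃ (Vec X) ↣ ℕ
  tuples-countable = mk↣ {to = encode ∘ proj₂} (encode-injective _ _)

⊎-countable : (ℕ ⊎ ℕ) ↣ ℕ
⊎-countable = mk↣ {to = code} code-injective
  where
  code : ℕ ⊎ ℕ → ℕ
  code (inj₁ m) = pairing 0 m
  code (inj₂ n) = pairing 1 n
  code-injective : Injective _≡_ _≡_ code
  code-injective {inj₁ m} {inj₁ n} eq = cong inj₁ (proj₂ (pairing-injective 0 0 {m} {n} eq))
  code-injective {inj₁ m} {inj₂ n} eq with pairing-injective 0 1 {m} {n} eq
  ... | () , _
  code-injective {inj₂ m} {inj₁ n} eq with pairing-injective 1 0 {m} {n} eq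
  ... | () , _
  code-injective {inj₂ m} {inj₂ n} eq = cong inj₂ (proj₂ (pairing-injective 1 1 {m} {n} eq))

-- Functions on a subset that are injective as functions of the element,
-- whatever the proofs of membership.

_InjectsInto_ : ∀ {a p y} {X : Set a} → Pred X p → Set y → Set (a ⊔ˡ p ⊔ˡ y)
P InjectsInto Y =
  Σ[ f ∈ (∀ {x} → x ∈ P → Y) ] (∀ {x x′} (p : x ∈ P) (p′ : x′ ∈ P) → f p ≡ f p′ → x ≡ x′)

module _ {a} {X : Set a} where

  ∪-countable : ∀ {p q} {P : Pred X p} {Q : Pred X q} →
                P InjectsInto ℕ → Q InjectsInto ℕ → (P ∪ Q) InjectsInto ℕ
  ∪-countable {P = P} {Q} (f , f-inj) (g , g-inj) =
    Injection.to ⊎-countable ∘ code , λ p p′ eq → code-injective p p′ (Injection.injective ⊎-countable eq)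
    where
    code : ∀ {x} → x ∈ P ∪ Q → ℕ ⊎ ℕ
    code (inj₁ p) = inj₁ (f p)
    code (inj₂ q) = inj₂ (g q)
    code-injective : ∀ {x x′} (p : x ∈ P ∪ Q) (p′ : x′ ∈ P ∪ Q) → code p ≡ code p′ → x ≡ x′
    code-injective (inj₁ p) (inj₁ p′) eq = f-inj p p′ (inj₁-injective eq)
    code-injective (inj₂ q) (inj₂ q′) eq = g-inj q q′ (inj₂-injective eq)

  range-injects : ∀ {i} {I : Set i} (s : I → X) → range s InjectsInto I
  range-injects s = proj₁ , λ { (_ , refl) (_ , refl) refl → refl }

  ⋃-countable : ∀ {j} {J : Set j} → J ↣ ℕ → (w : J → ∃ (Vec X)) →
                (λ x → ∃ λ j → x ∈ᵛ proj₂ (w j)) InjectsInto ℕ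
  ⋃-countable {J = J} e w = code , λ { (j , x∈) (j′ , x′∈) → code-injective j j′ x∈ x′∈ }
    where
    code : ∀ {x} → (∃ λ j → x ∈ᵛ proj₂ (w j)) → ℕ
    code (j , x∈) = pairing (Injection.to e j) (toℕ (index x∈))
    code-injective : ∀ {x x′} j j′ (x∈ : x ∈ᵛ proj₂ (w j)) (x′∈ : x′ ∈ᵛ proj₂ (w j′)) →
                     code (j , x∈) ≡ code (j′ , x′∈) → x ≡ x′
    code-injective j j′ x∈ x′∈ eq with pairing-injective _ _ eq
    ... | p , q with Injection.injective e p
    ... | refl = trans (lookup-index x∈)
                   (trans (cong (lookup (proj₂ (w j))) (toℕ-injective q)) (sym (lookup-index x′∈)))

-- Automorphisms of the monster model

module Automorphisms {ℓ} {L : Language ℓ} {𝒦 : AEC L} (monster : Monster 𝒦) where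

  open AEC 𝒦
  open Monster monster
  open MonsterNotions monster
  open IsEmbedding

  ↣-≺-trans : ∀ {a b c} {X : Set a} {Y : Set b} {Z : Set c} → X ↣ Y → Y ≺ Z → X ≺ Z
  ↣-≺-trans f (g , ¬g) = g ↣-∘ f , λ h → ¬g (f ↣-∘ h)

  record Aut : Set ℓ where
    constructor mkAut
    field
      to           : M → M
      isomorphism  : IsIsomorphism 𝕄 𝕄 to

  open Aut

  infixr 7 _·_ _⊙_

  _·_ : Aut → M → M
  _·_ = to

  _⊙_ : ∀ {n} → Aut → Vec M n → Vec M n
  σ ⊙ a = map (to σ) a

  ·-injective : ∀ σ {x y} → σ · x ≡ σ · y → x ≡ y
  ·-injective σ = injective (proj₁ (isomorphism σ))

  idᴬ : Aut
  idᴬ = mkAut id (record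
    { injective = id
    ; pres-fun  = λ f v → cong (Structure.fun 𝕄 f) (sym (map-id v))
    ; pres-rln  = λ r v → mk⇔ (subst (Structure.rln 𝕄 r) (sym (map-id v)))
                              (subst (Structure.rln 𝕄 r) (map-id v))
    } , λ y → y , refl)

  embedding-∘ : ∀ {A B C : Structure L} {g : ∣ B ∣ → ∣ C ∣} {f : ∣ A ∣ → ∣ B ∣} →
                IsEmbedding B C g → IsEmbedding A B f → IsEmbedding A C (g ∘ f)
  embedding-∘ {A} {B} {C} {g} {f} G F = record
    { injective = injective F ∘ injective G
    ; pres-fun  = λ s v → trans (cong g (pres-fun F s v)) (trans (pres-fun G s _)
                            (cong (Structure.fun C s) (sym (map-∘ g f v))))
    ; pres-rln  = λ r v → mk⇔
        (λ p → subst (Structure.rln C r) (sym (map-∘ g f v))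
                 (Equivalence.to (pres-rln G r _) (Equivalence.to (pres-rln F r v) p)))
        (λ p → Equivalence.from (pres-rln F r v) (Equivalence.from (pres-rln G r _)
                 (subst (Structure.rln C r) (map-∘ g f v) p)))
    }

  infixr 9 _∘ᴬ_

  _∘ᴬ_ : Aut → Aut → Aut
  σ ∘ᴬ τ = mkAut (to σ ∘ to τ)
    ( embedding-∘ (proj₁ (isomorphism σ)) (proj₁ (isomorphism τ))
    , λ y → let (z , σz≡y) = proj₂ (isomorphism σ) y ; (x , τx≡z) = proj₂ (isomorphism τ) z
            in x , trans (cong (to σ) τx≡z) σz≡y )

  module _ (σ : Aut) where

    private
      s⁻¹ : M → M
      s⁻¹ y = proj₁ (proj₂ (isomorphism σ) y)

      s-s⁻¹ : ∀ y → σ · s⁻¹ y ≡ y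
      s-s⁻¹ y = proj₂ (proj₂ (isomorphism σ) y)

      map-s-s⁻¹ : ∀ {n} (v : Vec M n) → σ ⊙ map s⁻¹ v ≡ v
      map-s-s⁻¹ v = trans (sym (map-∘ (to σ) s⁻¹ v)) (trans (map-cong s-s⁻¹ v) (map-id v))

    infix 10 _⁻¹

    _⁻¹ : Aut
    _⁻¹ = mkAut s⁻¹ (record
      { injective = λ {x} {y} eq → trans (sym (s-s⁻¹ x)) (trans (cong (to σ) eq) (s-s⁻¹ y))
      ; pres-fun  = λ f v → ·-injective σ (trans (s-s⁻¹ _) (sym (trans (pres-fun σ-emb f _)
                              (cong (Structure.fun 𝕄 f) (map-s-s⁻¹ v)))))
      ; pres-rln  = λ r v → mk⇔
          (λ p → Equivalence.from (pres-rln σ-emb r _) (subst (Structure.rln 𝕄 r) (sym (map-s-s⁻¹ v)) p))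
          (λ p → subst (Structure.rln 𝕄 r) (map-s-s⁻¹ v) (Equivalence.to (pres-rln σ-emb r _) p))
      } , λ x → σ · x , ·-injective σ (s-s⁻¹ (σ · x)))
      where σ-emb = proj₁ (isomorphism σ)

    ·-⁻¹ : ∀ x → σ · _⁻¹ · x ≡ x
    ·-⁻¹ = s-s⁻¹

    ⁻¹-· : ∀ x → _⁻¹ · σ · x ≡ x
    ⁻¹-· x = ·-injective σ (·-⁻¹ (σ · x))

    ⊙-⁻¹ : ∀ {n} (v : Vec M n) → σ ⊙ _⁻¹ ⊙ v ≡ v
    ⊙-⁻¹ = map-s-s⁻¹

    ⁻¹-⊙ : ∀ {n} (v : Vec M n) → _⁻¹ ⊙ σ ⊙ v ≡ v
    ⁻¹-⊙ v = trans (sym (map-∘ _ _ v)) (trans (map-cong ⁻¹-· v) (map-id v))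

  ∘ᴬ-⊙ : ∀ σ τ {n} (v : Vec M n) → (σ ∘ᴬ τ) ⊙ v ≡ σ ⊙ τ ⊙ v
  ∘ᴬ-⊙ σ τ v = map-∘ (to σ) (to τ) v

  Fixes : ∀ {p} → Aut → Pred M p → Set (ℓ ⊔ˡ p)
  Fixes σ X = ∀ {x} → x ∈ X → σ · x ≡ x

  module _ {p} {X : Pred M p} where

    Fixes-∘ : ∀ σ τ → Fixes σ X → Fixes τ X → Fixes (σ ∘ᴬ τ) X
    Fixes-∘ σ τ fσ fτ x∈ = trans (cong (to σ) (fτ x∈)) (fσ x∈)

    Fixes-⁻¹ : ∀ σ → Fixes σ X → Fixes (σ ⁻¹) X
    Fixes-⁻¹ σ fσ {x} x∈ = ·-injective σ (trans (·-⁻¹ σ x) (sym (fσ x∈)))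

    Fixes-⊙ : ∀ σ → Fixes σ X → ∀ {n} {v : Vec M n} → All X v → σ ⊙ v ≡ v
    Fixes-⊙ σ fσ []       = refl
    Fixes-⊙ σ fσ (x∈ ∷ v) = cong₂ _∷_ (fσ x∈) (Fixes-⊙ σ fσ v)

  ⊙-Fixes : ∀ σ {n} {v : Vec M n} → σ ⊙ v ≡ v → Fixes σ ⟪ v ⟫
  ⊙-Fixes σ {v = _ ∷ _} eq (here refl) = ∷-injectiveˡ eq
  ⊙-Fixes σ {v = _ ∷ _} eq (there x∈)  = ⊙-Fixes σ (∷-injectiveʳ eq) x∈

  ∈ᵗ-self : ∀ {n} (v : Vec M n) → v ∈ᵗ ⟪ v ⟫
  ∈ᵗ-self []      = []
  ∈ᵗ-self (x ∷ v) = here refl ∷ All.map there (∈ᵗ-self v)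

  ∈ᵗ⇒⊆ : ∀ {p} {X : Pred M p} {n} {v : Vec M n} → All X v → ⟪ v ⟫ ⊆ X
  ∈ᵗ⇒⊆ v∈ x∈ = All.lookup v∈ x∈

  ⊆⇒∈ᵗ : ∀ {p} {X : Pred M p} {n} {v : Vec M n} → ⟪ v ⟫ ⊆ X → All X v
  ⊆⇒∈ᵗ v⊆ = All.map v⊆ (∈ᵗ-self _)

  ++-⊆ˡ : ∀ {m n} {a : Vec M m} {b : Vec M n} → ⟪ a ⟫ ⊆ ⟪ a ++ b ⟫
  ++-⊆ˡ = ∈-++⁺ˡ

  ++-⊆ʳ : ∀ {m n} (a : Vec M m) {b : Vec M n} → ⟪ b ⟫ ⊆ ⟪ a ++ b ⟫
  ++-⊆ʳ a = ∈-++⁺ʳ a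

  ++-⊆ : ∀ {p} {X : Pred M p} {m n} {a : Vec M m} {b : Vec M n} →
         ⟪ a ⟫ ⊆ X → ⟪ b ⟫ ⊆ X → ⟪ a ++ b ⟫ ⊆ X
  ++-⊆ a⊆ b⊆ = ∈ᵗ⇒⊆ (++⁺ (⊆⇒∈ᵗ a⊆) (⊆⇒∈ᵗ b⊆))

  -- Types over finite sets as orbits

  infix 4 _≈[_]_

  _≈[_]_ : ∀ {n k} → Vec M n → Vec M k → Vec M n → Set ℓ
  a ≈[ B ] b = Σ[ σ ∈ Aut ] Fixes σ ⟪ B ⟫ × σ ⊙ a ≡ b

  ≈-refl : ∀ {n k} {a : Vec M n} {B : Vec M k} → a ≈[ B ] a
  ≈-refl = idᴬ , (λ _ → refl) , map-id _

  ≈-sym : ∀ {n k} {a b : Vec M n} {B : Vec M k} → a ≈[ B ] b → b ≈[ B ] a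
  ≈-sym (σ , fσ , refl) = σ ⁻¹ , Fixes-⁻¹ σ fσ , ⁻¹-⊙ σ _

  ≈-trans : ∀ {n k} {a b c : Vec M n} {B : Vec M k} → a ≈[ B ] b → b ≈[ B ] c → a ≈[ B ] c
  ≈-trans (σ , fσ , refl) (τ , fτ , refl) = τ ∘ᴬ σ , Fixes-∘ τ σ fτ fσ , ∘ᴬ-⊙ τ σ _

  ≈-mono : ∀ {n k l} {a b : Vec M n} {A : Vec M k} {B : Vec M l} →
           ⟪ A ⟫ ⊆ ⟪ B ⟫ → a ≈[ B ] b → a ≈[ A ] b
  ≈-mono A⊆B (σ , fσ , eq) = σ , (λ x∈ → fσ (A⊆B x∈)) , eq

  ⊙-∈ : ∀ σ {n} {x} {v : Vec M n} → x ∈ ⟪ v ⟫ → σ · x ∈ ⟪ σ ⊙ v ⟫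
  ⊙-∈ σ (here refl) = here refl
  ⊙-∈ σ (there x∈)  = there (⊙-∈ σ x∈)

  ≈-conj : ∀ σ {n k} {a b : Vec M n} {B : Vec M k} → a ≈[ B ] b → σ ⊙ a ≈[ σ ⊙ B ] σ ⊙ b
  ≈-conj σ {a = a} {B = B} (τ , fτ , refl) = σ ∘ᴬ τ ∘ᴬ σ ⁻¹ , ⊙-Fixes (σ ∘ᴬ τ ∘ᴬ σ ⁻¹) fixes , action a
    where
    action : ∀ {n} (v : Vec M n) → (σ ∘ᴬ τ ∘ᴬ σ ⁻¹) ⊙ σ ⊙ v ≡ σ ⊙ τ ⊙ v
    action v = trans (∘ᴬ-⊙ σ (τ ∘ᴬ σ ⁻¹) _) (cong (σ ⊙_) (trans (∘ᴬ-⊙ τ (σ ⁻¹) _) (cong (τ ⊙_) (⁻¹-⊙ σ v))))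
    fixes : (σ ∘ᴬ τ ∘ᴬ σ ⁻¹) ⊙ σ ⊙ B ≡ σ ⊙ B
    fixes = trans (action B) (cong (σ ⊙_) (Fixes-⊙ τ fτ (∈ᵗ-self B)))

  ≈-⊙ : ∀ σ {n k} {B : Vec M k} → Fixes σ ⟪ B ⟫ → (a : Vec M n) → a ≈[ B ] σ ⊙ a
  ≈-⊙ σ fσ a = σ , fσ , refl

  ++-⊙ : ∀ σ {m n} (a : Vec M m) {a′ : Vec M m} {b b′ : Vec M n} →
         σ ⊙ (a ++ b) ≡ a′ ++ b′ → σ ⊙ a ≡ a′ × σ ⊙ b ≡ b′
  ++-⊙ σ a eq = ++-injective _ _ (trans (sym (map-++ (to σ) a _)) eq)

  ⊙-++ : ∀ σ {m n} (a : Vec M m) {a′ : Vec M m} {b b′ : Vec M n} →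
         σ ⊙ a ≡ a′ → σ ⊙ b ≡ b′ → σ ⊙ (a ++ b) ≡ a′ ++ b′
  ⊙-++ σ a refl refl = map-++ (to σ) a _

  -- Splitting compares a b with a c. With the common part a moved into the parameters, this becomes
  -- a comparison of b with c, the form used from here on.
  ≈-++ˡ : ∀ {m n k} (a : Vec M m) {b c : Vec M n} {B : Vec M k} →
          b ≈[ a ++ B ] c → a ++ b ≈[ B ] a ++ c
  ≈-++ˡ a (σ , fσ , eq) =
    σ , (λ x∈ → fσ (++-⊆ʳ a x∈)) , ⊙-++ σ a (Fixes-⊙ σ fσ (⊆⇒∈ᵗ (++-⊆ˡ {a = a}))) eq

  ≈-++ˡ⁻ : ∀ {m n k} (a : Vec M m) {b c : Vec M n} {B : Vec M k} →
           a ++ b ≈[ B ] a ++ c → b ≈[ a ++ B ] c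
  ≈-++ˡ⁻ a (σ , fσ , eq) = let (eqa , eqb) = ++-⊙ σ a eq in
    σ , ++-⊆ {X = λ x → σ · x ≡ x} {a = a} (⊙-Fixes σ eqa) fσ , eqb

  ≡ᵗ⇒≈ : ∀ {n k} {a b : Vec M n} {X} {B : Vec M k} → a ≡ᵗ b over X → B ∈ᵗ X → a ≈[ B ] b
  ≡ᵗ⇒≈ {a = a} {b} a≡b B∈ = let (σ , (iso , fix) , eq) = a≡b _ B∈ in
    mkAut σ iso , fix , trans (sym (tabulate∘lookup _)) (trans
      (tabulate-cong λ i → trans (lookup-map i σ a) (eq i)) (tabulate∘lookup b))

  ≈⇒≡ᵗ : ∀ {n} {a b : Vec M n} {X} → (∀ {k} (B : Vec M k) → B ∈ᵗ X → a ≈[ B ] b) → a ≡ᵗ b over X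
  ≈⇒≡ᵗ {a = a} a≈b B B∈ = let (σ , fσ , eq) = a≈b B B∈ in
    to σ , (isomorphism σ , fσ) , λ i → trans (sym (lookup-map i (to σ) a)) (cong (λ v → lookup v i) eq)

  ≈⇒≡ᵗ⟪⟫ : ∀ {n k} {a b : Vec M n} {A : Vec M k} → a ≈[ A ] b → a ≡ᵗ b over ⟪ A ⟫
  ≈⇒≡ᵗ⟪⟫ a≈b = ≈⇒≡ᵗ λ B B∈ → ≈-mono (∈ᵗ⇒⊆ B∈) a≈b

  ≡ᵗ⟪⟫⇒≈ : ∀ {n k} {a b : Vec M n} {A : Vec M k} → a ≡ᵗ b over ⟪ A ⟫ → a ≈[ A ] b
  ≡ᵗ⟪⟫⇒≈ a≡b = ≡ᵗ⇒≈ a≡b (∈ᵗ-self _)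

module Independence (em : {a : Level} → ExcludedMiddle a) {ℓ} {L : Language ℓ} {𝒦 : AEC L}
                    (monster : Monster 𝒦) (fur : MonsterNotions.IsFUR monster) where

  open AEC 𝒦
  open Monster monster
  open MonsterNotions monster
  open Automorphisms monster
  open IsEmbedding
  open Aut
  open Model
  open IsFUR fur
  open IsInaccessible inaccessible

  -- Models generated by bounded and by countable sets

  ⊎-≺ : ∀ {X Y : Set ℓ} → X ≺ Δ → Y ≺ Δ → (X ⊎ Y) ≺ Δ
  ⊎-≺ {X} {Y} X≺ Y≺ = ↣-≺-trans (mk↣ {to = tagged} tagged-injective)
    (regular (Lift ℓ Bool) F (↣-≺-trans bool↣ℕ uncountable) λ { (lift true) → X≺ ; (lift false) → Y≺ })
    where
    F : Lift ℓ Bool → Set ℓ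
    F (lift true)  = X
    F (lift false) = Y
    tagged : X ⊎ Y → ∃ F
    tagged (inj₁ x) = lift true , x
    tagged (inj₂ y) = lift false , y
    tagged-injective : Injective _≡_ _≡_ tagged
    tagged-injective {inj₁ _} {inj₁ _} refl = refl
    tagged-injective {inj₂ _} {inj₂ _} refl = refl
    bool↣ℕ : Lift ℓ Bool ↣ ℕ
    bool↣ℕ = mk↣ {to = λ { (lift true) → 0 ; (lift false) → 1 }} λ
      { {lift true} {lift true} _ → refl ; {lift false} {lift false} _ → refl }

  Lift-≺ : ∀ {X : Set} → X ≺ Δ → Lift ℓ X ≺ Δ
  Lift-≺ = ↣-≺-trans (mk↣ {to = lower} λ { {lift _} {lift _} refl → refl })

  Fin-≺ : ∀ n → Fin n ≺ Δ
  Fin-≺ n = ↣-≺-trans (mk↣ {to = toℕ} toℕ-injective) uncountable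

  elementary-∘ : ∀ {B C : Structure L} {h : ∣ B ∣ → ∣ C ∣} {i : ∣ C ∣ → M} →
                 IsElementary C 𝕄 i → IsElementary B C h → IsElementary B 𝕄 (i ∘ h)
  elementary-∘ {h = h} {i} I H =
    embedding-∘ (proj₁ I) (proj₁ H) ,
    ≽-resp-≐ ((λ { (_ , (d , refl) , refl) → d , refl }) , λ { (d , refl) → h d , (d , refl) , refl })
      (≽-trans I (proj₂ H))

  Aut-elementary : ∀ σ → IsElementary 𝕄 𝕄 (to σ)
  Aut-elementary σ = proj₁ (isomorphism σ) ,
    ≽-resp-≐ ((λ _ → proj₂ (isomorphism σ) _) , λ _ → _) (≽-refl 𝕄∈K)

  infixr 7 _⋆_

  _⋆_ : Aut → Model → Model
  σ ⋆ 𝒜 = record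
    { str        = str 𝒜
    ; str∈K      = str∈K 𝒜
    ; ι          = to σ ∘ ι 𝒜
    ; elementary = elementary-∘ (Aut-elementary σ) (elementary 𝒜)
    ; bounded    = bounded 𝒜
    }

  ∈-⋆ : ∀ σ 𝒜 {x} → x ∈ ⌊ 𝒜 ⌋ → σ · x ∈ ⌊ σ ⋆ 𝒜 ⌋
  ∈-⋆ σ 𝒜 (d , refl) = d , refl

  ∈ᵗ-⋆ : ∀ σ 𝒜 {n} {v : Vec M n} → v ∈ᵗ ⌊ 𝒜 ⌋ → σ ⊙ v ∈ᵗ ⌊ σ ⋆ 𝒜 ⌋
  ∈ᵗ-⋆ σ 𝒜 v∈ = map⁺ (All.map (∈-⋆ σ 𝒜) v∈)

  module _ {B : Structure L} {i : ∣ B ∣ → M} (B∈K : K B) (i-elem : IsElementary B 𝕄 i)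
           {P : Subset} (P⊆ : P ⊆ range i) where

    -- The ambient structure `B` is left open: the monster itself yields models around `P`, and a
    -- model 𝒟 yields submodels of 𝒟.
    hull : ∀ {y} {Y : Set y} → P InjectsInto Y → (Y ⊎ ℕ) ≺ Δ →
           Σ[ 𝒞 ∈ Model ] P ⊆ ⌊ 𝒞 ⌋ × ⌊ 𝒞 ⌋ ⊆ range i × (∣ str 𝒞 ∣ ↣ (Y ⊎ ℕ))
    hull {Y = Y} (f , f-inj) bound = 𝒞 , P⊆𝒞 , (λ { (d , refl) → h d , refl }) , size
      where
      -- `True em` has at most one proof, so the projection to `∣ B ∣` is injective, as `LS≡ω`
      -- demands; membership proofs in `P` may be numerous.
      I : Set ℓ
      I = Σ[ b ∈ ∣ B ∣ ] True (em {P = i b ∈ P})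

      equal : {p q : I} → proj₁ p ≡ proj₁ q → p ≡ q
      equal {b , s} {_ , t} refl = cong (b ,_) (T-irrelevant s t)

      ls = LS≡ω B B∈K I proj₁ equal
      C    = proj₁ ls
      h    = proj₁ (proj₂ ls)
      C∈K  = proj₁ (proj₂ (proj₂ ls))
      h-el = proj₁ (proj₂ (proj₂ (proj₂ ls)))
      I⊆C  = proj₁ (proj₂ (proj₂ (proj₂ (proj₂ ls))))
      C↣   = proj₂ (proj₂ (proj₂ (proj₂ (proj₂ ls))))

      I↣Y : I ↣ Y
      I↣Y = mk↣ {to = λ (b , t) → f (toWitness t)} λ eq →
        equal (injective (proj₁ i-elem) (f-inj _ _ eq))

      size : ∣ C ∣ ↣ (Y ⊎ ℕ)
      size = (I↣Y ⊎-↣ mk↣ id) ↣-∘ C↣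

      𝒞 : Model
      𝒞 = record { str = C ; str∈K = C∈K ; ι = i ∘ h
                 ; elementary = elementary-∘ i-elem h-el ; bounded = ↣-≺-trans size bound }

      P⊆𝒞 : P ⊆ ⌊ 𝒞 ⌋
      P⊆𝒞 x∈P with P⊆ x∈P
      ... | b , refl = let (d , hd≡b) = I⊆C ((b , fromWitness x∈P) , refl) in d , cong i hd≡b

    countable-hull : P InjectsInto ℕ → Σ[ 𝒞 ∈ Model ] Countable 𝒞 × P ⊆ ⌊ 𝒞 ⌋ × ⌊ 𝒞 ⌋ ⊆ range i
    countable-hull P↣ℕ = let (𝒞 , P⊆𝒞 , 𝒞⊆ , 𝒞↣) = hull P↣ℕ (↣-≺-trans ⊎-countable uncountable) in
      𝒞 , ⊎-countable ↣-∘ 𝒞↣ , P⊆𝒞 , 𝒞⊆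

  ⟪⟫-countable : ∀ {n} (a : Vec M n) → ⟪ a ⟫ InjectsInto ℕ
  ⟪⟫-countable a = (λ x∈ → toℕ (index x∈)) , λ x∈ y∈ eq →
    trans (lookup-index x∈) (trans (cong (lookup a) (toℕ-injective eq)) (sym (lookup-index y∈)))

  model-countable : ∀ 𝒜 → Countable 𝒜 → ⌊ 𝒜 ⌋ InjectsInto ℕ
  model-countable 𝒜 c = (λ (d , _) → Injection.to c d) , λ { (_ , refl) (_ , refl) eq →
    cong (ι 𝒜) (Injection.injective c eq) }

  abstract

    submodel : ∀ 𝒟 {P : Subset} → P ⊆ ⌊ 𝒟 ⌋ → P InjectsInto ℕ →
               Σ[ 𝒞 ∈ Model ] Countable 𝒞 × P ⊆ ⌊ 𝒞 ⌋ × ⌊ 𝒞 ⌋ ⊆ ⌊ 𝒟 ⌋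
    submodel 𝒟 P⊆ = countable-hull (str∈K 𝒟) (elementary 𝒟) P⊆

    countable-model : ∀ {P : Subset} → P InjectsInto ℕ → Σ[ 𝒞 ∈ Model ] Countable 𝒞 × P ⊆ ⌊ 𝒞 ⌋
    countable-model P↣ℕ =
      let (𝒞 , c , P⊆𝒞 , _) = countable-hull 𝕄∈K (Aut-elementary idᴬ) (λ _ → _ , refl) P↣ℕ in 𝒞 , c , P⊆𝒞

    family-model : ∀ {I : Set ℓ} → I ≺ Δ → (s : I → M) → Σ[ 𝒩 ∈ Model ] range s ⊆ ⌊ 𝒩 ⌋
    family-model I≺ s =
      let (𝒩 , s⊆ , _) = hull 𝕄∈K (Aut-elementary idᴬ) (λ _ → _ , refl) (range-injects s)
                           (↣-≺-trans (mk↣ id ⊎-↣ mk↣ {to = lift} λ { refl → refl })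
                             (⊎-≺ I≺ (Lift-≺ uncountable)))
      in 𝒩 , s⊆

    tuple-model : ∀ {n} (a : Vec M n) → Σ[ 𝒩 ∈ Model ] Countable 𝒩 × a ∈ᵗ ⌊ 𝒩 ⌋
    tuple-model a = let (𝒩 , c , a⊆) = countable-model (⟪⟫-countable a) in 𝒩 , c , ⊆⇒∈ᵗ a⊆

    join : ∀ 𝒜 ℬ → Σ[ 𝒟 ∈ Model ] ⌊ 𝒜 ⌋ ⊆ ⌊ 𝒟 ⌋ × ⌊ ℬ ⌋ ⊆ ⌊ 𝒟 ⌋
    join 𝒜 ℬ = let (𝒟 , s⊆) = family-model (⊎-≺ (bounded 𝒜) (bounded ℬ)) λ { (inj₁ d) → ι 𝒜 d ; (inj₂ d) → ι ℬ d } in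
      𝒟 , (λ { (d , refl) → s⊆ (inj₁ d , refl) }) , (λ { (d , refl) → s⊆ (inj₂ d , refl) })

    extend : ∀ 𝒜 {n} (a : Vec M n) → Σ[ 𝒟 ∈ Model ] ⌊ 𝒜 ⌋ ⊆ ⌊ 𝒟 ⌋ × a ∈ᵗ ⌊ 𝒟 ⌋
    extend 𝒜 a = let (𝒩 , _ , a∈) = tuple-model a ; (𝒟 , 𝒜⊆ , 𝒩⊆) = join 𝒜 𝒩 in
      𝒟 , 𝒜⊆ , All.map 𝒩⊆ a∈

  Bounded⇒⊆model : ∀ {P} → Bounded P → Σ[ 𝒩 ∈ Model ] P ⊆ ⌊ 𝒩 ⌋
  Bounded⇒⊆model {P} ((f , f-inj) , ¬Δ↣P) =
    let (𝒩 , I⊆) = family-model {I = I} (mk↣ {to = f ∘ proj₁} f′-inj , ¬Δ↣I) proj₁ in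
    𝒩 , λ x∈P → I⊆ ((_ , fromWitness x∈P) , refl)
    where
    I : Set ℓ
    I = Σ[ x ∈ M ] True (em {P = x ∈ P})
    equal : {p q : I} → proj₁ p ≡ proj₁ q → p ≡ q
    equal {x , s} {_ , t} refl = cong (x ,_) (T-irrelevant s t)
    f′-inj : {p q : I} → f (proj₁ p) ≡ f (proj₁ q) → p ≡ q
    f′-inj {_ , s} {_ , t} eq = equal (f-inj (toWitness s) (toWitness t) eq)
    ¬Δ↣I : ¬ (Δ ↣ I)
    ¬Δ↣I g = ¬Δ↣P (proj₁ ∘ Injection.to g , (λ eq → Injection.injective g (equal eq)) ,
      λ { (d , refl) → toWitness (proj₂ (Injection.to g d)) })

  ⊆model⇒Bounded : ∀ {P : Subset} 𝒩 → P ⊆ ⌊ 𝒩 ⌋ → Bounded P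
  ⊆model⇒Bounded {P} 𝒩 P⊆ = (f , λ x∈ y∈ → f-inj (P⊆ x∈) (P⊆ y∈)) , ¬Δ↣P
    where
    f : M → Δ
    f x with em {P = x ∈ ⌊ 𝒩 ⌋}
    ... | yes (d , _) = Injection.to (proj₁ (bounded 𝒩)) d
    ... | no _        = Injection.to (proj₁ uncountable) 0
    f-inj : ∀ {x y} → x ∈ ⌊ 𝒩 ⌋ → y ∈ ⌊ 𝒩 ⌋ → f x ≡ f y → x ≡ y
    f-inj {x} {y} x∈ y∈ eq with em {P = x ∈ ⌊ 𝒩 ⌋} | em {P = y ∈ ⌊ 𝒩 ⌋}
    ... | no x∉          | _              = contradiction x∈ x∉
    ... | yes _          | no y∉          = contradiction y∈ y∉
    ... | yes (d , refl) | yes (e , refl) = cong (ι 𝒩) (Injection.injective (proj₁ (bounded 𝒩)) eq)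
    ¬Δ↣P : ¬ (Σ[ g ∈ (Δ → M) ] Injective _≡_ _≡_ g × range g ⊆ P)
    ¬Δ↣P (g , g-inj , g⊆P) = proj₂ (bounded 𝒩) (mk↣ {to = λ d → proj₁ (P⊆ (g⊆P (d , refl)))} λ {d} {e} eq →
      g-inj (trans (sym (proj₂ (P⊆ (g⊆P (d , refl))))) (trans (cong (ι 𝒩) eq) (proj₂ (P⊆ (g⊆P (e , refl)))))))

  -- Homogeneity of countable models

  module _ (𝒜 ℬ : Model) (h : ∣ str 𝒜 ∣ → ∣ str ℬ ∣)
           (locally : ∀ {k} (w : Vec ∣ str 𝒜 ∣ k) → Σ[ σ ∈ Aut ] σ ⊙ map (ι 𝒜) w ≡ map (ι ℬ) (map h w))
           (surjective : ∀ e → ∃ λ d → h d ≡ e) where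

    private
      ιᴬ = proj₁ (elementary 𝒜)
      ιᴮ = proj₁ (elementary ℬ)

      h-embedding : IsEmbedding (str 𝒜) (str ℬ) h
      h-embedding .injective {d} {e} hd≡he = let (σ , eq) = locally (d ∷ e ∷ []) in
        injective ιᴬ (·-injective σ (trans (∷-injectiveˡ eq)
          (trans (cong (ι ℬ) hd≡he) (sym (∷-injectiveˡ (∷-injectiveʳ eq))))))
      h-embedding .pres-fun f v = let (σ , eq) = locally (Structure.fun (str 𝒜) f v ∷ v) in
        injective ιᴮ (trans (sym (∷-injectiveˡ eq))
          (trans (cong (to σ) (pres-fun ιᴬ f v))
          (trans (pres-fun (proj₁ (isomorphism σ)) f _)
          (trans (cong (Structure.fun 𝕄 f) (∷-injectiveʳ eq))
                 (sym (pres-fun ιᴮ f _))))))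
      h-embedding .pres-rln r v = let (σ , eq) = locally v ; R = Structure.rln 𝕄 r in mk⇔
        (λ p → Equivalence.from (pres-rln ιᴮ r _) (subst R eq
                 (Equivalence.to (pres-rln (proj₁ (isomorphism σ)) r _) (Equivalence.to (pres-rln ιᴬ r v) p))))
        (λ p → Equivalence.from (pres-rln ιᴬ r v) (Equivalence.from (pres-rln (proj₁ (isomorphism σ)) r _)
                 (subst R (sym eq) (Equivalence.to (pres-rln ιᴮ r _) p))))

    -- Symbols have finite arity, so a bijection that agrees with some automorphism on each finite
    -- tuple is an isomorphism; model homogeneity then extends it to the monster.
    weakly-elementary⇒Aut : Σ[ σ ∈ Aut ] (∀ d → σ · ι 𝒜 d ≡ ι ℬ (h d))
    weakly-elementary⇒Aut =
      let (s , s-iso , eq) = homogeneous (str∈K 𝒜) (str∈K ℬ) (bounded 𝒜) (bounded ℬ)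
                               (elementary 𝒜) (elementary ℬ) (h-embedding , surjective)
      in mkAut s s-iso , eq

  module BackAndForth (𝒜 ℬ : Model) (cᴬ : Countable 𝒜) (cᴮ : Countable ℬ) where

    -- A finite partial map from 𝒜 to ℬ, stored as an automorphism of which only the values on `dom`
    -- count. Later automorphisms may differ from it elsewhere.
    record State : Set ℓ where
      field
        {size} : ℕ
        dom    : Vec M size
        aut    : Aut
        dom⊆   : dom ∈ᵗ ⌊ 𝒜 ⌋
        cod⊆   : aut ⊙ dom ∈ᵗ ⌊ ℬ ⌋

    open State

    infix 4 _⊑_

    _⊑_ : State → State → Set ℓ
    s ⊑ t = ∀ {x} → x ∈ ⟪ dom s ⟫ → x ∈ ⟪ dom t ⟫ × aut t · x ≡ aut s · x

    ⊑-trans : ∀ {s t u} → s ⊑ t → t ⊑ u → s ⊑ u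
    ⊑-trans s⊑t t⊑u x∈ = let (x∈t , eq) = s⊑t x∈ ; (x∈u , eq′) = t⊑u x∈t in x∈u , trans eq′ eq

    forth : ∀ s {x} → x ∈ ⌊ 𝒜 ⌋ → Σ[ t ∈ State ] s ⊑ t × x ∈ ⟪ dom t ⟫
    -- The image of x may lie outside ℬ. A realization y in ℬ of its type over the images already
    -- chosen is reached by an automorphism τ that fixes those images.
    forth s {x} x∈ with AI ℬ cᴮ (aut s · x ∷ []) (aut s ⊙ dom s) (cod⊆ s)
    ... | y ∷ [] , y∈ ∷ [] , y≡ with ≈-sym (≡ᵗ⟪⟫⇒≈ y≡)
    ... | τ , fix , τσx≡y = record
      { dom  = x ∷ dom s
      ; aut  = τ ∘ᴬ aut s
      ; dom⊆ = x∈ ∷ dom⊆ s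
      ; cod⊆ = subst (_∈ ⌊ ℬ ⌋) (sym (∷-injectiveˡ τσx≡y)) y∈
               ∷ subst (_∈ᵗ ⌊ ℬ ⌋) (sym (trans (∘ᴬ-⊙ τ (aut s) _) (Fixes-⊙ τ fix (∈ᵗ-self _)))) (cod⊆ s)
      } , (λ z∈ → there z∈ , fix (⊙-∈ (aut s) z∈)) , here refl

    back : ∀ s {y} → y ∈ ⌊ ℬ ⌋ → Σ[ t ∈ State ] s ⊑ t × ∃ λ x → x ∈ ⟪ dom t ⟫ × aut t · x ≡ y
    back s {y} y∈ with AI 𝒜 cᴬ (aut s ⁻¹ · y ∷ []) (dom s) (dom⊆ s)
    ... | x ∷ [] , x∈ ∷ [] , x≡ with ≡ᵗ⟪⟫⇒≈ x≡
    ... | τ , fix , τx≡ = record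
      { dom  = x ∷ dom s
      ; aut  = aut s ∘ᴬ τ
      ; dom⊆ = x∈ ∷ dom⊆ s
      ; cod⊆ = subst (_∈ ⌊ ℬ ⌋) (sym στx≡y) y∈
               ∷ subst (_∈ᵗ ⌊ ℬ ⌋) (sym (trans (∘ᴬ-⊙ (aut s) τ _) (cong (aut s ⊙_) (Fixes-⊙ τ fix (∈ᵗ-self _))))) (cod⊆ s)
      } , (λ z∈ → there z∈ , cong (to (aut s)) (fix z∈)) , x , here refl , στx≡y
      where
      στx≡y : aut s · τ · x ≡ y
      στx≡y = trans (cong (to (aut s)) (∷-injectiveˡ τx≡)) (·-⁻¹ (aut s) y)

    codeᴬ = Injection.to cᴬ
    codeᴮ = Injection.to cᴮ

    step : ∀ n s → Σ[ t ∈ State ] s ⊑ t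
           × (∀ d → codeᴬ d ≡ n → ι 𝒜 d ∈ ⟪ dom t ⟫)
           × (∀ e → codeᴮ e ≡ n → ∃ λ x → x ∈ ⟪ dom t ⟫ × aut t · x ≡ ι ℬ e)
    step n s =
      let (t , s⊑t , t∋) = forth? ; (u , t⊑u , u∋) = back? t in
      u , ⊑-trans {s} {t} {u} s⊑t t⊑u , (λ d eq → proj₁ (t⊑u (t∋ d eq))) , u∋
      where
      forth? : Σ[ t ∈ State ] s ⊑ t × (∀ d → codeᴬ d ≡ n → ι 𝒜 d ∈ ⟪ dom t ⟫)
      forth? with em {P = ∃ λ d → codeᴬ d ≡ n}
      ... | no none       = s , (λ x∈ → x∈ , refl) , λ d eq → contradiction (d , eq) none
      ... | yes (d , refl) = let (t , s⊑t , d∈) = forth s (d , refl) in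
        t , s⊑t , λ d′ eq → subst (λ z → ι 𝒜 z ∈ ⟪ dom t ⟫) (sym (Injection.injective cᴬ eq)) d∈
      back? : ∀ t → Σ[ u ∈ State ] t ⊑ u × (∀ e → codeᴮ e ≡ n → ∃ λ x → x ∈ ⟪ dom u ⟫ × aut u · x ≡ ι ℬ e)
      back? t with em {P = ∃ λ e → codeᴮ e ≡ n}
      ... | no none       = t , (λ x∈ → x∈ , refl) , λ e eq → contradiction (e , eq) none
      ... | yes (e , refl) = let (u , t⊑u , e∈) = back t (e , refl) in
        u , t⊑u , λ e′ eq → subst (λ z → ∃ λ x → x ∈ ⟪ dom u ⟫ × aut u · x ≡ ι ℬ z) (sym (Injection.injective cᴮ eq)) e∈

    module _ (start : State) where

      states : ℕ → State
      states zero    = start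
      states (suc n) = proj₁ (step n (states n))

      states-mono : ∀ {m n} → m ≤′ n → states m ⊑ states n
      states-mono ≤′-refl x∈ = x∈ , refl
      states-mono {m} {suc n} (≤′-step m≤n) =
        ⊑-trans {states m} {states n} {states (suc n)} (states-mono m≤n) (proj₁ (proj₂ (step n (states n))))

      agree : ∀ m n {x} → x ∈ ⟪ dom (states m) ⟫ → x ∈ ⟪ dom (states n) ⟫ →
              aut (states m) · x ≡ aut (states n) · x
      agree m n x∈m x∈n = trans (sym (proj₂ (states-mono (≤⇒≤′ (m≤m⊔n m n)) x∈m)))
                                (proj₂ (states-mono (≤⇒≤′ (m≤n⊔m m n)) x∈n))

      -- `step n` treats the elements with code n and its result is `states (suc n)`, hence the
      -- successor.
      stage : ∣ str 𝒜 ∣ → ℕ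
      stage d = suc (codeᴬ d)

      in-stage : ∀ d → ι 𝒜 d ∈ ⟪ dom (states (stage d)) ⟫
      in-stage d = proj₁ (proj₂ (proj₂ (step (codeᴬ d) (states (codeᴬ d))))) d refl

      value : ∀ d → aut (states (stage d)) · ι 𝒜 d ∈ ⌊ ℬ ⌋
      value d = ∈ᵗ⇒⊆ (cod⊆ (states (stage d))) (⊙-∈ (aut (states (stage d))) (in-stage d))

      limit : ∣ str 𝒜 ∣ → ∣ str ℬ ∣
      limit d = proj₁ (value d)

      limit-at : ∀ d n → ι 𝒜 d ∈ ⟪ dom (states n) ⟫ → aut (states n) · ι 𝒜 d ≡ ι ℬ (limit d)
      limit-at d n d∈ = trans (agree n (stage d) d∈ (in-stage d)) (sym (proj₂ (value d)))

      all-in-stage : ∀ {k} (w : Vec ∣ str 𝒜 ∣ k) → ∃ λ n → map (ι 𝒜) w ∈ᵗ ⟪ dom (states n) ⟫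
      all-in-stage []      = 0 , []
      all-in-stage (d ∷ w) = let (n , w∈) = all-in-stage w in
        stage d ⊔ n , proj₁ (states-mono (≤⇒≤′ (m≤m⊔n (stage d) n)) (in-stage d))
                    ∷ All.map (λ x∈ → proj₁ (states-mono (≤⇒≤′ (m≤n⊔m (stage d) n)) x∈)) w∈

      limit-locally : ∀ {k} (w : Vec ∣ str 𝒜 ∣ k) → Σ[ σ ∈ Aut ] σ ⊙ map (ι 𝒜) w ≡ map (ι ℬ) (map limit w)
      limit-locally w = let (n , w∈) = all-in-stage w in aut (states n) , along n w w∈
        where
        along : ∀ n {k} (w : Vec ∣ str 𝒜 ∣ k) → map (ι 𝒜) w ∈ᵗ ⟪ dom (states n) ⟫ →
                aut (states n) ⊙ map (ι 𝒜) w ≡ map (ι ℬ) (map limit w)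
        along n []      []         = refl
        along n (d ∷ w) (d∈ ∷ w∈) = cong₂ _∷_ (limit-at d n d∈) (along n w w∈)

      limit-surjective : ∀ e → ∃ λ d → limit d ≡ e
      limit-surjective e =
        let n = suc (codeᴮ e) ; (x , x∈ , σx≡e) = proj₂ (proj₂ (proj₂ (step (codeᴮ e) (states (codeᴮ e))))) e refl
            (d , ιd≡x) = ∈ᵗ⇒⊆ (dom⊆ (states n)) x∈
        in d , injective (proj₁ (elementary ℬ)) (trans (sym (limit-at d n (subst (_∈ ⟪ dom (states n) ⟫) (sym ιd≡x) x∈)))
                 (trans (cong (to (aut (states n))) ιd≡x) σx≡e))

      limit-aut : Σ[ σ ∈ Aut ] (∀ d → σ · ι 𝒜 d ≡ ι ℬ (limit d))
      limit-aut = weakly-elementary⇒Aut 𝒜 ℬ limit limit-locally limit-surjective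

  abstract

    countable-homogeneous : ∀ 𝒜 ℬ → Countable 𝒜 → Countable ℬ → ∀ {n} {a : Vec M n} τ →
      a ∈ᵗ ⌊ 𝒜 ⌋ → τ ⊙ a ∈ᵗ ⌊ ℬ ⌋ →
      Σ[ σ ∈ Aut ] σ ⊙ a ≡ τ ⊙ a × ⌊ σ ⋆ 𝒜 ⌋ ≐ ⌊ ℬ ⌋
    countable-homogeneous 𝒜 ℬ cᴬ cᴮ {a = a} τ a∈ τa∈ = σ , σa≡ a a∈ (λ x∈ → x∈)
      , (λ { (d , refl) → limit start d , sym (σι d) })
      , λ { (e , refl) → let (d , eq) = limit-surjective start e in d , trans (σι d) (cong (ι ℬ) eq) }
      where
      open BackAndForth 𝒜 ℬ cᴬ cᴮ
      start : State
      start = record { dom = a ; aut = τ ; dom⊆ = a∈ ; cod⊆ = τa∈ }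
      σ : Aut
      σ = proj₁ (limit-aut start)
      σι : ∀ d → σ · ι 𝒜 d ≡ ι ℬ (limit start d)
      σι = proj₂ (limit-aut start)
      σa≡ : ∀ {k} (v : Vec M k) → v ∈ᵗ ⌊ 𝒜 ⌋ → ⟪ v ⟫ ⊆ ⟪ a ⟫ → σ ⊙ v ≡ τ ⊙ v
      σa≡ []      []                v⊆ = refl
      σa≡ (_ ∷ v) ((d , refl) ∷ v∈) v⊆ = cong₂ _∷_
        (trans (σι d) (sym (limit-at start d 0 (v⊆ (here refl))))) (σa≡ v v∈ (λ x∈ → v⊆ (there x∈)))

  -- Splitting and the game GI

  record NS {n k} (a : Vec M n) (A : Vec M k) (X : Subset) : Set ℓ where
    constructor mkNS
    field
      nonsplitting : ∀ {m} {b c : Vec M m} → b ∈ᵗ X → c ∈ᵗ X → b ≈[ A ] c → b ≈[ a ++ A ] c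

  open NS

  ¬Splits⇒NS : ∀ {n k} {a : Vec M n} {A : Vec M k} {X} → ¬ Splits a X A → NS a A X
  ¬Splits⇒NS {a = a} ¬splits = mkNS λ {_} {b} {c} b∈ c∈ b≈c → decidable-stable em λ b≉c →
    ¬splits (-, b , c , b∈ , c∈ , ≈⇒≡ᵗ⟪⟫ b≈c , λ ab≡ac → b≉c (≈-++ˡ⁻ a (≡ᵗ⟪⟫⇒≈ ab≡ac)))

  NS⇒¬Splits : ∀ {n k} {a : Vec M n} {A : Vec M k} {X} → NS a A X → ¬ Splits a X A
  NS⇒¬Splits {a = a} ns (_ , b , c , b∈ , c∈ , b≡c , ab≢ac) =
    ab≢ac (≈⇒≡ᵗ⟪⟫ (≈-++ˡ a (nonsplitting ns b∈ c∈ (≡ᵗ⟪⟫⇒≈ b≡c))))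

  ⊙-preimage : ∀ σ {X : Subset} {n} {v : Vec M n} → All (λ x → ∃ λ y → y ∈ X × σ · y ≡ x) v →
               Σ[ w ∈ Vec M n ] w ∈ᵗ X × σ ⊙ w ≡ v
  ⊙-preimage σ []                     = [] , [] , refl
  ⊙-preimage σ ((y , y∈ , refl) ∷ v∈) = let (w , w∈ , eq) = ⊙-preimage σ v∈ in
    y ∷ w , y∈ ∷ w∈ , cong (_ ∷_) eq

  ≈-conj⁻ : ∀ σ {n k} {a b : Vec M n} {B : Vec M k} → σ ⊙ a ≈[ σ ⊙ B ] σ ⊙ b → a ≈[ B ] b
  ≈-conj⁻ σ {a = a} {b} {B} eq = subst₂ (λ a b → a ≈[ B ] b) (⁻¹-⊙ σ a) (⁻¹-⊙ σ b)
    (subst (λ B → σ ⁻¹ ⊙ σ ⊙ a ≈[ B ] σ ⁻¹ ⊙ σ ⊙ b) (⁻¹-⊙ σ B) (≈-conj (σ ⁻¹) eq))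

  NS-⊙ : ∀ σ {n k} {a : Vec M n} {A : Vec M k} {X X′ : Subset} →
         (∀ {x} → x ∈ X′ → ∃ λ y → y ∈ X × σ · y ≡ x) → NS a A X → NS (σ ⊙ a) (σ ⊙ A) X′
  NS-⊙ σ {a = a} {A} {X} {X′} X′⊆ ns = mkNS λ b∈ c∈ →
    transfer (⊙-preimage σ (All.map X′⊆ b∈)) (⊙-preimage σ (All.map X′⊆ c∈))
    where
    transfer : ∀ {m} {b c : Vec M m} →
               (Σ[ v ∈ Vec M m ] v ∈ᵗ X × σ ⊙ v ≡ b) → (Σ[ w ∈ Vec M m ] w ∈ᵗ X × σ ⊙ w ≡ c) →
               b ≈[ σ ⊙ A ] c → b ≈[ σ ⊙ a ++ σ ⊙ A ] c
    transfer (v , v∈ , refl) (w , w∈ , refl) b≈c =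
      subst (λ B → σ ⊙ v ≈[ B ] σ ⊙ w) (map-++ (to σ) a A)
        (≈-conj σ (nonsplitting ns v∈ w∈ (≈-conj⁻ σ b≈c)))

  ↓ⁿˢ-⊙ : ∀ σ {n} (a : Vec M n) {B C B′ C′ : Subset} → a ↓ⁿˢ[ B ] C →
          (∀ {x} → x ∈ B → σ · x ∈ B′) → (∀ {x} → x ∈ B′ ∪ C′ → ∃ λ y → y ∈ B ∪ C × σ · y ≡ x) →
          σ ⊙ a ↓ⁿˢ[ B′ ] C′
  ↓ⁿˢ-⊙ σ a (_ , A , A∈ , ¬splits) B→B′ X′⊆ =
    -, σ ⊙ A , map⁺ (All.map B→B′ A∈) , NS⇒¬Splits (NS-⊙ σ X′⊆ (¬Splits⇒NS {a = a} ¬splits))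

  Splits-mono : ∀ {n k} (a : Vec M n) {A : Vec M k} {X Y} → X ⊆ Y → Splits a X A → Splits a Y A
  Splits-mono a X⊆Y (_ , b , c , b∈ , c∈ , s) = -, b , c , All.map X⊆Y b∈ , All.map X⊆Y c∈ , s

  ↓ⁿˢ-mono : ∀ {n} (a : Vec M n) {B C B′ C′ : Subset} → B ⊆ B′ → B′ ∪ C′ ⊆ B ∪ C →
             a ↓ⁿˢ[ B ] C → a ↓ⁿˢ[ B′ ] C′
  ↓ⁿˢ-mono a B⊆B′ X′⊆X (_ , A , A∈ , ¬splits) =
    -, A , All.map B⊆B′ A∈ , λ s → ¬splits (Splits-mono a X′⊆X s)

  -- The game is played in countable models, and so is AII applied; both need a rank chain whose
  -- members are countable.
  CountableRankAtLeast : ∀ {n} → ℕ → Vec M n → Model → Set (lsuc ℓ)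
  CountableRankAtLeast zero    a 𝒜 = ⊤
  CountableRankAtLeast (suc m) a 𝒜 = Σ[ ℬ ∈ Model ]
    Countable ℬ × ⌊ 𝒜 ⌋ ⊆ ⌊ ℬ ⌋ × ¬ (a ↓ⁿˢ[ ⌊ 𝒜 ⌋ ] ⌊ ℬ ⌋) × CountableRankAtLeast m a ℬ

  CountableRank-mono : ∀ m {n} {a : Vec M n} {𝒜 ℬ} → ⌊ 𝒜 ⌋ ⊆ ⌊ ℬ ⌋ →
                       CountableRankAtLeast m a ℬ → CountableRankAtLeast m a 𝒜
  CountableRank-mono zero    𝒜⊆ℬ _ = tt
  CountableRank-mono (suc m) {a = a} 𝒜⊆ℬ (𝒞 , c , ℬ⊆𝒞 , dep , rank) = 𝒞 , c , (λ x∈ → ℬ⊆𝒞 (𝒜⊆ℬ x∈)) ,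
    (λ ind → dep (↓ⁿˢ-mono a 𝒜⊆ℬ [ (λ x∈ → inj₂ (ℬ⊆𝒞 x∈)) , inj₂ ] ind)) , rank

  ↓ⁿˢ-⋆⁻ : ∀ σ {n} (a : Vec M n) 𝒜 ℬ → σ ⊙ a ↓ⁿˢ[ ⌊ σ ⋆ 𝒜 ⌋ ] ⌊ σ ⋆ ℬ ⌋ → a ↓ⁿˢ[ ⌊ 𝒜 ⌋ ] ⌊ ℬ ⌋
  ↓ⁿˢ-⋆⁻ σ a 𝒜 ℬ ind = subst (_↓ⁿˢ[ ⌊ 𝒜 ⌋ ] ⌊ ℬ ⌋) (⁻¹-⊙ σ a)
    (↓ⁿˢ-⊙ (σ ⁻¹) (σ ⊙ a) ind (λ { (d , refl) → d , sym (⁻¹-· σ _) })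
      [ (λ x∈ → _ , inj₁ (∈-⋆ σ 𝒜 x∈) , ⁻¹-· σ _) , (λ x∈ → _ , inj₂ (∈-⋆ σ ℬ x∈) , ⁻¹-· σ _) ])

  ⋆-mono : ∀ σ {𝒜 ℬ} → ⌊ 𝒜 ⌋ ⊆ ⌊ ℬ ⌋ → ⌊ σ ⋆ 𝒜 ⌋ ⊆ ⌊ σ ⋆ ℬ ⌋
  ⋆-mono σ {ℬ = ℬ} 𝒜⊆ℬ (d , refl) = ∈-⋆ σ ℬ (𝒜⊆ℬ (d , refl))

  CountableRank-⋆ : ∀ m σ {n} {a : Vec M n} {𝒜} →
                    CountableRankAtLeast m a 𝒜 → CountableRankAtLeast m (σ ⊙ a) (σ ⋆ 𝒜)
  CountableRank-⋆ zero    σ _ = tt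
  CountableRank-⋆ (suc m) σ {a = a} {𝒜} (ℬ , c , 𝒜⊆ℬ , dep , rank) =
    σ ⋆ ℬ , c , ⋆-mono σ {𝒜} {ℬ} 𝒜⊆ℬ , (λ ind → dep (↓ⁿˢ-⋆⁻ σ a 𝒜 ℬ ind)) , CountableRank-⋆ m σ rank

  DependenceWitness : ∀ {n k} → Vec M n → Vec M k → Model → Model → Set ℓ
  DependenceWitness a A 𝒜 ℬ = ∃ λ m → Σ[ d ∈ Vec M m ] Σ[ b ∈ Vec M m ]
    d ∈ᵗ ⌊ ℬ ⌋ × b ∈ᵗ ⌊ 𝒜 ⌋ × d ≈[ A ] b × ¬ (d ≈[ a ++ A ] b)

  MoveOnto : ∀ {n k} → Vec M n → Vec M k → Model → Model → Set ℓ
  MoveOnto a A 𝒜 ℬ =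
    Σ[ π ∈ Aut ] ⌊ π ⋆ ℬ ⌋ ≐ ⌊ 𝒜 ⌋ × ∃ λ m → Σ[ A′ ∈ Vec M m ] Move 𝒜 a A (π ⊙ a) A′

  module _ {𝒜 ℬ} (cᴬ : Countable 𝒜) (cᴮ : Countable ℬ) (𝒜⊆ℬ : ⌊ 𝒜 ⌋ ⊆ ⌊ ℬ ⌋) {n} (a : Vec M n)
           (dep : ¬ (a ↓ⁿˢ[ ⌊ 𝒜 ⌋ ] ⌊ ℬ ⌋)) {k} {A : Vec M k} (A∈ : A ∈ᵗ ⌊ 𝒜 ⌋) where

    abstract

      -- Splitting over A yields c and d in ℬ with the same type over A but not over a A. A
      -- realization b in 𝒜 of their common type over A differs over a A from at least one of them.
      dependence-witness : DependenceWitness a A 𝒜 ℬ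
      dependence-witness = from-splitting (decidable-stable em (λ ¬splits → dep (-, A , A∈ , ¬splits)))
        where
        cases : ∀ {m} {b c d : Vec M m} → c ∈ᵗ ⌊ ℬ ⌋ → d ∈ᵗ ⌊ ℬ ⌋ → b ∈ᵗ ⌊ 𝒜 ⌋ → c ≈[ A ] d →
                ¬ (c ≈[ a ++ A ] d) → c ≈[ A ] b → Dec (c ≈[ a ++ A ] b) → DependenceWitness a A 𝒜 ℬ
        cases c∈ d∈ b∈ c≈d c≉d c≈b (no c≉b)   = -, _ , _ , c∈ , b∈ , c≈b , c≉b
        cases c∈ d∈ b∈ c≈d c≉d c≈b (yes c≈b′) =
          -, _ , _ , d∈ , b∈ , ≈-trans (≈-sym c≈d) c≈b , λ d≈b → c≉d (≈-trans c≈b′ (≈-sym d≈b))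
        from-splitting : Splits a (⌊ 𝒜 ⌋ ∪ ⌊ ℬ ⌋) A → DependenceWitness a A 𝒜 ℬ
        from-splitting (_ , c , d , c∈ , d∈ , c≡d , ac≢ad) =
          let (b , b∈ , b≡c) = AI 𝒜 cᴬ c A A∈
          in cases (All.map [ 𝒜⊆ℬ , id ] c∈) (All.map [ 𝒜⊆ℬ , id ] d∈) b∈ (≡ᵗ⟪⟫⇒≈ c≡d)
               (λ c≈d → ac≢ad (≈⇒≡ᵗ⟪⟫ (≈-++ˡ a c≈d))) (≈-sym (≡ᵗ⟪⟫⇒≈ b≡c)) em

      -- A failure of independence over 𝒜 gives player I a move: the image of a under
      -- an isomorphism ℬ → 𝒜 over A that takes a tuple d of ℬ to some b of 𝒜 with the
      -- same type as d over A but not over a A.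

      move : MoveOnto a A 𝒜 ℬ
      move = onto dependence-witness
        where
        moved : ∀ π → Fixes π ⟪ A ⟫ → ∀ {m} {d b : Vec M m} → π ⊙ d ≡ b → π ⊙ a ≈[ A ++ b ] a → d ≈[ a ++ A ] b
        moved π πA {d = d} {b} πd≡b (ρ , fρ , ρπa≡a) = ρ ∘ᴬ π
          , ++-⊆ {X = λ x → ρ · π · x ≡ x} {a = a} (⊙-Fixes (ρ ∘ᴬ π) (trans (∘ᴬ-⊙ ρ π a) ρπa≡a))
              (Fixes-∘ ρ π (λ x∈ → fρ (++-⊆ˡ x∈)) πA)
          , trans (∘ᴬ-⊙ ρ π d) (trans (cong (ρ ⊙_) πd≡b) (Fixes-⊙ ρ fρ (⊆⇒∈ᵗ (++-⊆ʳ A))))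
        via : ∀ {m} {d b : Vec M m} → b ∈ᵗ ⌊ 𝒜 ⌋ → ¬ (d ≈[ a ++ A ] b) → ∀ π → ⌊ π ⋆ ℬ ⌋ ≐ ⌊ 𝒜 ⌋ →
              π ⊙ A ≡ A × π ⊙ d ≡ b → MoveOnto a A 𝒜 ℬ
        via {b = b} b∈ d≉b π πℬ≐𝒜 (πA≡A , πd≡b) = π , πℬ≐𝒜 , -, A ++ b , ++⁺ A∈ b∈
          , ≈⇒≡ᵗ⟪⟫ (≈-sym (≈-⊙ π (⊙-Fixes π πA≡A) a)) , ++-⊆ˡ
          , λ πa≡a → d≉b (moved π (⊙-Fixes π πA≡A) πd≡b (≡ᵗ⟪⟫⇒≈ πa≡a))
        onto : DependenceWitness a A 𝒜 ℬ → MoveOnto a A 𝒜 ℬ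
        onto (_ , d , b , d∈ , b∈ , (τ , fix , τd≡b) , d≉b) =
          let τAd≡Ab = ⊙-++ τ A (Fixes-⊙ τ fix (∈ᵗ-self A)) τd≡b
              (π , eq , πℬ≐𝒜) = countable-homogeneous ℬ 𝒜 cᴮ cᴬ {a = A ++ d} τ (++⁺ (All.map 𝒜⊆ℬ A∈) d∈)
                                  (subst (_∈ᵗ ⌊ 𝒜 ⌋) (sym τAd≡Ab) (++⁺ A∈ b∈))
          in via b∈ d≉b π πℬ≐𝒜 (++-⊙ π A (trans eq τAd≡Ab))

  -- The game stays in 𝒜 while the chain climbs: after a move the automorphism π maps ℬ onto 𝒜, so
  -- the chain for a above ℬ becomes one for π a above 𝒜. A further move exists whatever finite set
  -- player II answers with.
  WinsGI⇒rank≤ : ∀ n {𝒜} → Countable 𝒜 → ∀ {m k} {a : Vec M m} {A : Vec M k} → A ∈ᵗ ⌊ 𝒜 ⌋ →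
                 WinsGI n 𝒜 a A → ¬ CountableRankAtLeast (suc n) a 𝒜
  WinsGI⇒rank≤ n {𝒜} cᴬ {a = a} {A} A∈ wins (ℬ , cᴮ , 𝒜⊆ℬ , dep , rank) =
    play n wins rank (move {𝒜} {ℬ} cᴬ cᴮ 𝒜⊆ℬ a dep A∈)
    where
    play : ∀ n → WinsGI n 𝒜 a A → CountableRankAtLeast n a ℬ → ¬ MoveOnto a A 𝒜 ℬ
    play zero    wins _    (π , _ , _ , A′ , mv) = wins (π ⊙ a) A′ mv
    play (suc n) wins rank (π , πℬ≐𝒜 , _ , A′ , mv) =
      let (_ , A″ , A″∈ , _ , wins′) = wins (π ⊙ a) A′ mv
      in WinsGI⇒rank≤ n {𝒜} cᴬ A″∈ wins′
           (CountableRank-mono (suc n) {𝒜 = 𝒜} {π ⋆ ℬ} (proj₂ πℬ≐𝒜) (CountableRank-⋆ (suc n) π {a = a} {ℬ} rank))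

  ι-preimage : ∀ 𝒜 {n} {v : Vec M n} → v ∈ᵗ ⌊ 𝒜 ⌋ → Σ[ w ∈ Vec ∣ str 𝒜 ∣ n ] map (ι 𝒜) w ≡ v
  ι-preimage 𝒜 []                = [] , refl
  ι-preimage 𝒜 ((d , refl) ∷ v∈) = let (w , eq) = ι-preimage 𝒜 v∈ in d ∷ w , cong (_ ∷_) eq

  ι-∈ᵗ : ∀ 𝒜 {n} (w : Vec ∣ str 𝒜 ∣ n) → map (ι 𝒜) w ∈ᵗ ⌊ 𝒜 ⌋
  ι-∈ᵗ 𝒜 []      = []
  ι-∈ᵗ 𝒜 (d ∷ w) = (d , refl) ∷ ι-∈ᵗ 𝒜 w

  module _ {n} {a : Vec M n} {𝒞 ℬ} (c : Countable 𝒞) (𝒞⊆ℬ : ⌊ 𝒞 ⌋ ⊆ ⌊ ℬ ⌋)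
           (splits : ∀ {k} (w : Vec ∣ str 𝒞 ∣ k) → Splits a ⌊ ℬ ⌋ (map (ι 𝒞) w)) where

    private
      witness : ∃ (Vec ∣ str 𝒞 ∣) → ∃ (Vec M)
      witness (_ , w) = -, proj₁ (proj₂ (splits w)) ++ proj₁ (proj₂ (proj₂ (splits w)))

      witness⊆ℬ : ∀ w → ⟪ proj₂ (witness w) ⟫ ⊆ ⌊ ℬ ⌋
      witness⊆ℬ (_ , w) with splits w
      ... | _ , _ , _ , b∈ , c∈ , _ = ∈ᵗ⇒⊆ (++⁺ b∈ c∈)

      splits-in : ∀ {X : Subset} {k} (w : Vec ∣ str 𝒞 ∣ k) → ⟪ proj₂ (witness (-, w)) ⟫ ⊆ X →
                  Splits a X (map (ι 𝒞) w)
      splits-in w ⊆X with splits w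
      ... | _ , b , c , _ , _ , s =
        -, b , c , ⊆⇒∈ᵗ (λ x∈ → ⊆X (++-⊆ˡ x∈)) , ⊆⇒∈ᵗ (λ x∈ → ⊆X (++-⊆ʳ b x∈)) , s

      dependent : ∀ {𝒞′} → (∀ w → ⟪ proj₂ (witness w) ⟫ ⊆ ⌊ 𝒞′ ⌋) → ¬ (a ↓ⁿˢ[ ⌊ 𝒞 ⌋ ] ⌊ 𝒞′ ⌋)
      dependent ⊆𝒞′ (_ , A , A∈ , ¬splits) with ι-preimage 𝒞 A∈
      ... | w , refl = ¬splits (splits-in w λ x∈ → inj₂ (⊆𝒞′ (-, w) x∈))

    abstract
      -- Only countably many finite tuples of 𝒞 could serve as a base, and one pair of tuples of ℬ
      -- refutes each of them.
      countable-dependence : Σ[ 𝒞′ ∈ Model ]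
        Countable 𝒞′ × ⌊ 𝒞 ⌋ ⊆ ⌊ 𝒞′ ⌋ × ¬ (a ↓ⁿˢ[ ⌊ 𝒞 ⌋ ] ⌊ 𝒞′ ⌋) × ⌊ 𝒞′ ⌋ ⊆ ⌊ ℬ ⌋
      countable-dependence =
        let (𝒞′ , c′ , P⊆𝒞′ , 𝒞′⊆ℬ) = submodel ℬ {⌊ 𝒞 ⌋ ∪ λ x → ∃ λ w → x ∈ᵛ proj₂ (witness w)}
              [ 𝒞⊆ℬ , (λ (w , x∈) → witness⊆ℬ w x∈) ]
              (∪-countable (model-countable 𝒞 c) (⋃-countable (tuples-countable c) witness))
        in 𝒞′ , c′ , (λ x∈ → P⊆𝒞′ (inj₁ x∈)) , dependent {𝒞′} (λ w x∈ → P⊆𝒞′ (inj₂ (w , x∈))) , 𝒞′⊆ℬ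

  Rank⇒CountableRank : ∀ m {n} {a : Vec M n} {𝒜} → RankAtLeast m a 𝒜 →
                       ∀ {𝒞} → Countable 𝒞 → ⌊ 𝒞 ⌋ ⊆ ⌊ 𝒜 ⌋ → CountableRankAtLeast m a 𝒞
  Rank⇒CountableRank zero    _ _ _ = tt
  Rank⇒CountableRank (suc m) {a = a} {𝒜} (ℬ , 𝒜⊆ℬ , dep , rank) {𝒞} c 𝒞⊆𝒜 =
    let (𝒞′ , c′ , 𝒞⊆𝒞′ , dep′ , 𝒞′⊆ℬ) = countable-dependence {a = a} {𝒞} {ℬ} c (λ x∈ → 𝒜⊆ℬ (𝒞⊆𝒜 x∈)) λ w →
          decidable-stable em λ ¬splits → dep (-, _ , All.map 𝒞⊆𝒜 (ι-∈ᵗ 𝒞 w) ,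
            λ s → ¬splits (Splits-mono a [ 𝒜⊆ℬ , id ] s))
    in 𝒞′ , c′ , 𝒞⊆𝒞′ , dep′ , Rank⇒CountableRank m {a = a} {ℬ} rank {𝒞′} c′ 𝒞′⊆ℬ

  abstract

    countable-submodel : ∀ 𝒜 {n} {a : Vec M n} → a ∈ᵗ ⌊ 𝒜 ⌋ →
                         Σ[ 𝒞 ∈ Model ] Countable 𝒞 × a ∈ᵗ ⌊ 𝒞 ⌋ × ⌊ 𝒞 ⌋ ⊆ ⌊ 𝒜 ⌋
    countable-submodel 𝒜 {a = a} a∈ = let (𝒞 , c , a⊆ , 𝒞⊆) = submodel 𝒜 (∈ᵗ⇒⊆ a∈) (⟪⟫-countable a) in
      𝒞 , c , ⊆⇒∈ᵗ a⊆ , 𝒞⊆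

    -- The number of moves in AIV depends on a alone, so one bound serves all models; n moves
    -- exclude the rank `suc n`.
    rank-bounded : ∀ {n} (a : Vec M n) → ∃ λ m → ∀ 𝒜 → ¬ RankAtLeast m a 𝒜
    rank-bounded a = let (n , wins) = AIV a in suc n , λ 𝒜 rank →
      let (𝒞 , c , _ , 𝒞⊆𝒜) = countable-submodel 𝒜 {a = []} [] in
      WinsGI⇒rank≤ n {𝒞} c [] (wins 𝒞 c [] []) (Rank⇒CountableRank (suc n) {a = a} {𝒜} rank {𝒞} c 𝒞⊆𝒜)

    -- Without a finite base, a would depend on 𝒜 over 𝒜 itself, and the constant chain at 𝒜 would
    -- witness every rank.
    NS-base : ∀ {n} (a : Vec M n) 𝒜 → ∃ λ k → Σ[ A ∈ Vec M k ] A ∈ᵗ ⌊ 𝒜 ⌋ × NS a A ⌊ 𝒜 ⌋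
    NS-base a 𝒜 = decidable-stable em λ none → proj₂ (rank-bounded a) 𝒜 (unbounded none _)
      where
      unbounded : ¬ (∃ λ k → Σ[ A ∈ Vec M k ] A ∈ᵗ ⌊ 𝒜 ⌋ × NS a A ⌊ 𝒜 ⌋) → ∀ m → RankAtLeast m a 𝒜
      unbounded none zero    = tt
      unbounded none (suc m) = 𝒜 , id ,
        (λ (_ , A , A∈ , ¬splits) → none (-, A , A∈ , ¬Splits⇒NS (λ s → ¬splits (Splits-mono a inj₁ s)))) ,
        unbounded none m

    -- AI for models of any size: a countable submodel around A already contains the realization.
    realize : ∀ 𝒜 {n k} (b : Vec M n) {A : Vec M k} → A ∈ᵗ ⌊ 𝒜 ⌋ → Σ[ b′ ∈ Vec M n ] b′ ∈ᵗ ⌊ 𝒜 ⌋ × b ≈[ A ] b′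
    realize 𝒜 b {A} A∈ =
      let (𝒞 , c , A∈𝒞 , 𝒞⊆𝒜) = countable-submodel 𝒜 A∈ ; (b′ , b′∈ , b′≡b) = AI 𝒞 c b A A∈𝒞 in
      b′ , All.map 𝒞⊆𝒜 b′∈ , ≈-sym (≡ᵗ⟪⟫⇒≈ b′≡b)

  -- Independence over models

  ++-mono : ∀ {m k l} (a : Vec M m) {A : Vec M k} {B : Vec M l} → ⟪ A ⟫ ⊆ ⟪ B ⟫ → ⟪ a ++ A ⟫ ⊆ ⟪ a ++ B ⟫
  ++-mono a {B = B} A⊆B = ++-⊆ {X = ⟪ a ++ B ⟫} {a = a} (++-⊆ˡ {a = a}) (λ x∈ → ++-⊆ʳ a (A⊆B x∈))

  ≈-swap : ∀ {m n k} (a a′ : Vec M m) (b b′ : Vec M n) {B : Vec M k} →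
           a ++ b ≈[ B ] a′ ++ b′ → b ++ a ≈[ B ] b′ ++ a′
  ≈-swap a a′ b b′ (σ , fσ , eq) = let (σa , σb) = ++-⊙ σ a {a′} eq in σ , fσ , ⊙-++ σ b {b′} {a} {a′} σb σa

  ≈-++ʳ : ∀ {m n k} {a a′ : Vec M m} (c : Vec M n) {B : Vec M k} → a ≈[ c ++ B ] a′ → a ++ c ≈[ B ] a′ ++ c
  ≈-++ʳ c a≈a′ = ≈-swap c c _ _ (≈-++ˡ c a≈a′)

  ≈-++ʳ⁻ : ∀ {m n k} {a a′ : Vec M m} (c : Vec M n) {B : Vec M k} → a ++ c ≈[ B ] a′ ++ c → a ≈[ c ++ B ] a′
  ≈-++ʳ⁻ {a = a} c ac≈a′c = ≈-++ˡ⁻ c (≈-swap a _ c c ac≈a′c)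

  -- An automorphism over B from b to c takes B b to B c; nonsplitting over A is applied to these
  -- longer tuples.
  NS-mono : ∀ {n k l} {a : Vec M n} {A : Vec M k} {B : Vec M l} {X} →
            ⟪ A ⟫ ⊆ ⟪ B ⟫ → B ∈ᵗ X → NS a A X → NS a B X
  NS-mono {a = a} {A} {B} A⊆B B∈ ns .nonsplitting b∈ c∈ (σ , fσ , σb≡c) =
    enlarge (nonsplitting ns (++⁺ B∈ b∈) (++⁺ B∈ c∈)
      (σ , (λ x∈ → fσ (A⊆B x∈)) , ⊙-++ σ B (Fixes-⊙ σ fσ (∈ᵗ-self B)) σb≡c))
    where
    enlarge : ∀ {m} {b c : Vec M m} → B ++ b ≈[ a ++ A ] B ++ c → b ≈[ a ++ B ] c
    enlarge (τ , fτ , eq) = let (τB , τb) = ++-⊙ τ B eq in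
      τ , ++-⊆ {X = λ x → τ · x ≡ x} {a = a} (λ x∈ → fτ (++-⊆ˡ x∈)) (⊙-Fixes τ τB) , τb

  -- Independence of finite tuples over a model, in a form that mentions c and its
  -- realizations in 𝒜 but no other tuples.

  infix 4 _⫝[_]_

  record _⫝[_]_ {n m} (a : Vec M n) (𝒜 : Model) (c : Vec M m) : Set ℓ where
    constructor mk⫝
    field
      {size} : ℕ
      base   : Vec M size
      base∈  : base ∈ᵗ ⌊ 𝒜 ⌋
      copies : ∀ {k} {B : Vec M k} → B ∈ᵗ ⌊ 𝒜 ⌋ → ⟪ base ⟫ ⊆ ⟪ B ⟫ →
               ∀ {c₀} → c₀ ∈ᵗ ⌊ 𝒜 ⌋ → c ≈[ B ] c₀ → c ≈[ a ++ B ] c₀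

  open _⫝[_]_

  -- The base of `a ⫝[ 𝒜 ] c` may vary with c. A base A of the type of a over 𝒜 serves every c: c is
  -- compared with a copy c₁ in 𝒜 over both bases, and nonsplitting inside 𝒜 leads from c₁ to c₀.
  uniform-base : ∀ {𝒜 n m k l} {a : Vec M n} {c : Vec M m} {A : Vec M k} {B : Vec M l} →
    NS a A ⌊ 𝒜 ⌋ → a ⫝[ 𝒜 ] c → B ∈ᵗ ⌊ 𝒜 ⌋ → ⟪ A ⟫ ⊆ ⟪ B ⟫ →
    ∀ {c₀} → c₀ ∈ᵗ ⌊ 𝒜 ⌋ → c ≈[ B ] c₀ → c ≈[ a ++ B ] c₀
  uniform-base {𝒜} {a = a} {c} {A} {B} ns a⫝c B∈ A⊆B {c₀} c₀∈ c≈c₀ =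
    through (realize 𝒜 c (++⁺ (base∈ a⫝c) B∈))
    where
    through : (Σ[ c₁ ∈ _ ] c₁ ∈ᵗ ⌊ 𝒜 ⌋ × c ≈[ base a⫝c ++ B ] c₁) → c ≈[ a ++ B ] c₀
    through (c₁ , c₁∈ , c≈c₁) = ≈-trans
      (≈-mono (++-mono a (++-⊆ʳ (base a⫝c))) (copies a⫝c (++⁺ (base∈ a⫝c) B∈) ++-⊆ˡ c₁∈ c≈c₁))
      (nonsplitting (NS-mono A⊆B B∈ ns) c₁∈ c₀∈
        (≈-trans (≈-sym (≈-mono (++-⊆ʳ (base a⫝c)) c≈c₁)) c≈c₀))

  ↓ⁿˢ⇒⫝ : ∀ {𝒜 n} {a : Vec M n} {X} → a ↓ⁿˢ[ ⌊ 𝒜 ⌋ ] X →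
          ∀ {m} {c : Vec M m} → c ∈ᵗ ⌊ 𝒜 ⌋ ∪ X → a ⫝[ 𝒜 ] c
  ↓ⁿˢ⇒⫝ {𝒜} {a = a} {X} (_ , A , A∈ , ¬splits) c∈ = mk⫝ A A∈ λ B∈ A⊆B c₀∈ →
    nonsplitting (NS-mono A⊆B (All.map inj₁ B∈) (¬Splits⇒NS ¬splits)) c∈ (All.map inj₁ c₀∈)

  -- Both tuples are compared with a single realization b₀ in 𝒜 of their common type over A.
  NS-extend : ∀ {𝒜 n k} {a : Vec M n} {A : Vec M k} {X} → A ∈ᵗ ⌊ 𝒜 ⌋ → NS a A ⌊ 𝒜 ⌋ →
              (∀ {m} {c : Vec M m} → c ∈ᵗ X → a ⫝[ 𝒜 ] c) → NS a A X
  NS-extend {𝒜} {a = a} {A} A∈ ns ind .nonsplitting {b = b} {c} b∈ c∈ b≈c = through (realize 𝒜 b A∈)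
    where
    through : (Σ[ b₀ ∈ _ ] b₀ ∈ᵗ ⌊ 𝒜 ⌋ × b ≈[ A ] b₀) → b ≈[ a ++ A ] c
    through (b₀ , b₀∈ , b≈b₀) = ≈-trans
      (uniform-base ns (ind b∈) A∈ id b₀∈ b≈b₀)
      (≈-sym (uniform-base ns (ind c∈) A∈ id b₀∈ (≈-trans (≈-sym b≈c) b≈b₀)))

  ⫝⇒↓ⁿˢ : ∀ {𝒜 n} {a : Vec M n} {X} → ⌊ 𝒜 ⌋ ⊆ X → (∀ {m} {c : Vec M m} → c ∈ᵗ X → a ⫝[ 𝒜 ] c) →
          a ↓ⁿˢ[ ⌊ 𝒜 ⌋ ] X
  ⫝⇒↓ⁿˢ {𝒜} {a = a} 𝒜⊆X ind = let (_ , A , A∈ , ns) = NS-base a 𝒜 in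
    -, A , A∈ , λ s → NS⇒¬Splits (NS-extend {𝒜} A∈ ns ind) (Splits-mono a [ 𝒜⊆X , id ] s)

  -- An instance of `copies` involves only the finitely many parameters B c₀, so an automorphism
  -- over these carries it from a c to a′ c′.
  ⫝-transfer : ∀ {𝒜 n m} {a a′ : Vec M n} {c c′ : Vec M m} →
    (∀ {k} {B : Vec M k} → B ∈ᵗ ⌊ 𝒜 ⌋ → a ++ c ≈[ B ] a′ ++ c′) → a ⫝[ 𝒜 ] c → a′ ⫝[ 𝒜 ] c′
  ⫝-transfer {𝒜} {a = a} {a′} {c} {c′} same a⫝c = mk⫝ (base a⫝c) (base∈ a⫝c) λ B∈ base⊆B {c₀} c₀∈ c′≈c₀ →
    transfer B∈ base⊆B c₀∈ c′≈c₀ (same (++⁺ B∈ c₀∈))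
    where
    transfer : ∀ {k} {B : Vec M k} → B ∈ᵗ ⌊ 𝒜 ⌋ → ⟪ base a⫝c ⟫ ⊆ ⟪ B ⟫ → ∀ {c₀} → c₀ ∈ᵗ ⌊ 𝒜 ⌋ →
               c′ ≈[ B ] c₀ → a ++ c ≈[ B ++ c₀ ] a′ ++ c′ → c′ ≈[ a′ ++ B ] c₀
    transfer {B = B} B∈ base⊆B {c₀} c₀∈ c′≈c₀ (σ , fσ , eq) =
      conj (++-⊙ σ a eq) (Fixes-⊙ σ fσ (⊆⇒∈ᵗ ++-⊆ˡ)) (Fixes-⊙ σ fσ (⊆⇒∈ᵗ (++-⊆ʳ B)))
      where
      conj : σ ⊙ a ≡ a′ × σ ⊙ c ≡ c′ → σ ⊙ B ≡ B → σ ⊙ c₀ ≡ c₀ → c′ ≈[ a′ ++ B ] c₀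
      conj (σa , σc) σB σc₀ =
        subst₂ (λ c c₀ → c ≈[ a′ ++ B ] c₀) σc σc₀
          (subst (λ X → σ ⊙ c ≈[ X ] σ ⊙ c₀) (⊙-++ σ a σa σB)
            (≈-conj σ (copies a⫝c B∈ base⊆B c₀∈
              (≈-trans (subst (c ≈[ B ]_) σc (≈-⊙ σ (⊙-Fixes σ σB) c)) c′≈c₀))))

  -- The chain a c, a c₀, a′ c₀, a′ c, where c₀ in 𝒜 is a copy of c over both bases.
  ⫝-stationary : ∀ {𝒜 n m} {a a′ : Vec M n} {c : Vec M m} →
    (∀ {k} {B : Vec M k} → B ∈ᵗ ⌊ 𝒜 ⌋ → a ≈[ B ] a′) → a ⫝[ 𝒜 ] c → a′ ⫝[ 𝒜 ] c →
    ∀ {k} {B : Vec M k} → B ∈ᵗ ⌊ 𝒜 ⌋ → a ++ c ≈[ B ] a′ ++ c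
  ⫝-stationary {𝒜} {a = a} {a′} {c} same a⫝c a′⫝c {B = B} B∈ = through (realize 𝒜 c B′∈)
    where
    B′ = B ++ base a⫝c ++ base a′⫝c
    B′∈ : B′ ∈ᵗ ⌊ 𝒜 ⌋
    B′∈ = ++⁺ B∈ (++⁺ (base∈ a⫝c) (base∈ a′⫝c))
    through : (Σ[ c₀ ∈ _ ] c₀ ∈ᵗ ⌊ 𝒜 ⌋ × c ≈[ B′ ] c₀) → a ++ c ≈[ B ] a′ ++ c
    through (c₀ , c₀∈ , c≈c₀) = ≈-mono (++-⊆ˡ {a = B}) (≈-trans (≈-trans
      (≈-++ˡ a (copies a⫝c B′∈ (λ x∈ → ++-⊆ʳ B (++-⊆ˡ x∈)) c₀∈ c≈c₀))
      (≈-++ʳ c₀ (same (++⁺ c₀∈ B′∈))))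
      (≈-sym (≈-++ˡ a′ (copies a′⫝c B′∈ (λ x∈ → ++-⊆ʳ B (++-⊆ʳ (base a⫝c) x∈)) c₀∈ c≈c₀))))

  ⫝-monoˡ : ∀ {𝒜 n n′ m} {a : Vec M n} {a′ : Vec M n′} {c : Vec M m} →
            ⟪ a′ ⟫ ⊆ ⟪ a ⟫ → a ⫝[ 𝒜 ] c → a′ ⫝[ 𝒜 ] c
  ⫝-monoˡ {a = a} {a′} a′⊆a a⫝c = mk⫝ (base a⫝c) (base∈ a⫝c) λ {_} {B} B∈ base⊆B c₀∈ c≈c₀ →
    ≈-mono (++-⊆ {X = ⟪ a ++ B ⟫} {a = a′} (λ x∈ → ++-⊆ˡ (a′⊆a x∈)) (++-⊆ʳ a)) (copies a⫝c B∈ base⊆B c₀∈ c≈c₀)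

  -- An automorphism over a B that takes c into 𝒜 also takes c′ into 𝒜, because B includes P.
  -- Nonsplitting of the type of a over 𝒜 then leads from this image to c₀.
  ⫝-monoʳ : ∀ {𝒜 n m m′ k} {a : Vec M n} {c : Vec M m} {c′ : Vec M m′} {P : Vec M k} →
            P ∈ᵗ ⌊ 𝒜 ⌋ → ⟪ c′ ⟫ ⊆ ⟪ P ⟫ ∪ ⟪ c ⟫ → a ⫝[ 𝒜 ] c → a ⫝[ 𝒜 ] c′
  ⫝-monoʳ {𝒜} {a = a} {c} {c′} {P} P∈ c′⊆ a⫝c = from (NS-base a 𝒜)
    where
    from : (∃ λ k → Σ[ A ∈ Vec M k ] A ∈ᵗ ⌊ 𝒜 ⌋ × NS a A ⌊ 𝒜 ⌋) → a ⫝[ 𝒜 ] c′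
    from (_ , A , A∈ , ns) = mk⫝ (A ++ P ++ base a⫝c) (++⁺ A∈ (++⁺ P∈ (base∈ a⫝c)))
      λ B∈ base⊆B c₀∈ c′≈c₀ → through B∈ (λ x∈ → base⊆B (++-⊆ˡ x∈))
        (λ x∈ → base⊆B (++-⊆ʳ A (++-⊆ˡ x∈))) (λ x∈ → base⊆B (++-⊆ʳ A (++-⊆ʳ P x∈))) c₀∈ c′≈c₀ (realize 𝒜 c B∈)
      where
      through : ∀ {l} {B : Vec M l} → B ∈ᵗ ⌊ 𝒜 ⌋ → ⟪ A ⟫ ⊆ ⟪ B ⟫ → ⟪ P ⟫ ⊆ ⟪ B ⟫ → ⟪ base a⫝c ⟫ ⊆ ⟪ B ⟫ →
                ∀ {c₀} → c₀ ∈ᵗ ⌊ 𝒜 ⌋ → c′ ≈[ B ] c₀ → (Σ[ c₁ ∈ _ ] c₁ ∈ᵗ ⌊ 𝒜 ⌋ × c ≈[ B ] c₁) → c′ ≈[ a ++ B ] c₀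
      through {B = B} B∈ A⊆ P⊆ base⊆ {c₀} c₀∈ c′≈c₀ (c₁ , c₁∈ , c≈c₁) = copy (copies a⫝c B∈ base⊆ c₁∈ c≈c₁)
        where
        copy : c ≈[ a ++ B ] c₁ → c′ ≈[ a ++ B ] c₀
        copy (σ , fσ , σc≡c₁) = ≈-trans (≈-⊙ σ fσ c′)
          (nonsplitting (NS-mono A⊆ B∈ ns) (map⁺ (⊆⇒∈ᵗ λ x∈ → σc′∈ (c′⊆ x∈))) c₀∈
            (≈-trans (≈-sym (≈-⊙ σ (λ x∈ → fσ (++-⊆ʳ a x∈)) c′)) c′≈c₀))
          where
          σc′∈ : ∀ {x} → x ∈ ⟪ P ⟫ ∪ ⟪ c ⟫ → σ · x ∈ ⌊ 𝒜 ⌋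
          σc′∈ (inj₁ x∈P) = subst (_∈ ⌊ 𝒜 ⌋) (sym (fσ (++-⊆ʳ a (P⊆ x∈P)))) (∈ᵗ⇒⊆ P∈ x∈P)
          σc′∈ (inj₂ x∈c) = ∈ᵗ⇒⊆ c₁∈ (subst (λ v → σ · _ ∈ ⟪ v ⟫) σc≡c₁ (⊙-∈ σ x∈c))

  ⫝-restrict : ∀ {𝒜 𝒞 n m} {a : Vec M n} {c : Vec M m} (a⫝c : a ⫝[ 𝒜 ] c) →
               base a⫝c ∈ᵗ ⌊ 𝒞 ⌋ → ⌊ 𝒞 ⌋ ⊆ ⌊ 𝒜 ⌋ → a ⫝[ 𝒞 ] c
  ⫝-restrict a⫝c base∈𝒞 𝒞⊆𝒜 = mk⫝ (base a⫝c) base∈𝒞 λ B∈ base⊆B c₀∈ →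
    copies a⫝c (All.map 𝒞⊆𝒜 B∈) base⊆B (All.map 𝒞⊆𝒜 c₀∈)

  -- A base A of the type of a over 𝒜 remains a base over ℬ. Hence `uniform-base` applies in ℬ, with
  -- parameters and copies taken from 𝒜.
  ⫝-trans : ∀ {𝒜 ℬ n m} {a : Vec M n} {c : Vec M m} → ⌊ 𝒜 ⌋ ⊆ ⌊ ℬ ⌋ →
            (∀ {k} {b : Vec M k} → b ∈ᵗ ⌊ ℬ ⌋ → a ⫝[ 𝒜 ] b) → a ⫝[ ℬ ] c → a ⫝[ 𝒜 ] c
  ⫝-trans {𝒜} {ℬ} {a = a} {c} 𝒜⊆ℬ a⫝ℬ a⫝c = from (NS-base a 𝒜)
    where
    from : (∃ λ k → Σ[ A ∈ Vec M k ] A ∈ᵗ ⌊ 𝒜 ⌋ × NS a A ⌊ 𝒜 ⌋) → a ⫝[ 𝒜 ] c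
    from (_ , A , A∈ , ns) = mk⫝ A A∈ λ B∈ A⊆B c₀∈ →
      uniform-base (NS-mono A⊆B (All.map 𝒜⊆ℬ B∈) (NS-extend {𝒜} A∈ ns a⫝ℬ)) a⫝c
        (All.map 𝒜⊆ℬ B∈) id (All.map 𝒜⊆ℬ c₀∈)

  FreeCopy : Model → Model → Model → Set ℓ
  FreeCopy 𝒜 ℬ 𝒟 = Σ[ σ ∈ Aut ] Fixes σ ⌊ 𝒜 ⌋ × ⌊ σ ⋆ ℬ ⌋ ⇓ⁿˢ[ ⌊ 𝒜 ⌋ ] ⌊ 𝒟 ⌋

  abstract
    -- Over the empty set, equality of the types of the two enumerations is a single automorphism
    -- between them. It fixes 𝒜 pointwise, since by the equality over {x} both enumerations take the
    -- value x of 𝒜 at the same index.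
    free-copy : ∀ {𝒜 ℬ 𝒟} → ⌊ 𝒜 ⌋ ⊆ ⌊ ℬ ⌋ → ⌊ 𝒜 ⌋ ⊆ ⌊ 𝒟 ⌋ → FreeCopy 𝒜 ℬ 𝒟
    free-copy {𝒜} {ℬ} {𝒟} 𝒜⊆ℬ 𝒜⊆𝒟 with AVI 𝒜 ℬ 𝒟 (λ x∈ → 𝒜⊆ℬ x∈ , 𝒜⊆𝒟 x∈)
    ... | 𝒞 , e , e≐𝒞 , same , ind with same [] []
    ... | s , (s-iso , _) , s∘e = σ , fixes , λ a a∈ → ind a (All.map σℬ⊆𝒞 a∈)
      where
      τ σ : Aut
      τ = mkAut s s-iso
      σ = τ ⁻¹
      σι : ∀ b → σ · ι ℬ b ≡ e b
      σι b = trans (cong (to σ) (sym (s∘e b))) (⁻¹-· τ (e b))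
      σℬ⊆𝒞 : ⌊ σ ⋆ ℬ ⌋ ⊆ ⌊ 𝒞 ⌋
      σℬ⊆𝒞 (b , refl) = proj₁ e≐𝒞 (b , sym (σι b))
      fixes : Fixes σ ⌊ 𝒜 ⌋
      fixes {x} x∈ with 𝒜⊆ℬ x∈ | same (x ∷ []) (x∈ ∷ [])
      ... | b , refl | t , (t-iso , t-fix) , t∘e =
        trans (σι b) (injective (proj₁ t-iso) (trans (t∘e b) (sym (t-fix (here refl)))))

  ⊙-same : ∀ σ {𝒜} → Fixes σ ⌊ 𝒜 ⌋ → ∀ {n} (a : Vec M n) {k} {B : Vec M k} → B ∈ᵗ ⌊ 𝒜 ⌋ → a ≈[ B ] σ ⊙ a
  ⊙-same σ fσ a B∈ = ≈-⊙ σ (λ x∈ → fσ (∈ᵗ⇒⊆ B∈ x∈)) a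

  -- AV applies to a free copy of a model that contains a; stationarity moves the
  -- result back to a.

  ⫝-sym-countable : ∀ {𝒜} → Countable 𝒜 → ∀ {n m} {a : Vec M n} {b : Vec M m} → a ⫝[ 𝒜 ] b → b ⫝[ 𝒜 ] a
  ⫝-sym-countable {𝒜} c {a = a} {b} a⫝b =
    let (ℬ , cᴮ , 𝒜a⊆ℬ) = countable-model (∪-countable (model-countable 𝒜 c) (⟪⟫-countable a))
        (𝒟 , 𝒜⊆𝒟 , b∈𝒟) = extend 𝒜 b
        𝒜⊆ℬ = λ {x} (x∈ : x ∈ ⌊ 𝒜 ⌋) → 𝒜a⊆ℬ (inj₁ x∈)
    in conclude {ℬ} {𝒟} cᴮ 𝒜⊆ℬ (⊆⇒∈ᵗ λ x∈ → 𝒜a⊆ℬ (inj₂ x∈)) b∈𝒟 (free-copy {𝒜} {ℬ} {𝒟} 𝒜⊆ℬ 𝒜⊆𝒟)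
    where
    conclude : ∀ {ℬ 𝒟} → Countable ℬ → ⌊ 𝒜 ⌋ ⊆ ⌊ ℬ ⌋ → a ∈ᵗ ⌊ ℬ ⌋ → b ∈ᵗ ⌊ 𝒟 ⌋ → FreeCopy 𝒜 ℬ 𝒟 → b ⫝[ 𝒜 ] a
    conclude {ℬ} {𝒟} cᴮ 𝒜⊆ℬ a∈ b∈ (σ , fσ , ind) = ⫝-transfer
        (λ {_} {B} B∈ → ≈-swap (σ ⊙ a) a b b {B}
          (⫝-stationary (λ B∈ → ≈-sym (⊙-same σ {𝒜} fσ a B∈)) σa⫝b a⫝b B∈))
        (↓ⁿˢ⇒⫝ b↓ (All.map inj₂ σa∈))
      where
      σa∈ : σ ⊙ a ∈ᵗ ⌊ σ ⋆ ℬ ⌋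
      σa∈ = ∈ᵗ-⋆ σ ℬ a∈
      σa⫝b : σ ⊙ a ⫝[ 𝒜 ] b
      σa⫝b = ↓ⁿˢ⇒⫝ (ind (σ ⊙ a) σa∈) (All.map inj₂ b∈)
      b↓ : b ↓ⁿˢ[ ⌊ 𝒜 ⌋ ] ⌊ σ ⋆ ℬ ⌋
      b↓ = AV 𝒜 (σ ⋆ ℬ) c cᴮ (λ {x} x∈ → subst (_∈ ⌊ σ ⋆ ℬ ⌋) (fσ x∈) (∈-⋆ σ ℬ (𝒜⊆ℬ x∈))) b
             λ x x∈ → ↓ⁿˢ-mono x id [ inj₁ , (λ y∈ → inj₂ (∈ᵗ⇒⊆ b∈ y∈)) ] (ind x x∈)

  -- A free copy σ b of b over 𝒜 is independent from a, so it suffices that σ b a and b a have the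
  -- same type over 𝒜. For a finite B this is stationarity in a countable submodel that contains B
  -- and both bases, where symmetry is known.
  ⫝-sym : ∀ {𝒜 n m} {a : Vec M n} {b : Vec M m} → a ⫝[ 𝒜 ] b → b ⫝[ 𝒜 ] a
  ⫝-sym {𝒜} {a = a} {b} a⫝b =
    let (ℬ , 𝒜⊆ℬ , b∈ℬ) = extend 𝒜 b
        (𝒟 , 𝒜⊆𝒟 , a∈𝒟) = extend 𝒜 a
    in conclude {ℬ} {𝒟} b∈ℬ a∈𝒟 (free-copy {𝒜} {ℬ} {𝒟} 𝒜⊆ℬ 𝒜⊆𝒟)
    where
    conclude : ∀ {ℬ 𝒟} → b ∈ᵗ ⌊ ℬ ⌋ → a ∈ᵗ ⌊ 𝒟 ⌋ → FreeCopy 𝒜 ℬ 𝒟 → b ⫝[ 𝒜 ] a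
    conclude {ℬ} b∈ a∈ (σ , fσ , ind) = ⫝-transfer same σb⫝a
      where
      σb⫝a : σ ⊙ b ⫝[ 𝒜 ] a
      σb⫝a = ↓ⁿˢ⇒⫝ (ind (σ ⊙ b) (∈ᵗ-⋆ σ ℬ b∈)) (All.map inj₂ a∈)
      over : ∀ {k} {B : Vec M k} → (Σ[ 𝒞 ∈ Model ] Countable 𝒞 × B ++ base a⫝b ++ base σb⫝a ∈ᵗ ⌊ 𝒞 ⌋ × ⌊ 𝒞 ⌋ ⊆ ⌊ 𝒜 ⌋) →
             σ ⊙ b ++ a ≈[ B ] b ++ a
      over {B = B} (𝒞 , c , bases∈ , 𝒞⊆𝒜) = ⫝-stationary {𝒞}
        (λ B∈ → ≈-sym (⊙-same σ {𝒜} fσ b (All.map 𝒞⊆𝒜 B∈)))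
        (⫝-restrict σb⫝a (++ʳ⁻ (base a⫝b) (++ʳ⁻ B bases∈)) 𝒞⊆𝒜)
        (⫝-sym-countable c (⫝-restrict a⫝b (++ˡ⁻ (base a⫝b) (++ʳ⁻ B bases∈)) 𝒞⊆𝒜))
        (++ˡ⁻ B bases∈)
      same : ∀ {k} {B : Vec M k} → B ∈ᵗ ⌊ 𝒜 ⌋ → σ ⊙ b ++ a ≈[ B ] b ++ a
      same B∈ = over (countable-submodel 𝒜 (++⁺ B∈ (++⁺ (base∈ a⫝b) (base∈ σb⫝a))))

  params-⫝ : ∀ {𝒜 n m} {a : Vec M n} {c : Vec M m} → a ∈ᵗ ⌊ 𝒜 ⌋ → a ⫝[ 𝒜 ] c
  params-⫝ {a = a} a∈ = mk⫝ a a∈ λ {_} {B} B∈ a⊆B c₀∈ → ≈-mono (++-⊆ {X = ⟪ B ⟫} {a = a} a⊆B id)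

  -- The automorphism that `copies` provides takes a to its copy in 𝒜 and fixes a, so the copy is a.
  ⫝-self : ∀ {𝒜 n} {a : Vec M n} → a ⫝[ 𝒜 ] a → a ∈ᵗ ⌊ 𝒜 ⌋
  ⫝-self {𝒜} {a = a} a⫝a = from (realize 𝒜 a (base∈ a⫝a))
    where
    from : (Σ[ a₀ ∈ _ ] a₀ ∈ᵗ ⌊ 𝒜 ⌋ × a ≈[ base a⫝a ] a₀) → a ∈ᵗ ⌊ 𝒜 ⌋
    from (a₀ , a₀∈ , a≈a₀) = let (σ , fσ , σa≡a₀) = copies a⫝a (base∈ a⫝a) id a₀∈ a≈a₀ in
      subst (_∈ᵗ ⌊ 𝒜 ⌋) (trans (sym σa≡a₀) (Fixes-⊙ σ fσ (⊆⇒∈ᵗ ++-⊆ˡ))) a₀∈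

  -- U-rank over models and over finite sets

  rank-mono : ∀ m {n} {a : Vec M n} {𝒜 ℬ} → ⌊ 𝒜 ⌋ ⊆ ⌊ ℬ ⌋ → RankAtLeast m a ℬ → RankAtLeast m a 𝒜
  rank-mono zero    𝒜⊆ℬ _ = tt
  rank-mono (suc m) {a = a} 𝒜⊆ℬ (𝒞 , ℬ⊆𝒞 , dep , rank) = 𝒞 , (λ x∈ → ℬ⊆𝒞 (𝒜⊆ℬ x∈)) ,
    (λ ind → dep (↓ⁿˢ-mono a 𝒜⊆ℬ [ (λ x∈ → inj₂ (ℬ⊆𝒞 x∈)) , inj₂ ] ind)) , rank

  rank-⋆ : ∀ m σ {n} {a : Vec M n} {𝒜} → RankAtLeast m a 𝒜 → RankAtLeast m (σ ⊙ a) (σ ⋆ 𝒜)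
  rank-⋆ zero    σ _ = tt
  rank-⋆ (suc m) σ {a = a} {𝒜} (ℬ , 𝒜⊆ℬ , dep , rank) =
    σ ⋆ ℬ , ⋆-mono σ {𝒜} {ℬ} 𝒜⊆ℬ , (λ ind → dep (↓ⁿˢ-⋆⁻ σ a 𝒜 ℬ ind)) , rank-⋆ m σ {𝒜 = ℬ} rank

  rank-pred : ∀ m {n} {a : Vec M n} {𝒜} → RankAtLeast (suc m) a 𝒜 → RankAtLeast m a 𝒜
  rank-pred m (ℬ , 𝒜⊆ℬ , _ , rank) = rank-mono m {ℬ = ℬ} 𝒜⊆ℬ rank

  rank-≤ : ∀ {m m′} → m ≤′ m′ → ∀ {n} {a : Vec M n} {𝒜} → RankAtLeast m′ a 𝒜 → RankAtLeast m a 𝒜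
  rank-≤ ≤′-refl         rank = rank
  rank-≤ (≤′-step m≤m′) {𝒜 = 𝒜} rank = rank-≤ m≤m′ {𝒜 = 𝒜} (rank-pred _ {𝒜 = 𝒜} rank)

  rank-⊆ : ∀ m {n n′} {a : Vec M n} {a′ : Vec M n′} {𝒜} → ⟪ a ⟫ ⊆ ⟪ a′ ⟫ →
           RankAtLeast m a 𝒜 → RankAtLeast m a′ 𝒜
  rank-⊆ zero    a⊆a′ _ = tt
  rank-⊆ (suc m) {a = a} {a′} {𝒜} a⊆a′ (ℬ , 𝒜⊆ℬ , dep , rank) = ℬ , 𝒜⊆ℬ ,
    (λ ind → dep (⫝⇒↓ⁿˢ {𝒜} {a = a} 𝒜⊆ℬ λ c∈ → ⫝-monoˡ a⊆a′ (↓ⁿˢ⇒⫝ ind (All.map inj₂ c∈)))) , rank-⊆ m {𝒜 = ℬ} a⊆a′ rank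

  rank-drop : ∀ m {n} {a : Vec M n} {𝒜 ℬ} → ⌊ 𝒜 ⌋ ⊆ ⌊ ℬ ⌋ →
              RankAtLeast m a ℬ → ¬ RankAtLeast (suc m) a 𝒜 → a ↓ⁿˢ[ ⌊ 𝒜 ⌋ ] ⌊ ℬ ⌋
  rank-drop m {ℬ = ℬ} 𝒜⊆ℬ rank ¬rank = decidable-stable em λ dep → ¬rank (ℬ , 𝒜⊆ℬ , dep , rank)

  Fixes-⋆ : ∀ σ {𝒜} → Fixes σ ⌊ 𝒜 ⌋ → ⌊ 𝒜 ⌋ ≐ ⌊ σ ⋆ 𝒜 ⌋
  Fixes-⋆ σ {𝒜} fσ = (λ x∈ → subst (_∈ ⌊ σ ⋆ 𝒜 ⌋) (fσ x∈) (∈-⋆ σ 𝒜 x∈))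
                   , λ { (d , refl) → d , sym (fσ (d , refl)) }

  rank-fixed : ∀ m σ {n} {a : Vec M n} {𝒜} → Fixes σ ⌊ 𝒜 ⌋ → RankAtLeast m a 𝒜 → RankAtLeast m (σ ⊙ a) 𝒜
  rank-fixed m σ {𝒜 = 𝒜} fσ rank = rank-mono m {ℬ = σ ⋆ 𝒜} (proj₁ (Fixes-⋆ σ {𝒜} fσ)) (rank-⋆ m σ {𝒜 = 𝒜} rank)

  rank-fixed⁻ : ∀ m σ {n} {a : Vec M n} {𝒜} → Fixes σ ⌊ 𝒜 ⌋ → RankAtLeast m (σ ⊙ a) 𝒜 → RankAtLeast m a 𝒜
  rank-fixed⁻ m σ {a = a} {𝒜} fσ rank =
    subst (λ v → RankAtLeast m v 𝒜) (⁻¹-⊙ σ a) (rank-fixed m (σ ⁻¹) {a = σ ⊙ a} {𝒜} (Fixes-⁻¹ σ fσ) rank)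

  ↓ⁿˢ-fixed⁻ : ∀ σ {n} (a : Vec M n) {𝒜} ℬ {ℬ′} → Fixes σ ⌊ 𝒜 ⌋ → ⌊ σ ⋆ ℬ ⌋ ⊆ ⌊ ℬ′ ⌋ →
               σ ⊙ a ↓ⁿˢ[ ⌊ 𝒜 ⌋ ] ⌊ ℬ′ ⌋ → a ↓ⁿˢ[ ⌊ 𝒜 ⌋ ] ⌊ ℬ ⌋
  ↓ⁿˢ-fixed⁻ σ a {𝒜} ℬ fσ σℬ⊆ ind = let (𝒜⊆σ𝒜 , σ𝒜⊆𝒜) = Fixes-⋆ σ {𝒜} fσ in
    ↓ⁿˢ-⋆⁻ σ a 𝒜 ℬ (↓ⁿˢ-mono (σ ⊙ a) 𝒜⊆σ𝒜 [ (λ x∈ → inj₁ (σ𝒜⊆𝒜 x∈)) , (λ x∈ → inj₂ (σℬ⊆ x∈)) ] ind)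

  FreeRealization : ∀ {n} → ℕ → Vec M n → Model → Model → Set (lsuc ℓ)
  FreeRealization m a 𝒜 ℬ =
    Σ[ σ ∈ Aut ] Fixes σ ⌊ 𝒜 ⌋ × σ ⊙ a ↓ⁿˢ[ ⌊ 𝒜 ⌋ ] ⌊ ℬ ⌋ × RankAtLeast m (σ ⊙ a) ℬ

  -- Symmetry and transitivity through 𝒞 make τ a independent from ℬ over 𝒜. Were τ a also
  -- independent from 𝒟 over ℬ, transitivity would make it independent from 𝒞 over 𝒜, against the
  -- dependence of a; so 𝒟 starts a chain above ℬ.
  FreeRealization-step : ∀ m {n} {a : Vec M n} {𝒜 ℬ 𝒞 𝒟} → ⌊ 𝒜 ⌋ ⊆ ⌊ ℬ ⌋ → ⌊ 𝒜 ⌋ ⊆ ⌊ 𝒞 ⌋ →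
    ⌊ ℬ ⌋ ⊆ ⌊ 𝒟 ⌋ → ⌊ 𝒞 ⌋ ⊆ ⌊ 𝒟 ⌋ → ¬ (a ↓ⁿˢ[ ⌊ 𝒜 ⌋ ] ⌊ 𝒞 ⌋) → ⌊ 𝒞 ⌋ ⇓ⁿˢ[ ⌊ 𝒜 ⌋ ] ⌊ ℬ ⌋ →
    FreeRealization m a 𝒞 𝒟 → FreeRealization (suc m) a 𝒜 ℬ
  FreeRealization-step m {a = a} {𝒜} {ℬ} {𝒞} {𝒟} 𝒜⊆ℬ 𝒜⊆𝒞 ℬ⊆𝒟 𝒞⊆𝒟 dep 𝒞↓ℬ (τ , fτ , τa↓𝒟 , rank) =
    τ , (λ x∈ → fτ (𝒜⊆𝒞 x∈)) , ⫝⇒↓ⁿˢ 𝒜⊆ℬ τa⫝ℬ , 𝒟 , ℬ⊆𝒟 , dep′ , rank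
    where
    τa⫝ℬ : ∀ {k} {b : Vec M k} → b ∈ᵗ ⌊ ℬ ⌋ → τ ⊙ a ⫝[ 𝒜 ] b
    τa⫝ℬ b∈ = ⫝-sym (⫝-trans {𝒜} {𝒞} 𝒜⊆𝒞
      (λ {_} {c} c∈ → ⫝-sym (↓ⁿˢ⇒⫝ (𝒞↓ℬ c c∈) (All.map inj₂ b∈)))
      (⫝-sym (↓ⁿˢ⇒⫝ {𝒞} τa↓𝒟 (All.map (λ x∈ → inj₂ (ℬ⊆𝒟 x∈)) b∈))))
    dep′ : ¬ (τ ⊙ a ↓ⁿˢ[ ⌊ ℬ ⌋ ] ⌊ 𝒟 ⌋)
    dep′ ind = dep (↓ⁿˢ-fixed⁻ τ a {𝒜} 𝒞 {𝒞} (λ x∈ → fτ (𝒜⊆𝒞 x∈)) (proj₂ (Fixes-⋆ τ {𝒞} fτ))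
      (⫝⇒↓ⁿˢ 𝒜⊆𝒞 λ c∈ → ⫝-trans {𝒜} {ℬ} 𝒜⊆ℬ τa⫝ℬ (↓ⁿˢ⇒⫝ {ℬ} ind (All.map (λ x∈ → inj₂ (𝒞⊆𝒟 x∈)) c∈))))

  FreeRealization-⊙ : ∀ m σ {n} {a : Vec M n} {𝒜 ℬ} → Fixes σ ⌊ 𝒜 ⌋ →
                      FreeRealization m (σ ⊙ a) 𝒜 ℬ → FreeRealization m a 𝒜 ℬ
  FreeRealization-⊙ m σ {a = a} {𝒜} {ℬ} fσ (τ , fτ , real) = τ ∘ᴬ σ , Fixes-∘ τ σ fτ fσ ,
    subst (λ v → v ↓ⁿˢ[ ⌊ 𝒜 ⌋ ] ⌊ ℬ ⌋ × RankAtLeast m v ℬ) (sym (∘ᴬ-⊙ τ σ a)) real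

  -- The first model 𝒞 of a chain 𝒜 ⊆ 𝒞 ⊆ … that witnesses the rank is made
  -- independent from ℬ; the rest of the chain is then moved over 𝒞.

  abstract
    free-realization : ∀ m {n} {a : Vec M n} {𝒜 ℬ} → ⌊ 𝒜 ⌋ ⊆ ⌊ ℬ ⌋ →
                       RankAtLeast m a 𝒜 → FreeRealization m a 𝒜 ℬ
    free-realization zero {a = a} {𝒜} {ℬ} 𝒜⊆ℬ _ =
      let (𝒩 , 𝒜⊆𝒩 , a∈𝒩) = extend 𝒜 a
          (σ , fσ , ind) = free-copy {𝒜} {𝒩} {ℬ} 𝒜⊆𝒩 𝒜⊆ℬ
      in σ , fσ , ind (σ ⊙ a) (∈ᵗ-⋆ σ 𝒩 a∈𝒩) , tt
    free-realization (suc m) {a = a} {𝒜} {ℬ} 𝒜⊆ℬ (𝒞 , 𝒜⊆𝒞 , dep , rank) =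
      copy (free-copy {𝒜} {𝒞} {ℬ} 𝒜⊆𝒞 𝒜⊆ℬ)
      where
      copy : FreeCopy 𝒜 𝒞 ℬ → FreeRealization (suc m) a 𝒜 ℬ
      copy (σ , fσ , σ𝒞↓ℬ) =
        let (𝒟 , ℬ⊆𝒟 , σ𝒞⊆𝒟) = join ℬ (σ ⋆ 𝒞)
        in FreeRealization-⊙ (suc m) σ {a = a} {𝒜} {ℬ} fσ
             (FreeRealization-step m {a = σ ⊙ a} {𝒜} {ℬ} {σ ⋆ 𝒞} {𝒟} 𝒜⊆ℬ
               (λ {x} x∈ → subst (_∈ ⌊ σ ⋆ 𝒞 ⌋) (fσ x∈) (∈-⋆ σ 𝒞 (𝒜⊆𝒞 x∈))) ℬ⊆𝒟 σ𝒞⊆𝒟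
               (λ ind → dep (↓ⁿˢ-fixed⁻ σ a {𝒜} 𝒞 {σ ⋆ 𝒞} fσ id ind)) σ𝒞↓ℬ
               (free-realization m {a = σ ⊙ a} {σ ⋆ 𝒞} {𝒟} σ𝒞⊆𝒟 (rank-⋆ m σ {𝒜 = 𝒞} rank)))

  -- U(a/A) ≥ m for finite A.

  infix 4 U[_/_]≥_

  record U[_/_]≥_ {n k} (a : Vec M n) (A : Vec M k) (m : ℕ) : Set (lsuc ℓ) where
    constructor mkU
    field
      model  : Model
      A∈     : A ∈ᵗ ⌊ model ⌋
      rank   : RankAtLeast m a model

  U-mono : ∀ {n k l m} {a : Vec M n} {A : Vec M k} {B : Vec M l} → ⟪ A ⟫ ⊆ ⟪ B ⟫ → U[ a / B ]≥ m → U[ a / A ]≥ m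
  U-mono A⊆B (mkU 𝒩 B∈ rank) = mkU 𝒩 (⊆⇒∈ᵗ λ x∈ → ∈ᵗ⇒⊆ B∈ (A⊆B x∈)) rank

  U-≤ : ∀ {n k m m′} {a : Vec M n} {A : Vec M k} → m ≤ m′ → U[ a / A ]≥ m′ → U[ a / A ]≥ m
  U-≤ m≤m′ (mkU 𝒩 A∈ rank) = mkU 𝒩 A∈ (rank-≤ (≤⇒≤′ m≤m′) {𝒜 = 𝒩} rank)

  U-⊙ : ∀ σ {n k m} {a : Vec M n} {A : Vec M k} → U[ a / A ]≥ m → U[ σ ⊙ a / σ ⊙ A ]≥ m
  U-⊙ σ {m = m} (mkU 𝒩 A∈ rank) = mkU (σ ⋆ 𝒩) (∈ᵗ-⋆ σ 𝒩 A∈) (rank-⋆ m σ {𝒜 = 𝒩} rank)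

  U-≈ : ∀ {n k m} {a b : Vec M n} {A : Vec M k} → a ≈[ A ] b → U[ a / A ]≥ m → U[ b / A ]≥ m
  U-≈ {m = m} {a} {A = A} (σ , fσ , refl) u = subst (λ B → U[ σ ⊙ a / B ]≥ m) (Fixes-⊙ σ fσ (∈ᵗ-self A)) (U-⊙ σ u)

  U-⊆ : ∀ {n n′ k m} {a : Vec M n} {a′ : Vec M n′} {A : Vec M k} → ⟪ a ⟫ ⊆ ⟪ a′ ⟫ → U[ a / A ]≥ m → U[ a′ / A ]≥ m
  U-⊆ {m = m} a⊆a′ (mkU 𝒩 A∈ rank) = mkU 𝒩 A∈ (rank-⊆ m {𝒜 = 𝒩} a⊆a′ rank)

  U≥0 : ∀ {n k} (a : Vec M n) (A : Vec M k) → U[ a / A ]≥ 0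
  U≥0 a A = let (𝒩 , _ , A∈) = tuple-model A in mkU 𝒩 A∈ tt

  greatest : ∀ {p} (P : ℕ → Set p) → P 0 → ∀ n → ¬ P n → ∃ λ m → P m × ¬ P (suc m)
  greatest P p₀ zero    ¬p = contradiction p₀ ¬p
  greatest P p₀ (suc n) ¬p with em {P = P n}
  ... | yes p = n , p , ¬p
  ... | no ¬q = greatest P p₀ n ¬q

  U-bounded : ∀ {n} (a : Vec M n) → ∃ λ m → ∀ {k} {A : Vec M k} → ¬ (U[ a / A ]≥ m)
  U-bounded a = let (m , ¬rank) = rank-bounded a in m , λ (mkU 𝒩 _ rank) → ¬rank 𝒩 rank

  U-exact : ∀ {n k} (a : Vec M n) (A : Vec M k) → ∃ λ m → U[ a / A ]≥ m × ¬ (U[ a / A ]≥ suc m)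
  U-exact a A = let (m , ¬u) = U-bounded a in greatest (U[ a / A ]≥_) (U≥0 a A) m ¬u

  -- Lascar types

  SameOver : ∀ {n} → Model → Vec M n → Vec M n → Set ℓ
  SameOver 𝒜 a b = ∀ {k} {B : Vec M k} → B ∈ᵗ ⌊ 𝒜 ⌋ → a ≈[ B ] b

  module TypeLabel (𝒩 : Model) (c : Countable 𝒩) (n : ℕ) where

    -- A type over 𝒩 is recorded by the pairs (B , d) from 𝒩 for which d realizes its restriction to
    -- B. By s-saturation this determines the type, and since 𝒩 is countable, `strongLimit` keeps
    -- the number of labels below δ.
    Label : Set ℓ
    Label = ∃ (Vec ∣ str 𝒩 ∣) × Vec ∣ str 𝒩 ∣ n → Bool

    Label≺Δ : Label ≺ Δ
    Label≺Δ = strongLimit _ (↣-≺-trans (mk↣ {to = code} code-injective) uncountable)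
      where
      code : ∃ (Vec ∣ str 𝒩 ∣) × Vec ∣ str 𝒩 ∣ n → ℕ
      code ((_ , B) , d) = pairing (encode c B) (encode c d)
      code-injective : Injective _≡_ _≡_ code
      code-injective {(_ , B) , d} {(_ , B′) , d′} eq
        with pairing-injective (encode c B) (encode c B′) eq
      ... | p , q with encode-injective c B B′ p | encode-injective c d d′ q
      ... | refl | refl = refl

    label : Vec M n → Label
    label a ((_ , B) , d) = isYes (em {P = a ≈[ map (ι 𝒩) B ] map (ι 𝒩) d})

    label-same : ∀ {a b} → label a ≡ label b → SameOver 𝒩 a b
    label-same {a} {b} eq {B = B} B∈ = from (ι-preimage 𝒩 B∈) (realize 𝒩 a B∈)
      where
      from : (∃ λ w → map (ι 𝒩) w ≡ B) → (Σ[ d ∈ Vec M n ] d ∈ᵗ ⌊ 𝒩 ⌋ × a ≈[ B ] d) → a ≈[ B ] b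
      from (w , refl) (d , d∈ , a≈d) with ι-preimage 𝒩 d∈
      ... | v , refl = ≈-trans a≈d (≈-sym (toWitness {a? = em} (subst T (cong (λ f → f ((-, w) , v)) eq)
                         (fromWitness {a? = em} a≈d))))

  module _ {n k q} {A : Vec M k} (Q : Vec M n → Vec M n → Set q) (Q-equiv : IsEquivalence Q)
           (Q-invariant : ∀ σ → Fixes σ ⟪ A ⟫ → ∀ {a b} → Q a b → Q (σ ⊙ a) (σ ⊙ b))
           (Q-coarse : ∀ {𝒩} → A ∈ᵗ ⌊ 𝒩 ⌋ → ∀ {a b} → SameOver 𝒩 a b → Q a b) where

    -- Relations in E(A) live at level ℓ, whereas `Q` may quantify over models or over E(A) itself;
    -- `True em` is a small proposition with the same truth value. The labels of types over a
    -- countable model around A bound the number of classes.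
    bounded-relation : E A n
    bounded-relation = record
      { R           = λ a b → Lift ℓ (True (em {P = Q a b}))
      ; equivalence = record
        { refl  = lift (fromWitness (IsEquivalence.refl Q-equiv))
        ; sym   = λ (lift r) → lift (fromWitness (IsEquivalence.sym Q-equiv (toWitness r)))
        ; trans = λ (lift r) (lift s) → lift (fromWitness (IsEquivalence.trans Q-equiv (toWitness r) (toWitness s)))
        }
      ; invariant   = λ {σ} (iso , fσ) (lift r) → lift (fromWitness (Q-invariant (mkAut σ iso) fσ (toWitness r)))
      ; boundedly   = let (𝒩 , c , A∈) = tuple-model A in
          TypeLabel.Label 𝒩 c n , TypeLabel.Label≺Δ 𝒩 c n , TypeLabel.label 𝒩 c n ,
          λ eq → lift (fromWitness (Q-coarse {𝒩} A∈ (TypeLabel.label-same 𝒩 c n eq)))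
      }

    ≡ᴸ⇒bounded-relation : ∀ {a b} → a ≡ᴸ b over ⟪ A ⟫ → Q a b
    ≡ᴸ⇒bounded-relation a≡b = toWitness (lower (a≡b A (∈ᵗ-self A) bounded-relation))

  ≡ᴸ-mono : ∀ {n} {a b : Vec M n} {X Y} → X ⊆ Y → a ≡ᴸ b over Y → a ≡ᴸ b over X
  ≡ᴸ-mono X⊆Y a≡b A A∈ = a≡b A (All.map X⊆Y A∈)

  ≡ᴸ-equivalence : ∀ {n X} → IsEquivalence (λ (a b : Vec M n) → a ≡ᴸ b over X)
  ≡ᴸ-equivalence = record
    { refl  = λ _ _ e → IsEquivalence.refl (E.equivalence e)
    ; sym   = λ a≡b A A∈ e → IsEquivalence.sym (E.equivalence e) (a≡b A A∈ e)
    ; trans = λ a≡b b≡c A A∈ e → IsEquivalence.trans (E.equivalence e) (a≡b A A∈ e) (b≡c A A∈ e)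
    }

  ≡ᴸ-sym : ∀ {n X} {a b : Vec M n} → a ≡ᴸ b over X → b ≡ᴸ a over X
  ≡ᴸ-sym = IsEquivalence.sym ≡ᴸ-equivalence

  ≡ᴸ-trans : ∀ {n X} {a b c : Vec M n} → a ≡ᴸ b over X → b ≡ᴸ c over X → a ≡ᴸ c over X
  ≡ᴸ-trans = IsEquivalence.trans ≡ᴸ-equivalence

  -- Equality of types over a finite A is itself a relation of E(A).
  ≡ᴸ⇒≈ : ∀ {n k} {a b : Vec M n} {A : Vec M k} → a ≡ᴸ b over ⟪ A ⟫ → a ≈[ A ] b
  ≡ᴸ⇒≈ {A = A} = ≡ᴸ⇒bounded-relation (_≈[ A ]_)
    (record { refl = ≈-refl ; sym = ≈-sym ; trans = ≈-trans })
    (λ σ fσ {a} {b} a≈b → subst (λ B → σ ⊙ a ≈[ B ] σ ⊙ b) (Fixes-⊙ σ fσ (∈ᵗ-self A)) (≈-conj σ a≈b))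
    (λ A∈ same → same A∈)

  -- A free extension b of t(a/𝒜) is equivalent to one of boundedly many
  -- representatives r, and a copy of r in 𝒜 over a base of b is then equivalent to b.

  module _ {n k} {A : Vec M k} (e : E A n) {𝒜} (A∈ : A ∈ᵗ ⌊ 𝒜 ⌋) (a : Vec M n) where

    private
      X    = proj₁ (E.boundedly e)
      X≺Δ  = proj₁ (proj₂ (E.boundedly e))
      cls  = proj₁ (proj₂ (proj₂ (E.boundedly e)))
      open E e using (R)

      move-R : ∀ σ → Fixes σ ⟪ A ⟫ → ∀ {b c b′ c′} → σ ⊙ b ≡ b′ → σ ⊙ c ≡ c′ → R b c → R b′ c′
      move-R σ fσ refl refl = E.invariant e (isomorphism σ , fσ)

      representative : ∀ x → ∃ λ r → (∃ λ v → cls v ≡ x) → cls r ≡ x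
      representative x with em {P = ∃ λ v → cls v ≡ x}
      ... | yes (v , eq) = v , λ _ → eq
      -- A dummy for labels that `cls` does not attain.
      ... | no none      = a , λ found → contradiction found none

      Index : Set ℓ
      Index = ∣ str 𝒜 ∣ ⊎ (Σ[ x ∈ X ] Lift ℓ (Fin n))

      element : Index → M
      element (inj₁ d)            = ι 𝒜 d
      element (inj₂ (x , lift i)) = lookup (proj₁ (representative x)) i

      representatives-model : Σ[ 𝒟 ∈ Model ] range element ⊆ ⌊ 𝒟 ⌋
      representatives-model = family-model
        (⊎-≺ (bounded 𝒜) (regular X _ X≺Δ λ _ → Lift-≺ (Fin-≺ n))) element

      reflect : ∀ {b r} → R b r → b ⫝[ 𝒜 ] r → Σ[ d ∈ Vec M n ] d ∈ᵗ ⌊ 𝒜 ⌋ × R b d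
      reflect {b} {r} Rbr b⫝r = copy (realize 𝒜 r (++⁺ A∈ (base∈ b⫝r)))
        where
        copy : (Σ[ d ∈ _ ] d ∈ᵗ ⌊ 𝒜 ⌋ × r ≈[ A ++ base b⫝r ] d) → _
        copy (d , d∈ , r≈d) =
          let (ρ , fρ , ρr≡d) = copies b⫝r (++⁺ A∈ (base∈ b⫝r)) (++-⊆ʳ A) d∈ r≈d in
          d , d∈ , move-R ρ (λ x∈ → fρ (++-⊆ʳ b (++-⊆ˡ x∈))) (Fixes-⊙ ρ fρ (⊆⇒∈ᵗ ++-⊆ˡ)) ρr≡d Rbr

    abstract
      represented : Σ[ d ∈ Vec M n ] d ∈ᵗ ⌊ 𝒜 ⌋ × R a d
      represented = from representatives-model
        where
        conclude : ∀ σ → Fixes σ ⌊ 𝒜 ⌋ → (Σ[ d ∈ Vec M n ] d ∈ᵗ ⌊ 𝒜 ⌋ × R (σ ⊙ a) d) →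
                   Σ[ d ∈ Vec M n ] d ∈ᵗ ⌊ 𝒜 ⌋ × R a d
        conclude σ fσ (d , d∈ , r) = d , d∈ ,
          move-R (σ ⁻¹) (λ x∈ → Fixes-⁻¹ σ fσ (∈ᵗ⇒⊆ A∈ x∈)) (⁻¹-⊙ σ a) (Fixes-⊙ (σ ⁻¹) (Fixes-⁻¹ σ fσ) d∈) r
        from : (Σ[ 𝒟 ∈ Model ] range element ⊆ ⌊ 𝒟 ⌋) → Σ[ d ∈ Vec M n ] d ∈ᵗ ⌊ 𝒜 ⌋ × R a d
        from (𝒟 , ⊆𝒟) =
          let (σ , fσ , σa↓𝒟 , _) = free-realization 0 {a = a} {𝒜} {𝒟} (λ { (d , refl) → ⊆𝒟 (inj₁ d , refl) }) tt
              (r , r-eq) = representative (cls (σ ⊙ a))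
          in conclude σ fσ (reflect
               (proj₂ (proj₂ (proj₂ (E.boundedly e))) (sym (r-eq (σ ⊙ a , refl))))
               (↓ⁿˢ⇒⫝ {𝒜} σa↓𝒟 (rep∈ (cls (σ ⊙ a)))))
          where
          rep∈ : ∀ x → proj₁ (representative x) ∈ᵗ ⌊ 𝒜 ⌋ ∪ ⌊ 𝒟 ⌋
          rep∈ x = subst (_∈ᵗ ⌊ 𝒜 ⌋ ∪ ⌊ 𝒟 ⌋) (tabulate∘lookup _)
                     (tabulate⁺ λ i → inj₂ (⊆𝒟 (inj₂ (x , lift i) , refl)))

  -- By `represented`, a is equivalent to some d in 𝒜. An automorphism over A d that takes a to b
  -- preserves this equivalence, so b is equivalent to d too.
  same⇒≡ᴸ : ∀ {𝒜 n} {a b : Vec M n} → SameOver 𝒜 a b → a ≡ᴸ b over ⌊ 𝒜 ⌋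
  same⇒≡ᴸ {𝒜} {a = a} {b} same A A∈ e = from (represented e {𝒜} A∈ a)
    where
    from : (Σ[ d ∈ _ ] d ∈ᵗ ⌊ 𝒜 ⌋ × E.R e a d) → E.R e a b
    from (d , d∈ , r) = along (same (++⁺ A∈ d∈))
      where
      along : a ≈[ A ++ d ] b → E.R e a b
      along (ρ , fρ , ρa≡b) = IsEquivalence.trans (E.equivalence e) r (IsEquivalence.sym (E.equivalence e)
        (subst₂ (E.R e) ρa≡b (Fixes-⊙ ρ fρ (⊆⇒∈ᵗ (++-⊆ʳ A)))
          (E.invariant e (isomorphism ρ , λ x∈ → fρ (++-⊆ˡ x∈)) r)))

  same⇒≡ᴸ⟪⟫ : ∀ {𝒜 n k} {a b : Vec M n} {A : Vec M k} → A ∈ᵗ ⌊ 𝒜 ⌋ → SameOver 𝒜 a b → a ≡ᴸ b over ⟪ A ⟫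
  same⇒≡ᴸ⟪⟫ {𝒜} A∈ same = ≡ᴸ-mono (∈ᵗ⇒⊆ A∈) (same⇒≡ᴸ {𝒜} same)

  -- Equality of Lascar types over A is itself in E(A), being implied by equality of types over a
  -- model around A; so `represented` applies to it.
  ≡ᴸ-realize : ∀ 𝒜 {n k} (a : Vec M n) {A : Vec M k} → A ∈ᵗ ⌊ 𝒜 ⌋ →
               Σ[ d ∈ Vec M n ] d ∈ᵗ ⌊ 𝒜 ⌋ × a ≡ᴸ d over ⟪ A ⟫
  ≡ᴸ-realize 𝒜 {n} a {A} A∈ = let (d , d∈ , r) = represented Lt {𝒜} A∈ a in d , d∈ , toWitness (lower r)
    where
    Lt : E A n
    Lt = bounded-relation (_≡ᴸ_over ⟪ A ⟫) ≡ᴸ-equivalence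
      (λ σ fσ a≡b A′ A′∈ e → E.invariant e (isomorphism σ , λ x∈ → fσ (∈ᵗ⇒⊆ A′∈ x∈)) (a≡b A′ A′∈ e))
      (λ {𝒩} A∈ → same⇒≡ᴸ⟪⟫ {𝒩} A∈)

  U-fixed : ∀ σ {n k m} {a : Vec M n} {A : Vec M k} → Fixes σ ⟪ A ⟫ → U[ σ ⊙ a / A ]≥ m → U[ a / A ]≥ m
  U-fixed σ {a = a} fσ = U-≈ (≈-sym (≈-⊙ σ fσ a))

  ≈-fixed⁻ : ∀ σ {n m k} {a : Vec M n} {A : Vec M k} {d e : Vec M m} {X : Subset} → Fixes σ X →
             A ∈ᵗ X → d ∈ᵗ X → e ∈ᵗ X → d ≈[ σ ⊙ a ++ A ] e → d ≈[ a ++ A ] e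
  ≈-fixed⁻ σ {a = a} {A} {d} {e} fσ A∈ d∈ e∈ d≈e = ≈-conj⁻ σ
    (subst₂ (λ d e → d ≈[ σ ⊙ (a ++ A) ] e) (sym (Fixes-⊙ σ fσ d∈)) (sym (Fixes-⊙ σ fσ e∈))
      (subst (λ X → d ≈[ X ] e) (sym (⊙-++ σ a refl (Fixes-⊙ σ fσ A∈))) d≈e))

  -- This relation between d and e has boundedly many classes, so equality of Lascar
  -- types over A implies it; no chain of types over models from d to e is needed.

  RankIndiscernible : ∀ {k m} → Vec M k → Vec M m → Vec M m → Set (lsuc ℓ)
  RankIndiscernible A d e = ∀ {n} (a : Vec M n) u 𝒟 → A ∈ᵗ ⌊ 𝒟 ⌋ → d ∈ᵗ ⌊ 𝒟 ⌋ → e ∈ᵗ ⌊ 𝒟 ⌋ →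
    ¬ (U[ a / A ]≥ suc u) → RankAtLeast u a 𝒟 → d ≈[ a ++ A ] e

  module _ {k} {A : Vec M k} where

    -- The middle tuple e need not lie in 𝒟. So a is moved over 𝒟 to a tuple of the same rank over a
    -- model that contains e as well.
    RankIndiscernible-trans : ∀ {m} {d e f : Vec M m} →
      RankIndiscernible A d e → RankIndiscernible A e f → RankIndiscernible A d f
    RankIndiscernible-trans {e = e} {f} d~e e~f a u 𝒟 A∈ d∈ f∈ ¬u rank =
      let (𝒟′ , 𝒟⊆ , e∈) = extend 𝒟 e in
      from {𝒟′} 𝒟⊆ e∈ (free-realization u {a = a} {𝒟} {𝒟′} 𝒟⊆ rank)
      where
      from : ∀ {𝒟′} → ⌊ 𝒟 ⌋ ⊆ ⌊ 𝒟′ ⌋ → e ∈ᵗ ⌊ 𝒟′ ⌋ → FreeRealization u a 𝒟 𝒟′ → _ ≈[ a ++ A ] f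
      from {𝒟′} 𝒟⊆ e∈ (σ , fσ , _ , rank′) = ≈-fixed⁻ σ fσ A∈ d∈ f∈ (≈-trans
        (d~e (σ ⊙ a) u 𝒟′ (All.map 𝒟⊆ A∈) (All.map 𝒟⊆ d∈) e∈ ¬u′ rank′)
        (e~f (σ ⊙ a) u 𝒟′ (All.map 𝒟⊆ A∈) e∈ (All.map 𝒟⊆ f∈) ¬u′ rank′))
        where
        ¬u′ : ¬ (U[ σ ⊙ a / A ]≥ suc u)
        ¬u′ U = ¬u (U-fixed σ (λ x∈ → fσ (∈ᵗ⇒⊆ A∈ x∈)) U)

    RankIndiscernible-⊙ : ∀ σ → Fixes σ ⟪ A ⟫ → ∀ {m} {d e : Vec M m} →
      RankIndiscernible A d e → RankIndiscernible A (σ ⊙ d) (σ ⊙ e)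
    RankIndiscernible-⊙ σ fσ {d = d} {e} d~e a u 𝒟 A∈ d∈ e∈ ¬u rank =
      subst (λ X → σ ⊙ d ≈[ X ] σ ⊙ e) (⊙-++ σ (σ ⁻¹ ⊙ a) (⊙-⁻¹ σ a) (Fixes-⊙ σ fσ (∈ᵗ-self A)))
        (≈-conj σ (d~e (σ ⁻¹ ⊙ a) u (σ ⁻¹ ⋆ 𝒟)
          (back A∈ (Fixes-⊙ (σ ⁻¹) (Fixes-⁻¹ σ fσ) (∈ᵗ-self A))) (back d∈ (⁻¹-⊙ σ d)) (back e∈ (⁻¹-⊙ σ e))
          (λ U → ¬u (U-fixed (σ ⁻¹) (Fixes-⁻¹ σ fσ) U)) (rank-⋆ u (σ ⁻¹) {𝒜 = 𝒟} rank)))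
      where
      back : ∀ {l} {v w : Vec M l} → v ∈ᵗ ⌊ 𝒟 ⌋ → σ ⁻¹ ⊙ v ≡ w → w ∈ᵗ ⌊ σ ⁻¹ ⋆ 𝒟 ⌋
      back v∈ refl = ∈ᵗ-⋆ (σ ⁻¹) 𝒟 v∈

    -- Once a is moved to have rank u over a model 𝒟′ around 𝒟 and 𝒩, maximality of u forbids a drop
    -- between 𝒩 and 𝒟′. The type over 𝒟′ therefore has a base in 𝒩, over which d and e agree.
    same⇒RankIndiscernible : ∀ {𝒩} → A ∈ᵗ ⌊ 𝒩 ⌋ → ∀ {m} {d e : Vec M m} → SameOver 𝒩 d e → RankIndiscernible A d e
    same⇒RankIndiscernible {𝒩} A∈𝒩 {d = d} {e} same a u 𝒟 A∈ d∈ e∈ ¬u rank =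
      let (𝒟′ , 𝒟⊆ , 𝒩⊆) = join 𝒟 𝒩 in
      from {𝒟′} 𝒟⊆ 𝒩⊆ (free-realization u {a = a} {𝒟} {𝒟′} 𝒟⊆ rank)
      where
      from : ∀ {𝒟′} → ⌊ 𝒟 ⌋ ⊆ ⌊ 𝒟′ ⌋ → ⌊ 𝒩 ⌋ ⊆ ⌊ 𝒟′ ⌋ → FreeRealization u a 𝒟 𝒟′ → d ≈[ a ++ A ] e
      from {𝒟′} 𝒟⊆ 𝒩⊆ (σ , fσ , _ , rank′) = ≈-fixed⁻ σ fσ A∈ d∈ e∈ (nonsplit
        (rank-drop u {a = σ ⊙ a} {𝒩} {𝒟′} 𝒩⊆ rank′ λ rank″ →
          ¬u (U-fixed σ (λ x∈ → fσ (∈ᵗ⇒⊆ A∈ x∈)) (mkU 𝒩 A∈𝒩 rank″))))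
        where
        nonsplit : σ ⊙ a ↓ⁿˢ[ ⌊ 𝒩 ⌋ ] ⌊ 𝒟′ ⌋ → d ≈[ σ ⊙ a ++ A ] e
        nonsplit (_ , B , B∈ , ¬splits) = ≈-mono (++-mono (σ ⊙ a) (++-⊆ʳ B))
          (nonsplitting (NS-mono (++-⊆ˡ {a = B}) (All.map inj₁ (++⁺ B∈ A∈𝒩)) (¬Splits⇒NS {a = σ ⊙ a} ¬splits))
            (All.map (λ x∈ → inj₂ (𝒟⊆ x∈)) d∈) (All.map (λ x∈ → inj₂ (𝒟⊆ x∈)) e∈) (same (++⁺ B∈ A∈𝒩)))

    ≡ᴸ⇒RankIndiscernible : ∀ {m} {d e : Vec M m} → d ≡ᴸ e over ⟪ A ⟫ → RankIndiscernible A d e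
    ≡ᴸ⇒RankIndiscernible = ≡ᴸ⇒bounded-relation (RankIndiscernible A)
      (record
        { refl  = λ _ _ _ _ _ _ _ _ → ≈-refl
        ; sym   = λ d~e a u 𝒟 A∈ d∈ e∈ ¬u rank → ≈-sym (d~e a u 𝒟 A∈ e∈ d∈ ¬u rank)
        ; trans = λ d~e e~f → RankIndiscernible-trans d~e e~f })
      (λ σ fσ d~e → RankIndiscernible-⊙ σ fσ d~e) (λ {𝒩} A∈ same → same⇒RankIndiscernible {𝒩} A∈ same)

  -- Lascar splitting and types of maximal rank

  record LascarNS {n k} (a : Vec M n) (A : Vec M k) (𝒟 : Model) : Set (lsuc ℓ) where
    constructor mkLNS
    field
      lascar-nonsplitting : ∀ {m} {d e : Vec M m} → d ∈ᵗ ⌊ 𝒟 ⌋ → e ∈ᵗ ⌊ 𝒟 ⌋ →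
                            d ≡ᴸ e over ⟪ A ⟫ → d ≈[ a ++ A ] e

  open LascarNS

  ¬LascarSplits⇒LascarNS : ∀ {n k} {a : Vec M n} {A : Vec M k} {𝒟} → ¬ LascarSplits a ⌊ 𝒟 ⌋ A → LascarNS a A 𝒟
  ¬LascarSplits⇒LascarNS {a = a} ¬splits = mkLNS λ {_} {d} {e} d∈ e∈ d≡e → decidable-stable em λ d≉e →
    ¬splits (-, d , e , d∈ , e∈ , d≡e , λ ad≡ae → d≉e (≈-++ˡ⁻ a (≡ᵗ⟪⟫⇒≈ ad≡ae)))

  LascarNS⇒¬LascarSplits : ∀ {n k} {a : Vec M n} {A : Vec M k} {𝒟} {X : Subset} → X ⊆ ⌊ 𝒟 ⌋ →
                           LascarNS a A 𝒟 → ¬ LascarSplits a X A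
  LascarNS⇒¬LascarSplits {a = a} X⊆ ns (_ , d , e , d∈ , e∈ , d≡e , ad≢ae) =
    ad≢ae (≈⇒≡ᵗ⟪⟫ (≈-++ˡ a (lascar-nonsplitting ns (All.map X⊆ d∈) (All.map X⊆ e∈) d≡e)))

  maximal-rank⇒LascarNS : ∀ {n k u} {a : Vec M n} {A : Vec M k} {𝒟} → A ∈ᵗ ⌊ 𝒟 ⌋ →
    ¬ (U[ a / A ]≥ suc u) → RankAtLeast u a 𝒟 → LascarNS a A 𝒟
  maximal-rank⇒LascarNS {u = u} {a} {𝒟 = 𝒟} A∈ ¬u rank = mkLNS λ d∈ e∈ d≡e →
    ≡ᴸ⇒RankIndiscernible d≡e a u 𝒟 A∈ d∈ e∈ ¬u rank

  Realization : ∀ {n k} → ℕ → Vec M n → Vec M k → Model → Set (lsuc ℓ)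
  Realization u a A 𝒟 = Σ[ σ ∈ Aut ] Fixes σ ⟪ A ⟫ × a ≡ᴸ σ ⊙ a over ⟪ A ⟫ × RankAtLeast u (σ ⊙ a) 𝒟

  abstract
    -- The free realization is taken over a model 𝒩 around A that witnesses the rank. As σ fixes all
    -- of 𝒩, it preserves the Lascar type over A.
    U-realize : ∀ {n k u} {a : Vec M n} {A : Vec M k} → U[ a / A ]≥ u → ∀ 𝒟 → Realization u a A 𝒟
    U-realize {u = u} {a} {A} (mkU 𝒩 A∈ rank) 𝒟 = let (𝒟′ , 𝒩⊆ , 𝒟⊆) = join 𝒩 𝒟 in
      from {𝒟′} 𝒟⊆ (free-realization u {a = a} {𝒩} {𝒟′} 𝒩⊆ rank)
      where
      from : ∀ {𝒟′} → ⌊ 𝒟 ⌋ ⊆ ⌊ 𝒟′ ⌋ → FreeRealization u a 𝒩 𝒟′ → Realization u a A 𝒟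
      from {𝒟′} 𝒟⊆ (σ , fσ , _ , rank′) = σ , (λ x∈ → fσ (∈ᵗ⇒⊆ A∈ x∈)) ,
        same⇒≡ᴸ⟪⟫ {𝒩} A∈ (⊙-same σ {𝒩} fσ a) , rank-mono u {ℬ = 𝒟′} 𝒟⊆ rank′

  -- The tuple d ∈ 𝒟 is replaced by a realization e of its Lascar type over A that
  -- is independent from b and b′; symmetry returns from e to d.

  module _ {n k} {b b′ : Vec M n} {A : Vec M k} {𝒟} (A∈ : A ∈ᵗ ⌊ 𝒟 ⌋)
           (b-ns : LascarNS b A 𝒟) (b′-ns : LascarNS b′ A 𝒟) (b≡b′ : b ≡ᴸ b′ over ⟪ A ⟫)
           {m} {d : Vec M m} (d∈ : d ∈ᵗ ⌊ 𝒟 ⌋) where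

    private
      return : ∀ {e : Vec M m} {c : Vec M n} → LascarNS c A 𝒟 → d ≡ᴸ e over ⟪ A ⟫ → e ⫝[ 𝒟 ] c → c ++ e ≈[ A ] c ++ d
      return {e} {c} c-ns d≡e e⫝c = ≈-++ˡ c (from (≡ᴸ-realize 𝒟 e (++⁺ A∈ (base∈ c⫝e))))
        where
        c⫝e : c ⫝[ 𝒟 ] e
        c⫝e = ⫝-sym e⫝c
        from : (Σ[ e₀ ∈ _ ] e₀ ∈ᵗ ⌊ 𝒟 ⌋ × e ≡ᴸ e₀ over ⟪ A ++ base c⫝e ⟫) → e ≈[ c ++ A ] d
        from (e₀ , e₀∈ , e≡e₀) = ≈-trans
          (≈-mono (++-mono c (++-⊆ˡ {a = A})) (copies c⫝e (++⁺ A∈ (base∈ c⫝e)) (++-⊆ʳ A) e₀∈ (≡ᴸ⇒≈ e≡e₀)))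
          (≈-sym (lascar-nonsplitting c-ns d∈ e₀∈ (≡ᴸ-trans d≡e (≡ᴸ-mono (++-⊆ˡ {a = A}) e≡e₀))))

      through : ∀ {u 𝒟′} → ¬ (U[ d / A ]≥ suc u) → ⌊ 𝒟 ⌋ ⊆ ⌊ 𝒟′ ⌋ → b ++ b′ ∈ᵗ ⌊ 𝒟′ ⌋ →
                Realization u d A 𝒟′ → b ++ d ≈[ A ] b′ ++ d
      through {u} {𝒟′} ¬u 𝒟⊆ bb′∈ (σ , fσ , d≡e , rank) = ≈-trans
        (≈-sym (return b-ns d≡e (e⫝ b (++ˡ⁻ b bb′∈)))) (≈-trans
        (≈-++ʳ e (≡ᴸ⇒RankIndiscernible b≡b′ e u 𝒟′ (All.map 𝒟⊆ A∈) (++ˡ⁻ b bb′∈) (++ʳ⁻ b bb′∈) ¬u′ rank))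
        (return b′-ns d≡e (e⫝ b′ (++ʳ⁻ b bb′∈))))
        where
        e = σ ⊙ d
        ¬u′ : ¬ (U[ e / A ]≥ suc u)
        ¬u′ U = ¬u (U-fixed σ fσ U)
        e⫝ : ∀ c → c ∈ᵗ ⌊ 𝒟′ ⌋ → e ⫝[ 𝒟 ] c
        e⫝ c c∈ = ↓ⁿˢ⇒⫝ {𝒟} (rank-drop u {𝒜 = 𝒟} {𝒟′} 𝒟⊆ rank (λ r → ¬u′ (mkU 𝒟 A∈ r))) (All.map inj₂ c∈)

    LascarNS-stationary : b ++ d ≈[ A ] b′ ++ d
    LascarNS-stationary =
      let (u , U , ¬U) = U-exact d A
          (𝒟′ , 𝒟⊆ , bb′∈) = extend 𝒟 (b ++ b′)
      in through {u} {𝒟′} ¬U 𝒟⊆ bb′∈ (U-realize U 𝒟′)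

  LascarNS-same : ∀ {n k} {b b′ : Vec M n} {A : Vec M k} {𝒟} → A ∈ᵗ ⌊ 𝒟 ⌋ →
    LascarNS b A 𝒟 → LascarNS b′ A 𝒟 → b ≡ᴸ b′ over ⟪ A ⟫ → SameOver 𝒟 b b′
  LascarNS-same {b = b} {b′} {A} {𝒟} A∈ ns ns′ b≡b′ {B = B} B∈ =
    ≈-mono (++-⊆ˡ {a = B}) (≈-++ʳ⁻ B (LascarNS-stationary {𝒟 = 𝒟} A∈ ns ns′ b≡b′ B∈))

  -- Some σ b with the Lascar type of b over A has rank u over 𝒟. Neither of the two types over 𝒟
  -- Lascar splits over A, so they agree and b inherits the rank.
  LascarNS⇒maximal-rank : ∀ {n k l u} {b : Vec M n} {A : Vec M k} {B : Vec M l} {𝒟} → A ∈ᵗ ⌊ 𝒟 ⌋ →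
    LascarNS b A 𝒟 → U[ b / A ]≥ u → ¬ (U[ b / A ]≥ suc u) → B ∈ᵗ ⌊ 𝒟 ⌋ → U[ b / B ]≥ u
  LascarNS⇒maximal-rank {u = u} {b} {A} {B} {𝒟} A∈ ns U ¬U B∈ = from (U-realize U 𝒟)
    where
    from : Realization u b A 𝒟 → U[ b / B ]≥ u
    from (σ , fσ , b≡σb , rank) = U-≈
      (≈-sym (LascarNS-same {𝒟 = 𝒟} A∈ ns
        (maximal-rank⇒LascarNS {𝒟 = 𝒟} A∈ (λ U′ → ¬U (U-fixed σ fσ U′)) rank) b≡σb B∈))
      (mkU 𝒟 B∈ rank)

  -- Both tuples are replaced by realizations of their Lascar types over C that have rank u over a
  -- model around C. There `LascarNS-same` identifies the types, and these determine the Lascar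
  -- types over C.
  U-stationary : ∀ {n k l u} {a b : Vec M n} {A : Vec M k} {C : Vec M l} → ⟪ A ⟫ ⊆ ⟪ C ⟫ →
    a ≡ᴸ b over ⟪ A ⟫ → ¬ (U[ a / A ]≥ suc u) → U[ a / C ]≥ u → U[ b / C ]≥ u → a ≡ᴸ b over ⟪ C ⟫
  U-stationary {u = u} {a} {b} {A} {C} A⊆C a≡b ¬U Ua Ub =
    let (𝒟 , _ , C∈) = tuple-model C in from {𝒟} C∈ (U-realize Ua 𝒟) (U-realize Ub 𝒟)
    where
    from : ∀ {𝒟} → C ∈ᵗ ⌊ 𝒟 ⌋ → Realization u a C 𝒟 → Realization u b C 𝒟 → a ≡ᴸ b over ⟪ C ⟫
    from {𝒟} C∈ (σ , fσ , a≡σa , rank-a) (τ , fτ , b≡τb , rank-b) =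
      ≡ᴸ-trans a≡σa (≡ᴸ-trans (same⇒≡ᴸ⟪⟫ {𝒟} C∈ (LascarNS-same {𝒟 = 𝒟} A∈
        (maximal-rank⇒LascarNS {𝒟 = 𝒟} A∈ (λ U → ¬U (U-fixed σ (λ x∈ → fσ (A⊆C x∈)) U)) rank-a)
        (maximal-rank⇒LascarNS {𝒟 = 𝒟} A∈ (λ U → ¬U (U-≈ (≈-sym (≡ᴸ⇒≈ a≡b)) (U-fixed τ (λ x∈ → fτ (A⊆C x∈)) U))) rank-b)
        (≡ᴸ-trans (≡ᴸ-sym (≡ᴸ-mono A⊆C a≡σa)) (≡ᴸ-trans a≡b (≡ᴸ-mono A⊆C b≡τb)))))
        (≡ᴸ-sym b≡τb))
      where
      A∈ : A ∈ᵗ ⌊ 𝒟 ⌋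
      A∈ = ⊆⇒∈ᵗ λ x∈ → ∈ᵗ⇒⊆ C∈ (A⊆C x∈)

  -- Additivity of the rank over finite sets

  ∈-initial : ∀ (s : ℕ → M) {i n} → i ≤ n → s i ∈ ⟪ initial s n ⟫
  ∈-initial s {i} {n} i≤n = subst (λ j → s j ∈ ⟪ initial s n ⟫) (toℕ-fromℕ< (s≤s i≤n))
    (∈-tabulate⁺ (λ j → s (toℕ j)) (fromℕ< (s≤s i≤n)))

  initial-mono : ∀ (s : ℕ → M) {m n} → m ≤ n → ⟪ initial s m ⟫ ⊆ ⟪ initial s n ⟫
  initial-mono s {m} {n} m≤n = ∈ᵗ⇒⊆ {X = ⟪ initial s n ⟫} {v = initial s m}
    (tabulate⁺ {f = λ j → s (toℕ j)} λ i → ∈-initial s (≤-trans (≤-pred (toℕ<n i)) m≤n))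

  module _ {ℬ 𝒩 : Model} {k} {b : Vec M k} {s : ℕ → M} (primary : IsPrimary ℬ 𝒩 b s) where

    finite-support : ∀ {n} {x : Vec M n} → x ∈ᵗ ⌊ ℬ ⌋ →
      ∃ λ m → ∃ λ l → Σ[ P ∈ Vec M l ] P ∈ᵗ ⌊ 𝒩 ⌋ × ⟪ x ⟫ ⊆ ⟪ P ⟫ ∪ ⟪ b ++ initial s m ⟫
    finite-support []                   = 0 , 0 , [] , [] , λ ()
    finite-support {x = x ∷ xs} (x∈ ∷ xs∈) with finite-support xs∈ | proj₁ (proj₁ primary) x∈
    ... | m , l , P , P∈ , xs⊆ | inj₁ x∈𝒩 = m , _ , x ∷ P , x∈𝒩 ∷ P∈ , λ
      { (here refl) → inj₁ (here refl)
      ; (there y∈) → [ (λ z → inj₁ (there z)) , inj₂ ] (xs⊆ y∈) }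
    ... | m , l , P , P∈ , xs⊆ | inj₂ (inj₁ x∈b) = m , _ , P , P∈ , λ
      { (here refl) → inj₂ (++-⊆ˡ x∈b)
      ; (there y∈) → xs⊆ y∈ }
    ... | m , l , P , P∈ , xs⊆ | inj₂ (inj₂ (i , refl)) = m ⊔ i , _ , P , P∈ , λ
      { (here refl) → inj₂ (++-⊆ʳ b (∈-initial s (m≤n⊔m m i)))
      ; (there y∈) → [ inj₁ , (λ z → inj₂ (++-mono b {initial s m} {initial s (m ⊔ i)}
                                               (initial-mono s (m≤m⊔n m i)) z)) ] (xs⊆ y∈) }

    -- A copy of d in 𝒩 over b fixes the type of an initial segment over 𝒩, since
    -- that type is isolated by a finite part.

    initial-⫝ : ∀ {m} {d : Vec M m} → b ⫝[ 𝒩 ] d → ∀ n → b ++ initial s n ⫝[ 𝒩 ] d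
    initial-⫝ {d = d} b⫝d n = from (proj₂ primary n)
      where
      y : Vec M _
      y = b ++ initial s n
      from : (∃ λ m → Σ[ A ∈ Vec M m ] A ∈ᵗ ⌊ 𝒩 ⌋
               × (∀ (b′ : Vec M k) (s′ : Vec M (suc n)) → b′ ≡ᵗ b over ⌊ 𝒩 ⌋ →
                    b′ ++ s′ ≡ᵗ y over ⟪ A ⟫ → b′ ++ s′ ≡ᵗ y over ⌊ 𝒩 ⌋)) → y ⫝[ 𝒩 ] d
      from (_ , A , A∈ , isolated) = mk⫝ (A ++ base b⫝d) (++⁺ A∈ (base∈ b⫝d)) λ B∈ base⊆B d₀∈ d≈d₀ →
        copy B∈ (λ x∈ → base⊆B (++-⊆ˡ x∈)) d₀∈ (copies b⫝d B∈ (λ x∈ → base⊆B (++-⊆ʳ A x∈)) d₀∈ d≈d₀)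
        where
        copy : ∀ {l} {B : Vec M l} → B ∈ᵗ ⌊ 𝒩 ⌋ → ⟪ A ⟫ ⊆ ⟪ B ⟫ → ∀ {d₀} → d₀ ∈ᵗ ⌊ 𝒩 ⌋ →
               d ≈[ b ++ B ] d₀ → d ≈[ y ++ B ] d₀
        copy {B = B} B∈ A⊆B {d₀} d₀∈ (ρ , fρ , ρd≡d₀) = back (≡ᵗ⇒≈ type (++⁺ B∈ d₀∈))
          where
          ρA : Fixes ρ ⟪ A ⟫
          ρA x∈ = fρ (++-⊆ʳ b (A⊆B x∈))
          ρy≡ : ρ ⊙ y ≡ b ++ ρ ⊙ initial s n
          ρy≡ = ⊙-++ ρ b (Fixes-⊙ ρ fρ (⊆⇒∈ᵗ ++-⊆ˡ)) refl
          type : b ++ ρ ⊙ initial s n ≡ᵗ y over ⌊ 𝒩 ⌋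
          type = isolated b (ρ ⊙ initial s n) (≈⇒≡ᵗ {a = b} {b} λ _ _ → ≈-refl)
            (≈⇒≡ᵗ⟪⟫ (≈-sym (subst (y ≈[ A ]_) ρy≡ (≈-⊙ ρ ρA y))))
          back : b ++ ρ ⊙ initial s n ≈[ B ++ d₀ ] y → d ≈[ y ++ B ] d₀
          back (τ , fτ , τρy≡y) = τ ∘ᴬ ρ
            , ++-⊆ {X = λ x → τ · ρ · x ≡ x} {a = y}
                (⊙-Fixes (τ ∘ᴬ ρ) (trans (∘ᴬ-⊙ τ ρ y) (trans (cong (τ ⊙_) ρy≡) τρy≡y)))
                (Fixes-∘ τ ρ (λ x∈ → fτ (++-⊆ˡ x∈)) (λ x∈ → fρ (++-⊆ʳ b x∈)))
            , trans (∘ᴬ-⊙ τ ρ d) (trans (cong (τ ⊙_) ρd≡d₀) (Fixes-⊙ τ fτ (⊆⇒∈ᵗ (++-⊆ʳ B))))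

    primary-⫝ : ∀ {m} {d : Vec M m} → b ⫝[ 𝒩 ] d → ∀ {n} {x : Vec M n} → x ∈ᵗ ⌊ ℬ ⌋ → x ⫝[ 𝒩 ] d
    primary-⫝ b⫝d x∈ = let (m , _ , P , P∈ , x⊆) = finite-support x∈ in
      ⫝-sym (⫝-monoʳ P∈ x⊆ (⫝-sym (initial-⫝ b⫝d m)))

  -- The chain of b is climbed before that of a. At each step a is moved over 𝒫, hence over 𝒩 b, so
  -- that its rank q holds above the next member of the chain of b too.
  rank-++-≥ : ∀ p q {m n} {a : Vec M m} {b : Vec M n} {𝒩 𝒫} → ⌊ 𝒩 ⌋ ⊆ ⌊ 𝒫 ⌋ → b ∈ᵗ ⌊ 𝒫 ⌋ →
              RankAtLeast p b 𝒩 → RankAtLeast q a 𝒫 → RankAtLeast (p + q) (a ++ b) 𝒩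
  rank-++-≥ zero q {𝒩 = 𝒩} {𝒫} 𝒩⊆ b∈ _ rank-a =
    rank-mono q {ℬ = 𝒫} 𝒩⊆ (rank-⊆ q {𝒜 = 𝒫} ++-⊆ˡ rank-a)
  rank-++-≥ (suc p) q {a = a} {b} {𝒩} {𝒫} 𝒩⊆ b∈ (𝒩₁ , 𝒩⊆𝒩₁ , dep , rank-b) rank-a =
    let (𝒫₁ , 𝒫⊆ , 𝒩₁⊆) = join 𝒫 𝒩₁ in
    from {𝒫₁} 𝒫⊆ 𝒩₁⊆ (free-realization q {a = a} {𝒫} {𝒫₁} 𝒫⊆ rank-a)
    where
    from : ∀ {𝒫₁} → ⌊ 𝒫 ⌋ ⊆ ⌊ 𝒫₁ ⌋ → ⌊ 𝒩₁ ⌋ ⊆ ⌊ 𝒫₁ ⌋ → FreeRealization q a 𝒫 𝒫₁ →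
           RankAtLeast (suc p + q) (a ++ b) 𝒩
    from {𝒫₁} 𝒫⊆ 𝒩₁⊆ (σ , fσ , _ , rank) = rank-fixed⁻ (suc p + q) σ {a = a ++ b} {𝒩} (λ x∈ → fσ (𝒩⊆ x∈))
      (subst (λ v → RankAtLeast (suc p + q) v 𝒩) (sym (⊙-++ σ a refl (Fixes-⊙ σ fσ b∈)))
        (𝒩₁ , 𝒩⊆𝒩₁
        , (λ ind → dep (⫝⇒↓ⁿˢ {𝒩} {a = b} 𝒩⊆𝒩₁ λ c∈ →
             ⫝-monoˡ (++-⊆ʳ (σ ⊙ a)) (↓ⁿˢ⇒⫝ {𝒩} {a = σ ⊙ a ++ b} ind (All.map inj₂ c∈))))
        , rank-++-≥ p q {a = σ ⊙ a} {b} {𝒩₁} {𝒫₁} 𝒩₁⊆ (All.map 𝒫⊆ b∈) rank-b rank))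

  U-++-≥ : ∀ {m n k p q} {a : Vec M m} {b : Vec M n} {A : Vec M k} →
           U[ b / A ]≥ p → U[ a / b ++ A ]≥ q → U[ a ++ b / A ]≥ (p + q)
  U-++-≥ {p = p} {q} {a} {b} {A} (mkU 𝒩 A∈ rank-b) (mkU 𝒫₀ bA∈ rank-a) =
    let (𝒫 , 𝒫₀⊆ , 𝒩⊆) = join 𝒫₀ 𝒩 in from {𝒫} 𝒫₀⊆ 𝒩⊆ (free-realization q {a = a} {𝒫₀} {𝒫} 𝒫₀⊆ rank-a)
    where
    from : ∀ {𝒫} → ⌊ 𝒫₀ ⌋ ⊆ ⌊ 𝒫 ⌋ → ⌊ 𝒩 ⌋ ⊆ ⌊ 𝒫 ⌋ → FreeRealization q a 𝒫₀ 𝒫 → U[ a ++ b / A ]≥ (p + q)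
    from {𝒫} 𝒫₀⊆ 𝒩⊆ (σ , fσ , _ , rank) = U-fixed σ (λ x∈ → fσ (∈ᵗ⇒⊆ (++ʳ⁻ b bA∈) x∈))
      (subst (λ v → U[ v / A ]≥ (p + q)) (sym (⊙-++ σ a refl (Fixes-⊙ σ fσ (++ˡ⁻ b bA∈))))
        (mkU 𝒩 A∈ (rank-++-≥ p q {a = σ ⊙ a} {b} {𝒩} {𝒫} 𝒩⊆ (All.map 𝒫₀⊆ (++ˡ⁻ b bA∈)) rank-b rank)))

  RankOver : ∀ {m n} → ℕ → Vec M m → Vec M n → Model → Set (lsuc ℓ)
  RankOver q a b 𝒩 = Σ[ 𝒫 ∈ Model ] ⌊ 𝒩 ⌋ ⊆ ⌊ 𝒫 ⌋ × b ∈ᵗ ⌊ 𝒫 ⌋ × RankAtLeast q a 𝒫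

  RankSplit : ∀ {m n} → ℕ → Vec M m → Vec M n → Model → Set (lsuc ℓ)
  RankSplit r a b 𝒩 = ∃ λ p → ∃ λ q → p + q ≡ r × RankAtLeast p b 𝒩 × RankOver q a b 𝒩

  -- If a b depends on 𝒩₁ over 𝒩 but b does not, then a depends on 𝒩₁ over the
  -- primary model over 𝒩 b, since that model is independent from 𝒩₁.

  module _ {m n q} {a : Vec M m} {b : Vec M n} {𝒩 𝒩₁ 𝒫 𝒫₁} (𝒩⊆𝒩₁ : ⌊ 𝒩 ⌋ ⊆ ⌊ 𝒩₁ ⌋)
           (𝒩⊆𝒫 : ⌊ 𝒩 ⌋ ⊆ ⌊ 𝒫 ⌋) (b∈𝒫 : b ∈ᵗ ⌊ 𝒫 ⌋) (𝒩₁⊆𝒫₁ : ⌊ 𝒩₁ ⌋ ⊆ ⌊ 𝒫₁ ⌋) (b∈𝒫₁ : b ∈ᵗ ⌊ 𝒫₁ ⌋)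
           (𝒫⫝𝒩₁ : ∀ {l k} {x : Vec M l} {d : Vec M k} → x ∈ᵗ ⌊ 𝒫 ⌋ → d ∈ᵗ ⌊ 𝒩₁ ⌋ → x ⫝[ 𝒩 ] d)
           (dep : ¬ (a ++ b ↓ⁿˢ[ ⌊ 𝒩 ⌋ ] ⌊ 𝒩₁ ⌋)) (rank-a : RankAtLeast q a 𝒫₁) where

    rank-over-primary : RankOver (suc q) a b 𝒩
    rank-over-primary = let (𝒟 , 𝒫₁⊆ , 𝒫⊆) = join 𝒫₁ 𝒫 in
      from {𝒟} 𝒫₁⊆ 𝒫⊆ (free-realization q {a = a} {𝒫₁} {𝒟} 𝒫₁⊆ rank-a)
      where
      from : ∀ {𝒟} → ⌊ 𝒫₁ ⌋ ⊆ ⌊ 𝒟 ⌋ → ⌊ 𝒫 ⌋ ⊆ ⌊ 𝒟 ⌋ → FreeRealization q a 𝒫₁ 𝒟 → RankOver (suc q) a b 𝒩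
      -- The rank of a is known over 𝒫₁, which need not contain 𝒫. It is carried to τ a over a
      -- common extension 𝒟, so τ a has rank `suc q` over 𝒫, and τ⁻¹ brings 𝒫 back to a.
      from {𝒟} 𝒫₁⊆ 𝒫⊆ (τ , fτ , _ , rank) = τ ⁻¹ ⋆ 𝒫
        , (λ x∈ → subst (_∈ ⌊ τ ⁻¹ ⋆ 𝒫 ⌋) (fτ⁻¹ (𝒩₁⊆𝒫₁ (𝒩⊆𝒩₁ x∈))) (∈-⋆ (τ ⁻¹) 𝒫 (𝒩⊆𝒫 x∈)))
        , subst (_∈ᵗ ⌊ τ ⁻¹ ⋆ 𝒫 ⌋) (Fixes-⊙ (τ ⁻¹) fτ⁻¹ b∈𝒫₁) (∈ᵗ-⋆ (τ ⁻¹) 𝒫 b∈𝒫)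
        , subst (λ v → RankAtLeast (suc q) v (τ ⁻¹ ⋆ 𝒫)) (⁻¹-⊙ τ a)
            (rank-⋆ (suc q) (τ ⁻¹) {a = τ ⊙ a} {𝒫} (𝒟 , 𝒫⊆ , dep′ , rank))
        where
        fτ⁻¹ : Fixes (τ ⁻¹) ⌊ 𝒫₁ ⌋
        fτ⁻¹ = Fixes-⁻¹ τ fτ
        dep′ : ¬ (τ ⊙ a ↓ⁿˢ[ ⌊ 𝒫 ⌋ ] ⌊ 𝒟 ⌋)
        dep′ ind = dep (↓ⁿˢ-fixed⁻ τ (a ++ b) {𝒩} 𝒩₁ {𝒩₁} (λ x∈ → fτ (𝒩₁⊆𝒫₁ (𝒩⊆𝒩₁ x∈)))
          (proj₂ (Fixes-⋆ τ {𝒩₁} (λ x∈ → fτ (𝒩₁⊆𝒫₁ x∈))))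
          (subst (_↓ⁿˢ[ ⌊ 𝒩 ⌋ ] ⌊ 𝒩₁ ⌋) (sym (⊙-++ τ a refl (Fixes-⊙ τ fτ b∈𝒫₁)))
            (⫝⇒↓ⁿˢ {𝒩} {a = τ ⊙ a ++ b} 𝒩⊆𝒩₁ λ d∈ → ⫝-sym (⫝-trans {𝒩} {𝒫} 𝒩⊆𝒫 (λ x∈ → ⫝-sym (𝒫⫝𝒩₁ x∈ d∈))
              (⫝-monoʳ b∈𝒫 (++-⊆ {X = ⟪ b ⟫ ∪ ⟪ τ ⊙ a ⟫} {a = τ ⊙ a} inj₂ inj₁)
                (⫝-sym (↓ⁿˢ⇒⫝ {𝒫} {a = τ ⊙ a} ind (All.map (λ x∈ → inj₂ (𝒫₁⊆ (𝒩₁⊆𝒫₁ x∈))) d∈))))))))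

  -- Each step of the chain for a b is charged to b if b depends on 𝒩₁ over 𝒩, and to a otherwise.
  -- In the second case AII supplies the model over which a depends.
  rank-++-≤ : ∀ r {m n} {a : Vec M m} {b : Vec M n} {𝒩} → Countable 𝒩 →
              CountableRankAtLeast r (a ++ b) 𝒩 → RankSplit r a b 𝒩
  rank-++-≤ zero {b = b} {𝒩} _ _ = let (𝒫 , 𝒩⊆ , b∈) = extend 𝒩 b in 0 , 0 , refl , tt , 𝒫 , 𝒩⊆ , b∈ , tt
  rank-++-≤ (suc r) {a = a} {b} {𝒩} c (𝒩₁ , c₁ , 𝒩⊆𝒩₁ , dep , rank) = from em (rank-++-≤ r {a = a} {b} {𝒩₁} c₁ rank)
    where
    from : Dec (b ↓ⁿˢ[ ⌊ 𝒩 ⌋ ] ⌊ 𝒩₁ ⌋) → RankSplit r a b 𝒩₁ → RankSplit (suc r) a b 𝒩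
    from (no b-dep) (p , q , refl , rank-b , 𝒫₁ , 𝒩₁⊆ , b∈ , rank-a) =
      suc p , q , refl , (𝒩₁ , 𝒩⊆𝒩₁ , b-dep , rank-b) , 𝒫₁ , (λ x∈ → 𝒩₁⊆ (𝒩⊆𝒩₁ x∈)) , b∈ , rank-a
    from (yes b↓𝒩₁) (p , q , refl , rank-b , 𝒫₁ , 𝒩₁⊆ , b∈ , rank-a) =
      p , suc q , +-suc p q , rank-mono p {ℬ = 𝒩₁} 𝒩⊆𝒩₁ rank-b , primary-case (AII b 𝒩 c)
      where
      primary-case : (Σ[ 𝒫 ∈ Model ] Σ[ s ∈ (ℕ → M) ] IsPrimary 𝒫 𝒩 b s) → RankOver (suc q) a b 𝒩
      primary-case (𝒫 , s , primary) = rank-over-primary {a = a} {b} {𝒩} {𝒩₁} {𝒫} {𝒫₁} 𝒩⊆𝒩₁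
        (λ x∈ → proj₂ (proj₁ primary) (inj₁ x∈)) (⊆⇒∈ᵗ λ x∈ → proj₂ (proj₁ primary) (inj₂ (inj₁ x∈))) 𝒩₁⊆ b∈
        (λ x∈ d∈ → primary-⫝ {𝒫} {𝒩} primary (↓ⁿˢ⇒⫝ {𝒩} b↓𝒩₁ (All.map inj₂ d∈)) x∈) dep rank-a

  U-++-≤ : ∀ {m n k r} {a : Vec M m} {b : Vec M n} {A : Vec M k} → U[ a ++ b / A ]≥ r →
           ∃ λ p → ∃ λ q → p + q ≡ r × U[ b / A ]≥ p × U[ a / b ++ A ]≥ q
  U-++-≤ {r = r} {a} {b} (mkU 𝒩 A∈ rank) =
    let (𝒞 , c , A∈𝒞 , 𝒞⊆𝒩) = countable-submodel 𝒩 A∈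
        (p , q , eq , rank-b , 𝒫 , 𝒞⊆𝒫 , b∈ , rank-a) =
          rank-++-≤ r {a = a} {b} {𝒞} c (Rank⇒CountableRank r {a = a ++ b} {𝒩} rank {𝒞} c 𝒞⊆𝒩)
    in p , q , eq , mkU 𝒞 A∈𝒞 rank-b , mkU 𝒫 (++⁺ b∈ (All.map 𝒞⊆𝒫 A∈𝒞)) rank-a

  open NonStrict _≤_ using (_≤⁺_) renaming ([_] to fin≤)

  -- U-rank over arbitrary sets

  U-compare : ∀ {n k u v} {a : Vec M n} {A : Vec M k} → U[ a / A ]≥ u → ¬ (U[ a / A ]≥ suc v) → u ≤ v
  U-compare {u = u} {v} U ¬U with u ≤? v
  ... | yes u≤v = u≤v
  ... | no u≰v  = contradiction (U-≤ (≰⇒> u≰v) U) ¬U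

  -- StableRank a X X u means U(a/X) = u, and StableRank a X (X ∪ Y) u will turn out
  -- to be a ↓[ X ] Y.

  record StableRank {n} (a : Vec M n) (X Y : Subset) (u : ℕ) : Set (lsuc ℓ) where
    constructor mkStable
    field
      {size} : ℕ
      base   : Vec M size
      base∈  : base ∈ᵗ X
      upper  : ¬ (U[ a / base ]≥ suc u)
      lower  : ∀ {k} {B : Vec M k} → B ∈ᵗ Y → U[ a / B ]≥ u

  open StableRank

  -- Descends from n while P persists. Failure at the predecessor alone suffices, because `Attained`
  -- in `stable-rank` is upward closed.
  least : ∀ {p} (P : ℕ → Set p) n → P n → ∃ λ m → P m × (∀ {k} → m ≡ suc k → ¬ P k)
  least P zero    p = 0 , p , λ ()
  least P (suc n) p with em {P = P n}
  ... | yes q = least P n q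
  ... | no ¬q = suc n , p , λ { refl → ¬q }

  -- `Attained u` says that some finite part of X gives a rank at most u; the search for the minimum
  -- starts at a bound valid for the empty tuple.
  stable-rank : ∀ {n} (a : Vec M n) X → ∃ (StableRank a X X)
  stable-rank a X = from (U-bounded a)
    where
    Attained : ℕ → Set (lsuc ℓ)
    Attained u = ∃ λ k → Σ[ A ∈ Vec M k ] A ∈ᵗ X × ¬ (U[ a / A ]≥ suc u)
    lower-bound : ∀ u → (∀ {k} → u ≡ suc k → ¬ Attained k) → ∀ {k} {B : Vec M k} → B ∈ᵗ X → U[ a / B ]≥ u
    lower-bound zero    _    B∈ = U≥0 a _
    lower-bound (suc u) none B∈ = decidable-stable em λ ¬U → none refl (-, _ , B∈ , ¬U)
    from : (∃ λ m → ∀ {k} {A : Vec M k} → ¬ (U[ a / A ]≥ m)) → ∃ (StableRank a X X)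
    from (m , ¬U) with least Attained m (-, [] , [] , λ U → ¬U (U-≤ (n≤1+n m) U))
    ... | u , (_ , A , A∈ , ¬U′) , none = u , mkStable A A∈ ¬U′ (lower-bound u none)

  RankModel-exact : ∀ {n} (a : Vec M n) 𝒜 → ∃ λ m → RankModel a 𝒜 (fin m)
  RankModel-exact a 𝒜 = let (N , ¬rank) = rank-bounded a
                            (m , rank , ¬rank′) = greatest (λ m → RankAtLeast m a 𝒜) tt N (¬rank 𝒜)
    in m , rank , λ m′ rank″ → below rank″ ¬rank′
    where
    below : ∀ {m m′} → RankAtLeast m′ a 𝒜 → ¬ RankAtLeast (suc m) a 𝒜 → m′ ≤ m
    below {m} {m′} rank ¬rank with m′ ≤? m
    ... | yes m′≤m = m′≤m
    ... | no m′≰m  = contradiction (rank-≤ (≤⇒≤′ (≰⇒> m′≰m)) {a = a} {𝒜} rank) ¬rank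

  module _ {n k} {a : Vec M n} {A : Vec M k} where

    U⇒RankFinite : ∀ {u} → U[ a / A ]≥ u → ¬ (U[ a / A ]≥ suc u) → RankFinite a A (fin u)
    U⇒RankFinite {u} (mkU 𝒩 A∈ rank) ¬U =
      (𝒩 , A∈ , rank , λ m rank′ → U-compare {v = u} (mkU 𝒩 A∈ rank′) ¬U) , bound
      where
      bound : ∀ 𝒜 v → A ∈ᵗ ⌊ 𝒜 ⌋ → RankModel a 𝒜 v → v ≤⁺ fin u
      bound 𝒜 (fin m) A∈ (rank , _) = fin≤ (U-compare (mkU 𝒜 A∈ rank) ¬U)
      bound 𝒜 ⊤⁺      A∈ rank       = contradiction (mkU 𝒜 A∈ (rank (suc u))) ¬U

    RankFinite⇒U : ∀ {v} → RankFinite a A v → ∃ λ u → v ≡ fin u × U[ a / A ]≥ u × ¬ (U[ a / A ]≥ suc u)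
    RankFinite⇒U {⊤⁺} ((𝒩 , A∈ , rank) , _) =
      let (m , ¬rank) = rank-bounded a in contradiction (rank m) (¬rank 𝒩)
    RankFinite⇒U {fin u} ((𝒩 , A∈ , rank , _) , bound) = u , refl , mkU 𝒩 A∈ rank , λ (mkU 𝒩′ A∈′ rank′) →
      exceeds {𝒩′} (bound 𝒩′) A∈′ rank′ (RankModel-exact a 𝒩′)
      where
      exceeds : ∀ {𝒩′} → (∀ v → A ∈ᵗ ⌊ 𝒩′ ⌋ → RankModel a 𝒩′ v → v ≤⁺ fin u) → A ∈ᵗ ⌊ 𝒩′ ⌋ →
                RankAtLeast (suc u) a 𝒩′ → ¬ (∃ λ m → RankModel a 𝒩′ (fin m))
      exceeds bound A∈′ rank′ (m , exact) with bound (fin m) A∈′ exact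
      ... | fin≤ m≤u = <⇒≱ (proj₂ exact (suc u) rank′) m≤u

  module _ {n} {a : Vec M n} {X : Subset} where

    stable⇒Rank : ∀ {u} → StableRank a X X u → Rank a X (fin u)
    stable⇒Rank {u} s =
      (-, base s , base∈ s , U⇒RankFinite (lower s (base∈ s)) (upper s)) , λ B v B∈ rank → bound B∈ (RankFinite⇒U rank)
      where
      bound : ∀ {k v} {B : Vec M k} → B ∈ᵗ X →
              (∃ λ w → v ≡ fin w × U[ a / B ]≥ w × ¬ (U[ a / B ]≥ suc w)) → fin u ≤⁺ v
      bound B∈ (w , refl , _ , ¬U) = fin≤ (U-compare (lower s B∈) ¬U)

    Rank⇒stable : ∀ {v} → Rank a X v → ∃ λ u → v ≡ fin u × StableRank a X X u
    Rank⇒stable ((_ , A , A∈ , rank) , bound) with RankFinite⇒U rank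
    ... | u , refl , U , ¬U = u , refl , mkStable A A∈ ¬U below
      where
      below : ∀ {k} {B : Vec M k} → B ∈ᵗ X → U[ a / B ]≥ u
      below {B = B} B∈ with U-exact a B
      ... | w , U′ , ¬U′ with bound B (fin w) B∈ (U⇒RankFinite U′ ¬U′)
      ... | fin≤ u≤w = U-≤ u≤w U′

  -- Independence as constancy of the rank

  StableRealization : ∀ {n} {a : Vec M n} {X Y u} → StableRank a X Y u → Model → Set (lsuc ℓ)
  StableRealization {a = a} {Y = Y} {u} s 𝒟 = Σ[ σ ∈ Aut ] Fixes σ ⟪ base s ⟫ × RankAtLeast u (σ ⊙ a) 𝒟
    × (∀ {k} {B : Vec M k} → B ∈ᵗ Y → a ≡ᴸ σ ⊙ a over ⟪ base s ++ B ⟫)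

  abstract
    -- One σ a serves all finite B at once. It is chosen over the base alone, and as both a and σ a
    -- keep the rank u over the base and B, `U-stationary` gives them the same Lascar type there.
    stable-realize : ∀ {n} {a : Vec M n} {X Y u} → X ⊆ Y → (s : StableRank a X Y u) →
                     ∀ 𝒟 → Y ⊆ ⌊ 𝒟 ⌋ → StableRealization s 𝒟
    stable-realize {a = a} {Y = Y} {u} X⊆Y s 𝒟 Y⊆𝒟 = from (U-realize (lower s base∈Y) 𝒟)
      where
      base∈Y : base s ∈ᵗ Y
      base∈Y = All.map X⊆Y (base∈ s)
      from : Realization u a (base s) 𝒟 → StableRealization s 𝒟
      from (σ , fσ , a≡σa , rank) = σ , fσ , rank , λ B∈ →
        U-stationary ++-⊆ˡ a≡σa (upper s) (lower s (++⁺ base∈Y B∈))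
          (mkU 𝒟 (All.map Y⊆𝒟 (++⁺ base∈Y B∈)) rank)

  module _ {n} {a : Vec M n} {X Y : Subset} where

    stable⇒↓ : ∀ {u} → StableRank a X (X ∪ Y) u → a ↓[ X ] Y
    stable⇒↓ {u} s = -, base s , base∈ s , λ D D-bounded XY⊆D →
      let (𝒟 , D⊆𝒟) = Bounded⇒⊆model D-bounded in
      from {D} {𝒟} D⊆𝒟 (λ x∈ → D⊆𝒟 (XY⊆D x∈)) (stable-realize inj₁ s 𝒟 λ x∈ → D⊆𝒟 (XY⊆D x∈))
      where
      from : ∀ {D 𝒟} → D ⊆ ⌊ 𝒟 ⌋ → X ∪ Y ⊆ ⌊ 𝒟 ⌋ → StableRealization s 𝒟 →
             Σ[ b ∈ Vec M n ] b ≡ᵗ a over (X ∪ Y) × ¬ LascarSplits b D (base s)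
      from {𝒟 = 𝒟} D⊆𝒟 XY⊆𝒟 (σ , fσ , rank , same) = σ ⊙ a
        , ≈⇒≡ᵗ (λ B B∈ → ≈-mono (++-⊆ʳ (base s)) (≈-sym (≡ᴸ⇒≈ (same B∈))))
        , LascarNS⇒¬LascarSplits {𝒟 = 𝒟} D⊆𝒟 (maximal-rank⇒LascarNS {𝒟 = 𝒟}
            (All.map (λ x∈ → XY⊆𝒟 (inj₁ x∈)) (base∈ s)) (λ U → upper s (U-fixed σ fσ U)) rank)

    -- With D a model, b keeps its rank over A on all finite subsets of D by
    -- `LascarNS⇒maximal-rank`, and finite subsets of X ∪ Y do not distinguish b from a.
    ↓⇒stable : ∀ {𝒩} → X ∪ Y ⊆ ⌊ 𝒩 ⌋ → a ↓[ X ] Y → ∃ (StableRank a X (X ∪ Y))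
    ↓⇒stable {𝒩} XY⊆𝒩 (_ , A , A∈ , free) =
      from (free ⌊ 𝒩 ⌋ (⊆model⇒Bounded 𝒩 id) XY⊆𝒩) (U-exact a A)
      where
      from : (Σ[ b ∈ Vec M n ] b ≡ᵗ a over (X ∪ Y) × ¬ LascarSplits b ⌊ 𝒩 ⌋ A) →
             (∃ λ u → U[ a / A ]≥ u × ¬ (U[ a / A ]≥ suc u)) → ∃ (StableRank a X (X ∪ Y))
      from (b , b≡a , ¬splits) (u , U , ¬U) = u , mkStable A A∈ ¬U λ B∈ → U-≈ (≡ᵗ⇒≈ b≡a B∈)
        (LascarNS⇒maximal-rank {𝒟 = 𝒩} (All.map (λ x∈ → XY⊆𝒩 (inj₁ x∈)) A∈) (¬LascarSplits⇒LascarNS {𝒟 = 𝒩} ¬splits)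
          (U-≈ (≈-sym b≈a) U) (λ U′ → ¬U (U-≈ b≈a U′)) (All.map XY⊆𝒩 B∈))
        where
        b≈a : b ≈[ A ] a
        b≈a = ≡ᵗ⇒≈ b≡a (All.map inj₁ A∈)

  StableRank-mono : ∀ {n u} {a : Vec M n} {X X′ Y Y′} → X ⊆ X′ → Y′ ⊆ Y → StableRank a X Y u → StableRank a X′ Y′ u
  StableRank-mono X⊆X′ Y′⊆Y s = mkStable (base s) (All.map X⊆X′ (base∈ s)) (upper s) λ B∈ → lower s (All.map Y′⊆Y B∈)

  stable-unique : ∀ {n u v} {a : Vec M n} {X} → StableRank a X X u → StableRank a X X v → u ≤ v
  stable-unique s t = U-compare (lower s (base∈ t)) (upper t)

  split-tuple : ∀ {X Z : Subset} {n} {v : Vec M n} → v ∈ᵗ X ∪ Z → ∃ λ k → Σ[ P ∈ Vec M k ] P ∈ᵗ X × ⟪ v ⟫ ⊆ ⟪ P ⟫ ∪ Z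
  split-tuple []                           = 0 , [] , [] , λ ()
  split-tuple {v = x ∷ _} (inj₁ x∈ ∷ v∈) = let (_ , P , P∈ , v⊆) = split-tuple v∈ in
    -, x ∷ P , x∈ ∷ P∈ , λ { (here refl) → inj₁ (here refl) ; (there y∈) → [ (λ z → inj₁ (there z)) , inj₂ ] (v⊆ y∈) }
  split-tuple (inj₂ x∈ ∷ v∈) = let (_ , P , P∈ , v⊆) = split-tuple v∈ in
    -, P , P∈ , λ { (here refl) → inj₂ x∈ ; (there y∈) → v⊆ y∈ }

  -- Over A the pair has rank at least v + u, since a keeps u over b A. Additivity in the other
  -- order gives v + u = p + q with p at most u for a, which leaves q at least v for b over a A.
  stable-sym : ∀ {n m u v} {a : Vec M n} {b : Vec M m} {X} → StableRank a X (X ∪ ⟪ b ⟫) u → StableRank b X X v →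
               StableRank b X (X ∪ ⟪ a ⟫) v
  stable-sym {u = u} {v} {a} {b} {X} s t = mkStable (base t) (base∈ t) (upper t) λ E∈ → below (split-tuple E∈)
    where
    below : ∀ {k} {E : Vec M k} → (∃ λ l → Σ[ P ∈ Vec M l ] P ∈ᵗ X × ⟪ E ⟫ ⊆ ⟪ P ⟫ ∪ ⟪ a ⟫) → U[ b / E ]≥ v
    below {E = E} (_ , P , P∈ , E⊆) = conclude (U-++-≤ {r = v + u} {a = b} {b = a} {A = A}
      (U-⊆ (++-⊆ {X = ⟪ b ++ a ⟫} {a = a} (++-⊆ʳ b) ++-⊆ˡ)
        (U-++-≥ (lower t A∈) (lower s (++⁺ (⊆⇒∈ᵗ inj₂) (All.map inj₁ A∈))))))
      where
      A : Vec M _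
      A = base s ++ P
      A∈ : A ∈ᵗ X
      A∈ = ++⁺ (base∈ s) P∈
      conclude : (∃ λ p → ∃ λ q → p + q ≡ v + u × U[ a / A ]≥ p × U[ b / a ++ A ]≥ q) → U[ b / E ]≥ v
      conclude (p , q , eq , Ua , Ub) = U-mono
        (λ x∈ → [ (λ z → ++-⊆ʳ a (++-⊆ʳ (base s) z)) , ++-⊆ˡ ]′ (E⊆ x∈)) (U-≤ v≤q Ub)
        where
        v≤q : v ≤ q
        v≤q = +-cancelʳ-≤ u v q (≤-trans (≤-reflexive (sym eq)) (≤-trans
          (+-monoˡ-≤ q (U-compare Ua (λ U → upper s (U-mono (++-⊆ˡ {a = base s}) U)))) (≤-reflexive (+-comm u q))))

  -- The base of s may contain entries of b. Only its part P in X joins the base of the pair; b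
  -- returns as a parameter in the additivity formula.
  stable-++ : ∀ {n m u v} {a : Vec M n} {b : Vec M m} {X} → StableRank a (⟪ b ⟫ ∪ X) (⟪ b ⟫ ∪ X) u →
              StableRank b X X v → StableRank (a ++ b) X X (u + v)
  stable-++ {u = u} {v} {a} {b} {X} s t = from (split-tuple (All.map [ inj₂ , inj₁ ] (base∈ s)))
    where
    from : (∃ λ l → Σ[ P ∈ Vec M l ] P ∈ᵗ X × ⟪ base s ⟫ ⊆ ⟪ P ⟫ ∪ ⟪ b ⟫) → StableRank (a ++ b) X X (u + v)
    from (_ , P , P∈ , s⊆) = mkStable A (++⁺ (base∈ t) P∈) (λ U → exceeds (U-++-≤ {a = a} {b} U)) λ {_} {B} B∈ →
      subst (U[ a ++ b / B ]≥_) (+-comm v u) (U-++-≥ (lower t B∈) (lower s (++⁺ (⊆⇒∈ᵗ inj₁) (All.map inj₂ B∈))))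
      where
      A : Vec M _
      A = base t ++ P
      exceeds : ¬ (∃ λ p → ∃ λ q → p + q ≡ suc (u + v) × U[ b / A ]≥ p × U[ a / b ++ A ]≥ q)
      exceeds (p , q , eq , Ub , Ua) = <⇒≱ (≤-reflexive (sym eq)) (≤-trans
        (+-mono-≤ (U-compare Ub λ U → upper t (U-mono (++-⊆ˡ {a = base t}) U))
                  (U-compare Ua λ U → upper s (U-mono
                    (λ x∈ → [ (λ z → ++-⊆ʳ b (++-⊆ʳ (base t) z)) , ++-⊆ˡ ]′ (s⊆ x∈)) U)))
        (≤-reflexive (+-comm v u)))

  -- Bounded closure

  Algebraic : ∀ {n k} → Vec M n → Vec M k → Set (lsuc ℓ)
  Algebraic a A = ∀ 𝒩 → A ∈ᵗ ⌊ 𝒩 ⌋ → a ∈ᵗ ⌊ 𝒩 ⌋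

  in-model⇒rank≡0 : ∀ {n m} {a : Vec M n} {𝒩} → a ∈ᵗ ⌊ 𝒩 ⌋ → ¬ RankAtLeast (suc m) a 𝒩
  in-model⇒rank≡0 {a = a} {𝒩} a∈ (ℬ , 𝒩⊆ , dep , _) = dep (⫝⇒↓ⁿˢ {𝒩} {a = a} 𝒩⊆ λ _ → params-⫝ a∈)

  -- A tuple outside 𝒩 depends over 𝒩 on any larger model that contains it, by `⫝-self`, and so has
  -- rank at least 1.
  U≡0⇒Algebraic : ∀ {n k} {a : Vec M n} {A : Vec M k} → ¬ (U[ a / A ]≥ 1) → Algebraic a A
  U≡0⇒Algebraic {a = a} ¬U 𝒩 A∈ = decidable-stable em λ a∉ →
    let (ℬ , 𝒩⊆ , a∈ℬ) = extend 𝒩 a in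
    ¬U (mkU 𝒩 A∈ (ℬ , 𝒩⊆ , (λ ind → a∉ (⫝-self (↓ⁿˢ⇒⫝ {𝒩} {a = a} ind (All.map inj₂ a∈ℬ)))) , tt))

  Algebraic⇒U≡0 : ∀ {n k} {a : Vec M n} {A : Vec M k} → Algebraic a A → ¬ (U[ a / A ]≥ 1)
  Algebraic⇒U≡0 alg (mkU 𝒩 A∈ rank) = in-model⇒rank≡0 {m = 0} {𝒩 = 𝒩} (alg 𝒩 A∈) rank

  -- All realizations lie in one model 𝒩 around A: if σ fixes A and takes y to x, then x lies in σ ⋆
  -- 𝒩, and hence y in 𝒩.
  Algebraic⇒∈bcl : ∀ {k x} {A : Vec M k} {X} → A ∈ᵗ X → Algebraic (x ∷ []) A → x ∈ bcl X
  Algebraic⇒∈bcl {x = x} {A} {X} A∈ alg = let (𝒩 , _ , A∈𝒩) = tuple-model A in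
    ⊆model⇒Bounded {λ y → y ∷ [] ≡ᵗ x ∷ [] over X} 𝒩 λ {y} y≡x →
      from {𝒩} A∈𝒩 (≡ᵗ⇒≈ {a = y ∷ []} {x ∷ []} y≡x A∈)
    where
    from : ∀ {𝒩 y} → A ∈ᵗ ⌊ 𝒩 ⌋ → y ∷ [] ≈[ A ] x ∷ [] → y ∈ ⌊ 𝒩 ⌋
    from {𝒩} A∈𝒩 (σ , fσ , σy≡x)
      with alg (σ ⋆ 𝒩) (subst (_∈ᵗ ⌊ σ ⋆ 𝒩 ⌋) (Fixes-⊙ σ fσ (∈ᵗ-self A)) (∈ᵗ-⋆ σ 𝒩 A∈𝒩))
    ... | (d , σd≡x) ∷ [] = d , ·-injective σ (trans σd≡x (sym (∷-injectiveˡ σy≡x)))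

  -- A type of positive rank has a realization outside any given model.

  ∈bcl⇒Algebraic : ∀ {X 𝒩 x} → X ⊆ ⌊ 𝒩 ⌋ → x ∈ bcl X →
                   ∃ λ k → Σ[ A ∈ Vec M k ] A ∈ᵗ X × Algebraic (x ∷ []) A
  ∈bcl⇒Algebraic {X} {𝒩} {x} X⊆𝒩 x∈ = from (stable-rank (x ∷ []) X)
    where
    from : ∃ (StableRank (x ∷ []) X X) → ∃ λ k → Σ[ A ∈ Vec M k ] A ∈ᵗ X × Algebraic (x ∷ []) A
    from (zero  , s) = -, base s , base∈ s , U≡0⇒Algebraic (upper s)
    from (suc u , s) =
      let (𝒩′ , ⊆𝒩′) = Bounded⇒⊆model x∈ ; (𝒟 , 𝒩⊆ , 𝒩′⊆) = join 𝒩 𝒩′ in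
      contradiction (stable-realize id s 𝒟 (λ y∈ → 𝒩⊆ (X⊆𝒩 y∈))) λ (σ , _ , rank , same) →
        in-model⇒rank≡0 {m = u} {a = σ ⊙ (x ∷ [])} {𝒟} (𝒩′⊆ (⊆𝒩′ (≈⇒≡ᵗ λ B B∈ →
          ≈-mono (++-⊆ʳ (base s)) (≈-sym (≡ᴸ⇒≈ (same B∈))))) ∷ []) rank

  ∈ᵗbcl⇒Algebraic : ∀ {X 𝒩} → X ⊆ ⌊ 𝒩 ⌋ → ∀ {n} {a : Vec M n} → a ∈ᵗ bcl X →
                    ∃ λ k → Σ[ A ∈ Vec M k ] A ∈ᵗ X × Algebraic a A
  ∈ᵗbcl⇒Algebraic X⊆𝒩 [] = 0 , [] , [] , λ _ _ → []
  ∈ᵗbcl⇒Algebraic {𝒩 = 𝒩} X⊆𝒩 (x∈ ∷ a∈) =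
    let (_ , A , A∈ , x-alg) = ∈bcl⇒Algebraic {𝒩 = 𝒩} X⊆𝒩 x∈ ; (_ , B , B∈ , a-alg) = ∈ᵗbcl⇒Algebraic {𝒩 = 𝒩} X⊆𝒩 a∈ in
    -, A ++ B , ++⁺ A∈ B∈ , λ 𝒩 AB∈ → All.head (x-alg 𝒩 (++ˡ⁻ A AB∈)) ∷ a-alg 𝒩 (++ʳ⁻ A AB∈)

  Algebraic⇒∈ᵗbcl : ∀ {n k} {a : Vec M n} {A : Vec M k} {X} → A ∈ᵗ X → Algebraic a A → a ∈ᵗ bcl X
  Algebraic⇒∈ᵗbcl {a = []}    A∈ alg = []
  Algebraic⇒∈ᵗbcl {a = _ ∷ _} A∈ alg = Algebraic⇒∈bcl A∈ (λ 𝒩 A∈𝒩 → All.head (alg 𝒩 A∈𝒩) ∷ [])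
                                     ∷ Algebraic⇒∈ᵗbcl A∈ (λ 𝒩 A∈𝒩 → All.tail (alg 𝒩 A∈𝒩))

  ∈⇒∈bcl : ∀ {X} → X ⊆ bcl X
  ∈⇒∈bcl x∈ = Algebraic⇒∈bcl (x∈ ∷ []) λ _ z∈ → z∈

  -- Properties of independence, rank and bounded closure

  bounded-∪⊆model : ∀ {X Y} → Bounded X → Bounded Y → Σ[ 𝒩 ∈ Model ] X ∪ Y ⊆ ⌊ 𝒩 ⌋
  bounded-∪⊆model X-bounded Y-bounded =
    let (𝒩 , X⊆) = Bounded⇒⊆model X-bounded ; (𝒩′ , Y⊆) = Bounded⇒⊆model Y-bounded
        (𝒟 , 𝒩⊆ , 𝒩′⊆) = join 𝒩 𝒩′
    in 𝒟 , [ (λ x∈ → 𝒩⊆ (X⊆ x∈)) , (λ x∈ → 𝒩′⊆ (Y⊆ x∈)) ]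

  ⟪⟫-bounded : ∀ {n} (a : Vec M n) → Bounded ⟪ a ⟫
  ⟪⟫-bounded a = let (𝒩 , _ , a∈) = tuple-model a in ⊆model⇒Bounded 𝒩 (∈ᵗ⇒⊆ a∈)

  Rank-∅-finite : ∀ {n} (a : Vec M n) → ∃ λ u → Rank a ⟪ [] ⟫ (fin u)
  Rank-∅-finite a = let (u , s) = stable-rank a ⟪ [] ⟫ in u , stable⇒Rank s

  module _ {A : Subset} where

    ↓-local-character : ∀ {n} (a : Vec M n) → ∃ λ k → Σ[ A₀ ∈ Vec M k ] A₀ ∈ᵗ A × a ↓[ ⟪ A₀ ⟫ ] A
    ↓-local-character a = let (u , s) = stable-rank a A in
      -, base s , base∈ s , stable⇒↓ (mkStable (base s) (∈ᵗ-self (base s)) (upper s) λ B∈ →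
        lower s (All.map [ ∈ᵗ⇒⊆ (base∈ s) , id ] B∈))

    Rank-++ : ∀ {n m} (a : Vec M n) (b : Vec M m) →
      ∃ λ u → ∃ λ v → Rank a (⟪ b ⟫ ∪ A) (fin u) × Rank b A (fin v) × Rank (a ++ b) A (fin (u + v))
    Rank-++ a b = let (u , s) = stable-rank a (⟪ b ⟫ ∪ A) ; (v , t) = stable-rank b A in
      u , v , stable⇒Rank s , stable⇒Rank t , stable⇒Rank (stable-++ s t)

  module _ {A : Subset} (A-bounded : Bounded A) where

    ↓-sym : ∀ {n m} (a : Vec M n) (b : Vec M m) → a ↓[ A ] ⟪ b ⟫ → b ↓[ A ] ⟪ a ⟫
    ↓-sym a b ind =
      let (𝒩 , ⊆𝒩) = bounded-∪⊆model A-bounded (⟪⟫-bounded b)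
          (_ , s) = ↓⇒stable {𝒩 = 𝒩} ⊆𝒩 ind ; (_ , t) = stable-rank b A
      in stable⇒↓ (stable-sym s t)

    bcl-local-character : ∀ {n} (a : Vec M n) → a ∈ᵗ bcl A → ∃ λ k → Σ[ A₀ ∈ Vec M k ] A₀ ∈ᵗ A × a ∈ᵗ bcl ⟪ A₀ ⟫
    bcl-local-character a a∈ =
      let (𝒩 , A⊆𝒩) = Bounded⇒⊆model A-bounded ; (_ , A₀ , A₀∈ , alg) = ∈ᵗbcl⇒Algebraic {𝒩 = 𝒩} A⊆𝒩 a∈ in
      -, A₀ , A₀∈ , Algebraic⇒∈ᵗbcl (∈ᵗ-self A₀) alg

    bcl-idem : bcl (bcl A) ≐ bcl A
    bcl-idem = (λ x∈ → from (Bounded⇒⊆model A-bounded) x∈) , ∈⇒∈bcl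
      where
      from : (Σ[ 𝒩 ∈ Model ] A ⊆ ⌊ 𝒩 ⌋) → bcl (bcl A) ⊆ bcl A
      from (𝒩 , A⊆𝒩) x∈ = conclude (∈bcl⇒Algebraic {𝒩 = 𝒩} bcl⊆𝒩 x∈)
        where
        -- A model around A contains bcl(A), so the closure is bounded and `∈bcl⇒Algebraic` applies
        -- to it as a parameter set.
        bcl⊆𝒩 : bcl A ⊆ ⌊ 𝒩 ⌋
        bcl⊆𝒩 y∈ = let (_ , A₀ , A₀∈ , alg) = ∈bcl⇒Algebraic {𝒩 = 𝒩} A⊆𝒩 y∈ in
          All.head (alg 𝒩 (All.map A⊆𝒩 A₀∈))
        conclude : ∀ {x} → (∃ λ k → Σ[ B ∈ Vec M k ] B ∈ᵗ bcl A × Algebraic (x ∷ []) B) → x ∈ bcl A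
        conclude (_ , B , B∈ , x-alg) = let (_ , A₀ , A₀∈ , B-alg) = ∈ᵗbcl⇒Algebraic {𝒩 = 𝒩} A⊆𝒩 B∈ in
          Algebraic⇒∈bcl A₀∈ λ 𝒩′ A₀∈𝒩′ → x-alg 𝒩′ (B-alg 𝒩′ A₀∈𝒩′)

    ∈bcl⇒↓ : ∀ {B n} (a : Vec M n) → a ∈ᵗ bcl A → a ↓[ A ] B
    ∈bcl⇒↓ a a∈ =
      let (𝒩 , A⊆𝒩) = Bounded⇒⊆model A-bounded ; (_ , A₀ , A₀∈ , alg) = ∈ᵗbcl⇒Algebraic {𝒩 = 𝒩} A⊆𝒩 a∈ in
      stable⇒↓ {u = 0} (mkStable A₀ A₀∈ (Algebraic⇒U≡0 alg) λ _ → U≥0 a _)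

    module _ {B : Subset} (B-bounded : Bounded B) where

      ↓⇒stable-rank : ∀ {n} {a : Vec M n} → a ↓[ A ] B → ∃ (StableRank a A (A ∪ B))
      ↓⇒stable-rank ind = let (𝒩 , ⊆𝒩) = bounded-∪⊆model A-bounded B-bounded in ↓⇒stable {𝒩 = 𝒩} ⊆𝒩 ind

      module _ (A⊆B : A ⊆ B) where

        ↓-finite-character : ∀ {n} (a : Vec M n) → ¬ (a ↓[ A ] B) → ∃ λ m → Σ[ b ∈ Vec M m ] b ∈ᵗ B × ¬ (a ↓[ A ] ⟪ b ⟫)
        ↓-finite-character a dep = from (stable-rank a A)
          where
          from : ∃ (StableRank a A A) → ∃ λ m → Σ[ b ∈ Vec M m ] b ∈ᵗ B × ¬ (a ↓[ A ] ⟪ b ⟫)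
          from (u , s) = drop (decidable-stable em λ none → dep (stable⇒↓
            (mkStable (base s) (base∈ s) (upper s) λ {_} {E} E∈ → decidable-stable em λ ¬U → none (-, E , E∈ , ¬U))))
            where
            drop : (∃ λ m → Σ[ E ∈ Vec M m ] E ∈ᵗ A ∪ B × ¬ (U[ a / E ]≥ u)) →
                   ∃ λ m → Σ[ b ∈ Vec M m ] b ∈ᵗ B × ¬ (a ↓[ A ] ⟪ b ⟫)
            -- The finite set E over which the rank falls below u is itself the tuple sought: it
            -- lies in B as A ⊆ B, and independence from E over A would keep the rank at u.
            drop (_ , E , E∈ , ¬U) = -, E , All.map [ A⊆B , id ] E∈ , λ ind →
              let (𝒩 , ⊆𝒩) = bounded-∪⊆model A-bounded (⟪⟫-bounded E) ; (v , t) = ↓⇒stable {𝒩 = 𝒩} ⊆𝒩 ind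
              in ¬U (U-≤ (U-compare (lower s (base∈ t)) (upper t)) (lower t (⊆⇒∈ᵗ inj₂)))

        ↓-stationary : ∀ {n} (a b : Vec M n) → a ≡ᴸ b over A → a ↓[ A ] B → b ↓[ A ] B → a ≡ᴸ b over B
        ↓-stationary a b a≡b a↓B b↓B = from (↓⇒stable-rank a↓B) (↓⇒stable-rank b↓B)
          where
          from : ∃ (StableRank a A (A ∪ B)) → ∃ (StableRank b A (A ∪ B)) → a ≡ᴸ b over B
          from (u , s) (v , t) C C∈ = ≡ᴸ-mono (++-⊆ʳ A₀) (U-stationary (++-⊆ˡ {a = A₀}) A₀≡
              (λ U → upper s (U-mono ++-⊆ˡ U)) (lower s A₀C∈) (U-≤ u≤v (lower t A₀C∈))) C (∈ᵗ-self C)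
            where
            A₀ : Vec M _
            A₀ = base s ++ base t
            A₀∈ : A₀ ∈ᵗ A
            A₀∈ = ++⁺ (base∈ s) (base∈ t)
            A₀C∈ : A₀ ++ C ∈ᵗ A ∪ B
            A₀C∈ = ++⁺ (All.map inj₁ A₀∈) (All.map inj₂ C∈)
            A₀≡ : a ≡ᴸ b over ⟪ A₀ ⟫
            A₀≡ = ≡ᴸ-mono (∈ᵗ⇒⊆ A₀∈) a≡b
            u≤v : u ≤ v
            u≤v = U-compare (U-≈ (≡ᴸ⇒≈ A₀≡) (lower s (All.map inj₁ A₀∈))) λ U → upper t (U-mono (++-⊆ʳ (base s)) U)

        ↓-extension : ∀ {n} (a : Vec M n) → Σ[ b ∈ Vec M n ] b ≡ᴸ a over A × b ↓[ A ] B
        ↓-extension {n} a = from (stable-rank a A) (bounded-∪⊆model A-bounded B-bounded)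
          where
          from : ∃ (StableRank a A A) → (Σ[ 𝒩 ∈ Model ] A ∪ B ⊆ ⌊ 𝒩 ⌋) → Σ[ b ∈ Vec M n ] b ≡ᴸ a over A × b ↓[ A ] B
          from (u , s) (𝒩 , ⊆𝒩) = realized (stable-realize id s 𝒩 λ x∈ → ⊆𝒩 (inj₁ x∈))
            where
            realized : StableRealization s 𝒩 → Σ[ b ∈ Vec M n ] b ≡ᴸ a over A × b ↓[ A ] B
            realized (σ , fσ , rank , same) = σ ⊙ a
              , (λ C C∈ → ≡ᴸ-mono (++-⊆ʳ (base s)) (≡ᴸ-sym (same C∈)) C (∈ᵗ-self C))
              , stable⇒↓ (mkStable (base s) (base∈ s) (λ U → upper s (U-fixed σ fσ U)) λ E∈ →
                  mkU 𝒩 (All.map ⊆𝒩 E∈) rank)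

        ↓⇔equal-rank : ∀ {n} (a : Vec M n) → (a ↓[ A ] B) ⇔ (∃ λ u → Rank a B u × Rank a A u)
        ↓⇔equal-rank a = mk⇔ (λ ind → let (u , s) = ↓⇒stable-rank ind in
            fin u , stable⇒Rank (StableRank-mono A⊆B inj₂ s) , stable⇒Rank (StableRank-mono id inj₁ s))
          (λ (v , rank-B , rank-A) → from (Rank⇒stable rank-A) (Rank⇒stable rank-B))
          where
          from : ∀ {v} → (∃ λ u → v ≡ fin u × StableRank a A A u) → (∃ λ u → v ≡ fin u × StableRank a B B u) → a ↓[ A ] B
          from (u , refl , s) (_ , refl , t) = stable⇒↓ (mkStable (base s) (base∈ s) (upper s) λ E∈ →
            lower t (All.map [ A⊆B , id ] E∈))

        -- The rank of a over a finite part of B is 0. Independence would carry this to a base in A,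
        -- over which a would then be algebraic.
        bcl-reflexive : ∀ {n} (a : Vec M n) → a ∈ᵗ bcl B → ¬ (a ∈ᵗ bcl A) → ¬ (a ↓[ A ] B)
        bcl-reflexive a a∈B a∉A ind =
          let (u , s) = ↓⇒stable-rank ind ; (𝒩 , B⊆𝒩) = Bounded⇒⊆model B-bounded
              (_ , B₀ , B₀∈ , alg) = ∈ᵗbcl⇒Algebraic {𝒩 = 𝒩} B⊆𝒩 a∈B
          in a∉A (Algebraic⇒∈ᵗbcl (base∈ s) (U≡0⇒Algebraic λ U → upper s (U-≤
               (s≤s (U-compare (lower s (All.map inj₂ B₀∈)) (Algebraic⇒U≡0 alg))) U)))

  ↓-mono : ∀ {A B C D} → Bounded A → Bounded D → A ⊆ B → B ⊆ C → C ⊆ D → ∀ {n} (a : Vec M n) → a ↓[ A ] D → a ↓[ B ] C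
  ↓-mono A-bounded D-bounded A⊆B B⊆C C⊆D a ind = let (u , s) = ↓⇒stable-rank A-bounded D-bounded {a = a} ind in
    stable⇒↓ {a = a} (StableRank-mono A⊆B [ (λ x∈ → inj₂ (C⊆D (B⊆C x∈))) , (λ x∈ → inj₂ (C⊆D x∈)) ] s)

  ↓-transitive : ∀ {A B C} → Bounded A → Bounded B → Bounded C → A ⊆ B → B ⊆ C →
                 ∀ {n} (a : Vec M n) → a ↓[ A ] B → a ↓[ B ] C → a ↓[ A ] C
  ↓-transitive A-bounded B-bounded C-bounded A⊆B B⊆C a ind ind′ =
    let (u , s) = ↓⇒stable-rank A-bounded B-bounded {a = a} ind
        (v , t) = ↓⇒stable-rank B-bounded C-bounded {a = a} ind′
    in stable⇒↓ {a = a} (mkStable (base s) (base∈ s) (upper s) λ E∈ →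
         U-≤ (stable-unique (StableRank-mono A⊆B inj₂ s) (StableRank-mono id inj₁ t))
           (lower t (All.map [ (λ x∈ → inj₁ (A⊆B x∈)) , inj₂ ] E∈)))

  bcl-model : ∀ 𝒜 → bcl ⌊ 𝒜 ⌋ ≐ ⌊ 𝒜 ⌋
  bcl-model 𝒜 = (λ x∈ → let (_ , A , A∈ , alg) = ∈bcl⇒Algebraic {𝒩 = 𝒜} id x∈ in All.head (alg 𝒜 A∈)) , ∈⇒∈bcl

theorem2p70 :
  ({a : Level} → ExcludedMiddle a) →
  ({a b : Level} → Extensionality a b) →
  ∀ {ℓ} {L : Language ℓ} (𝒦 : AEC L) (monster : Monster 𝒦) →
  let open MonsterNotions monster in
  IsFUR →
  ∀ (A B C D : Subset) → Bounded A → Bounded B → Bounded C → Bounded D →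
  A ⊆ B → B ⊆ C → C ⊆ D →
  -- (i) local character
  (∀ {n} (a : Vec M n) → ∃ λ k → Σ[ A₀ ∈ Vec M k ] A₀ ∈ᵗ A × a ↓[ ⟪ A₀ ⟫ ] A)
  -- (ii) finite character
  × (∀ {n} (a : Vec M n) → ¬ (a ↓[ A ] B) →
       ∃ λ m → Σ[ b ∈ Vec M m ] b ∈ᵗ B × ¬ (a ↓[ A ] ⟪ b ⟫))
  -- (iii) stationarity
  × (∀ {n} (a b : Vec M n) → a ≡ᴸ b over A → a ↓[ A ] B → b ↓[ A ] B → a ≡ᴸ b over B)
  -- (iv) extension
  × (∀ {n} (a : Vec M n) → Σ[ b ∈ Vec M n ] b ≡ᴸ a over A × b ↓[ A ] B)
  -- (v) monotonicity
  × (∀ {n} (a : Vec M n) → a ↓[ A ] D → a ↓[ B ] C)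
  -- (vi) transitivity
  × (∀ {n} (a : Vec M n) → a ↓[ A ] B → a ↓[ B ] C → a ↓[ A ] C)
  -- (vii) symmetry
  × (∀ {n m} (a : Vec M n) (b : Vec M m) → a ↓[ A ] ⟪ b ⟫ → b ↓[ A ] ⟪ a ⟫)
  -- (viii) U-ranks
  × (∀ {n} (a : Vec M n) → (a ↓[ A ] B) ⇔ (∃ λ u → Rank a B u × Rank a A u))
  -- (ix) finiteness of U-rank
  × (∀ {n} (a : Vec M n) → ∃ λ u → Rank a ⟪ [] ⟫ (fin u))
  -- (x) addition of ranks
  × (∀ {n m} (a : Vec M n) (b : Vec M m) →
       ∃₂ λ u v → Rank a (⟪ b ⟫ ∪ A) (fin u) × Rank b A (fin v) × Rank (a ++ b) A (fin (u + v)))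
  -- (xi) independence of bcl
  × (∀ {n} (a : Vec M n) → a ∈ᵗ bcl A → a ↓[ A ] B)
  -- (xii) reflexivity
  × (∀ {n} (a : Vec M n) → a ∈ᵗ bcl B → ¬ (a ∈ᵗ bcl A) → ¬ (a ↓[ A ] B))
  -- (xiii) local character of bcl
  × (∀ {n} (a : Vec M n) → a ∈ᵗ bcl A → ∃ λ k → Σ[ A₀ ∈ Vec M k ] A₀ ∈ᵗ A × a ∈ᵗ bcl ⟪ A₀ ⟫)
  -- (xiv) closure
  × (bcl (bcl A) ≐ bcl A)
  -- (xv) models are closed
  × (∀ (𝒜 : Model) → bcl ⌊ 𝒜 ⌋ ≐ ⌊ 𝒜 ⌋)
theorem2p70 em _ 𝒦 monster fur A B C D A-bd B-bd C-bd D-bd A⊆B B⊆C C⊆D =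
    ↓-local-character
  , ↓-finite-character A-bd B-bd A⊆B
  , ↓-stationary A-bd B-bd A⊆B
  , ↓-extension A-bd B-bd A⊆B
  , ↓-mono A-bd D-bd A⊆B B⊆C C⊆D
  , ↓-transitive A-bd B-bd C-bd A⊆B B⊆C
  , ↓-sym A-bd
  , ↓⇔equal-rank A-bd B-bd A⊆B
  , Rank-∅-finite
  , Rank-++
  , ∈bcl⇒↓ A-bd
  , bcl-reflexive A-bd B-bd A⊆B
  , bcl-local-character A-bd
  , bcl-idem A-bd
  , bcl-model
  where
  open Independence em monster fur
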